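{- Let $T$ be a hook-valued tableau, $(P_1,Q_1)=\mathcal{U}_{\mathcal{L}^\infty\mathcal{A}^\infty}(T)$ and $(P_2,Q_2)=\mathcal{U}_{\mathcal{A}^\infty\mathcal{L}^\infty}(T)$. Then $P_2=P_1$ and $Q_2=\mathsf{shuff}(Q_1)$.
   Context: French notation: cell $(i,j)$ in row $i$ (bottom to top), column $j$ (left to right). A hook-valued tableau of shape $\lambda$: each cell of $\lambda$ contains a hook-shaped semistandard tableau with hook entry $h$, leg entries $L_1<\dots<L_\ell$ above ($h<L_1$), arm entries $A_1\le\dots\le A_k$ to the right ($h\le A_1$), positive integers; every entry of a cell is weakly smaller than every entry of the cell to its right and strictly smaller than every entry of the cell above. Arm bumping $\mathcal{A}_b$: if no arms, identity. Else let $c$ be the rightmost column containing an arm entry, $a$ the largest arm entry there (rightmost copy), in cell $(r,c)$. If column $c+1$ has an entry $\ge a$, let $k$ be the smallest, in $(\tilde r,c+1)$: remove $a$ from $(r,c)$, replace this $k$ by $a$, add $k$ as an arm of $(\tilde r,c+1)$; if $\tilde r=r$, also move the legs of $(r,c)$ greater than $a$ to $(r,c+1)$ as legs. Otherwise create a new cell on top of column $c+1$ containing $a$; if it is $(r,c+1)$, also move the legs of $(r,c)$ greater than $a$ into it. Leg bumping $\mathcal{L}_b$: if no legs, identity. Else let $r$ be the topmost row containing a leg, $\ell$ the largest leg in row $r$, in cell $(r,c)$. If row $r+1$ has an entry $>\ell$, let $k$ be the smallest, in $(r+1,\tilde c)$: remove $\ell$ from $(r,c)$, replace this $k$ by $\ell$,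 add $k$ as a leg of $(r+1,\tilde c)$; if $\tilde c=c$, also move the arms of $(r,c)$ that are $\le\ell$ to $(r+1,c)$ as arms. Otherwise create a new cell at the end of row $r+1$ containing $\ell$; if it is $(r+1,c)$, also move the arms of $(r,c)$ that are $\le\ell$ into it. $\mathcal{A}(T)=\mathcal{A}_b^m(T)$ with $m$ minimal such that the shape grows (identity if no arms); $\mathcal{L}$ likewise. For a word $f_n\cdots f_1$ in $\{\mathcal{A},\mathcal{L}\}$, $T_i=f_i\circ\cdots\circ f_1(T)$ of shape $\lambda^{(i)}$, $\mathcal{U}_{f_n\cdots f_1}(T)=(P,Q)$ with $P=T_n$ and $Q$ the filling of $\lambda^{(n)}/\lambda^{(0)}$ whose new cell $\lambda^{(i)}/\lambda^{(i-1)}$ (when one is added) contains $\alpha_c$ if $f_i=\mathcal{A}$ ($c$ the column of the cell of $T_{i-1}$ holding the largest arm entry of its rightmost column with arms) and $\beta_r$ if $f_i=\mathcal{L}$ ($r$ the topmost row of $T_{i-1}$ containing a leg). $\mathcal{U}_{\mathcal{L}^\infty\mathcal{A}^\infty}(T):=\mathcal{U}_{\mathcal{L}^N\mathcal{A}^M}(T)$ and $\mathcal{U}_{\mathcal{A}^\infty\mathcal{L}^\infty}(T):=\mathcal{U}_{\mathcal{A}^M\mathcal{L}^N}(T)$ for $M\ge$ #arm entries, $N\ge$ #leg entries of $T$. Shuffle: for a mixed tableau $Q$ (filling of a skew shape by symbols $\alpha_k,\beta_k$) that is flagged ($\alpha_k$ at $(i,j)$ has $0<k<j$, $\beta_k$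 at $(i,j)$ has $0<k<i$), $\alpha$-column-strict, $\beta$-row-strict (for $\gamma\in\{\alpha,\beta\}$: $\gamma_i$ weakly southwest of $\gamma_j$ implies $i\ge j$, and $\alpha$-entries in a common column, resp. $\beta$-entries in a common row, have distinct indices) and $(\alpha,\beta)$-sorted ($\alpha$-cells form $\nu/\lambda$, $\beta$-cells form $\mu/\nu$, $\lambda\subseteq\nu\subseteq\mu$ partitions), $\mathsf{shuff}(Q)$ is obtained by repeatedly choosing, among $\alpha$-entries with a $\beta$-entry directly above or directly right, the rightmost one with smallest index $\alpha_i$, and while a $\beta$ lies directly above or right of it, swapping $\alpha_i$ with it if only one exists, and if $\beta_k$ is above and $\beta_j$ right, swapping with $\beta_k$ when $k>j$ and with $\beta_j$ when $k\le j$; until no $\alpha$-entry has a $\beta$-entry directly above or right.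
   Formalization: In leg bumping, the arms of (r,c) that move along with ℓ are those ≥ ℓ, not those ≤ ℓ as printed; with ≤ the claim fails, e.g. for the single cell with hook 2, legs 5, 8 and arm 6. -}

module Defs where

open import Data.Nat using (ℕ; zero; suc; _≤_; _<_; _≤ᵇ_; _<ᵇ_; _≡ᵇ_; _⊔_)
open import Data.Bool using (Bool; true; false; if_then_else_; _∧_; _∨_; not)
open import Data.List using (List; []; _∷_; _++_; length; map; foldr; foldl; concatMap)
open import Data.Nat.ListAction using (sum)
open import Data.List.Relation.Unary.Linked using (Linked)
open import Data.List.Relation.Unary.Any using (Any)
open import Data.Maybe using (Maybe; just; nothing)
open import Data.Product using (_×_; _,_; Σ)
open import Relation.Binary.PropositionalEquality using (_≡_)
open import Relation.Nullary using (¬_)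

-- Conventions.
-- A tableau is a list of rows, bottom row first (French notation); each
-- row is a list of cells, leftmost first.  Internal list indices are
-- 0-based: the cell at list position (i , j) is the paper's cell
-- (i+1 , j+1).  Labels α_c / β_r of the recording tableau use the
-- paper's 1-based column / row numbers.

-- A hook-shaped semistandard tableau: hook entry, legs (increasing, from
-- bottom to top), arms (weakly increasing, from left to right).
record Cell : Set where
  constructor cell
  field
    hook : ℕ
    legs : List ℕ
    arms : List ℕ
open Cell public

Tableau : Set
Tableau = List (List Cell)

entries : Cell → List ℕ
entries x = hook x ∷ legs x ++ arms x

nth : {A : Set} → A → List A → ℕ → A
nth d [] _ = d
nth d (x ∷ xs) zero = x
nth d (x ∷ xs) (suc i) = nth d xs i

modifyAt : {A : Set} → ℕ → (A → A) → List A → List A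
modifyAt _ f [] = []
modifyAt zero f (x ∷ xs) = f x ∷ xs
modifyAt (suc i) f (x ∷ xs) = x ∷ modifyAt i f xs

appendAt : {A : Set} → List (List A) → ℕ → A → List (List A)
appendAt [] _ x = (x ∷ []) ∷ []
appendAt (r ∷ rs) zero x = (r ++ (x ∷ [])) ∷ rs
appendAt (r ∷ rs) (suc i) x = r ∷ appendAt rs i x

indexed : {A : Set} → ℕ → List A → List (ℕ × A)
indexed n [] = []
indexed n (x ∷ xs) = (n , x) ∷ indexed (suc n) xs

cellsOf : {A : Set} → List (List A) → List (ℕ × ℕ × A)
cellsOf T = concatMap (λ { (i , row) → map (λ { (j , x) → (i , j , x) }) (indexed 0 row) }) (indexed 0 T)

filterB : {A : Set} → (A → Bool) → List A → List A
filterB p [] = []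
filterB p (x ∷ xs) = if p x then x ∷ filterB p xs else filterB p xs

elemB : ℕ → List ℕ → Bool
elemB k [] = false
elemB k (x ∷ xs) = (k ≡ᵇ x) ∨ elemB k xs

ins : ℕ → List ℕ → List ℕ
ins x [] = x ∷ []
ins x (y ∷ ys) = if x ≤ᵇ y then x ∷ y ∷ ys else y ∷ ins x ys

insAll : List ℕ → List ℕ → List ℕ
insAll xs ys = foldr ins ys xs

removeOne : ℕ → List ℕ → List ℕ
removeOne k [] = []
removeOne k (x ∷ xs) = if k ≡ᵇ x then xs else x ∷ removeOne k xs

maxList : List ℕ → ℕ
maxList = foldr _⊔_ 0

minWith : (ℕ → Bool) → List ℕ → Maybe ℕ
minWith p [] = nothing
minWith p (x ∷ xs) with minWith p xs
... | nothing = if p x then just x else nothing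
... | just y = if p x ∧ (x <ᵇ y) then just x else just y

iter : {A : Set} → (A → A) → ℕ → A → A
iter f zero x = x
iter f (suc n) x = f (iter f n x)

size : Tableau → ℕ
size T = sum (map length T)

shape : Tableau → List ℕ
shape T = map length T

numArms numLegs : Tableau → ℕ
numArms T = sum (map (λ row → sum (map (λ x → length (arms x)) row)) T)
numLegs T = sum (map (λ row → sum (map (λ x → length (legs x)) row)) T)

cellAt : Tableau → ℕ → ℕ → Maybe Cell
cellAt T i j = nth nothing (map just (nth [] T i)) j

record HookValued (T : Tableau) : Set where
  field
    rowsNonEmpty : ∀ i → i < length T → 1 ≤ length (nth [] T i)
    rowsDecr     : ∀ i → length (nth [] T (suc i)) ≤ length (nth [] T i)
    hookPos   : ∀ i j x → cellAt T i j ≡ just x → 1 ≤ hook x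
    legsIncr  : ∀ i j x → cellAt T i j ≡ just x → Linked _<_ (hook x ∷ legs x)
    armsWeak  : ∀ i j x → cellAt T i j ≡ just x → Linked _≤_ (hook x ∷ arms x)
    rowWeak : ∀ i j x y → cellAt T i j ≡ just x → cellAt T i (suc j) ≡ just y →
              ∀ u v → Any (u ≡_) (entries x) → Any (v ≡_) (entries y) → u ≤ v
    colStrict : ∀ i j x y → cellAt T i j ≡ just x → cellAt T (suc i) j ≡ just y →
              ∀ u v → Any (u ≡_) (entries x) → Any (v ≡_) (entries y) → u < v

findArm : Tableau → Maybe (ℕ × ℕ × ℕ × Cell)
findArm T = foldl step nothing (cellsOf T)
  where
  better : ℕ × ℕ × ℕ × Cell → ℕ × ℕ × ℕ × Cell → Bool
  better (_ , j , a , _) (_ , j' , a' , _) = (j' <ᵇ j) ∨ ((j' ≡ᵇ j) ∧ (a' <ᵇ a))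
  step : Maybe (ℕ × ℕ × ℕ × Cell) → ℕ × ℕ × Cell → Maybe (ℕ × ℕ × ℕ × Cell)
  step best (i , j , x) with arms x
  ... | [] = best
  ... | as@(_ ∷ _) with best
  ...   | nothing = just (i , j , maxList as , x)
  ...   | just old = if better (i , j , maxList as , x) old then just (i , j , maxList as , x) else just old

findLeg : Tableau → Maybe (ℕ × ℕ × ℕ × Cell)
findLeg T = foldl step nothing (cellsOf T)
  where
  better : ℕ × ℕ × ℕ × Cell → ℕ × ℕ × ℕ × Cell → Bool
  better (i , _ , a , _) (i' , _ , a' , _) = (i' <ᵇ i) ∨ ((i' ≡ᵇ i) ∧ (a' <ᵇ a))
  step : Maybe (ℕ × ℕ × ℕ × Cell) → ℕ × ℕ × Cell → Maybe (ℕ × ℕ × ℕ × Cell)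
  step best (i , j , x) with legs x
  ... | [] = best
  ... | ls@(_ ∷ _) with best
  ...   | nothing = just (i , j , maxList ls , x)
  ...   | just old = if better (i , j , maxList ls , x) old then just (i , j , maxList ls , x) else just old

-- smallest entry satisfying p among the cells at positions satisfying q
-- (ties: the first such cell in bottom-to-top, left-to-right order)
findMin : (ℕ → ℕ → Bool) → (ℕ → Bool) → Tableau → Maybe (ℕ × ℕ × ℕ)
findMin q p T = foldl step nothing (cellsOf T)
  where
  step : Maybe (ℕ × ℕ × ℕ) → ℕ × ℕ × Cell → Maybe (ℕ × ℕ × ℕ)
  step best (i , j , x) with q i j | minWith p (entries x)
  ... | false | _ = best
  ... | true | nothing = best
  ... | true | just k with best
  ...   | nothing = just (i , j , k)
  ...   | just (i' , j' , k') = if k <ᵇ k' then just (i , j , k) else just (i' , j' , k')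

colHeight : Tableau → ℕ → ℕ
colHeight [] j = 0
colHeight (r ∷ rs) j = if j <ᵇ length r then suc (colHeight rs j) else 0

modifyCell : ℕ → ℕ → (Cell → Cell) → Tableau → Tableau
modifyCell i j f = modifyAt i (modifyAt j f)

replaceA : ℕ → ℕ → Cell → Cell
replaceA a k (cell h ls as) =
  if h ≡ᵇ k then cell a ls as
  else if elemB k as then cell h ls (ins a (removeOne k as))
  else if elemB k ls then cell h (ins a (removeOne k ls)) as
  else cell h ls as

addArm : ℕ → Cell → Cell
addArm k (cell h ls as) = cell h ls (ins k as)

addArms : List ℕ → Cell → Cell
addArms ks (cell h ls as) = cell h ls (insAll ks as)

addLeg : ℕ → Cell → Cell
addLeg k (cell h ls as) = cell h (ins k ls) as

addLegs : List ℕ → Cell → Cell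
addLegs ks (cell h ls as) = cell h (insAll ks ls) as

removeArm : ℕ → Cell → Cell
removeArm a (cell h ls as) = cell h ls (removeOne a as)

removeLeg : ℕ → Cell → Cell
removeLeg a (cell h ls as) = cell h (removeOne a ls) as

keepLegsLE : ℕ → Cell → Cell
keepLegsLE a (cell h ls as) = cell h (filterB (λ y → y ≤ᵇ a) ls) as

keepArmsLT : ℕ → Cell → Cell
keepArmsLT l (cell h ls as) = cell h ls (filterB (λ y → y <ᵇ l) as)

armBump : Tableau → Tableau
armBump T with findArm T
... | nothing = T
... | just (r , c , a , x) with findMin (λ _ j → j ≡ᵇ suc c) (λ y → a ≤ᵇ y) T
...   | just (r' , _ , k) =
        let T₁ = modifyCell r c (removeArm a) T
            T₂ = modifyCell r' (suc c) (λ y → addArm k (replaceA a k y)) T₁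
            moved = filterB (λ y → a <ᵇ y) (legs x)
        in if r' ≡ᵇ r
           then modifyCell r (suc c) (addLegs moved) (modifyCell r c (keepLegsLE a) T₂)
           else T₂
...   | nothing =
        let T₁ = modifyCell r c (removeArm a) T
            h = colHeight T (suc c)
            moved = filterB (λ y → a <ᵇ y) (legs x)
        in if h ≡ᵇ r
           then appendAt (modifyCell r c (keepLegsLE a) T₁) h (cell a moved [])
           else appendAt T₁ h (cell a [] [])

replaceL : ℕ → ℕ → Cell → Cell
replaceL l k (cell h ls as) =
  if h ≡ᵇ k then cell l ls as
  else if elemB k ls then cell h (ins l (removeOne k ls)) as
  else if elemB k as then cell h ls (ins l (removeOne k as))
  else cell h ls as

legBump : Tableau → Tableau
legBump T with findLeg T
... | nothing = T
... | just (r , c , l , x) with findMin (λ i _ → i ≡ᵇ suc r) (λ y → l <ᵇ y) T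
...   | just (_ , c' , k) =
        let T₁ = modifyCell r c (removeLeg l) T
            T₂ = modifyCell (suc r) c' (λ y → addLeg k (replaceL l k y)) T₁
            moved = filterB (λ y → l ≤ᵇ y) (arms x)
        in if c' ≡ᵇ c
           then modifyCell (suc r) c (addArms moved) (modifyCell r c (keepArmsLT l) T₂)
           else T₂
...   | nothing =
        let T₁ = modifyCell r c (removeLeg l) T
            w = length (nth [] T (suc r))
            moved = filterB (λ y → l ≤ᵇ y) (arms x)
        in if w ≡ᵇ c
           then appendAt (modifyCell r c (keepArmsLT l) T₁) (suc r) (cell l [] moved)
           else appendAt T₁ (suc r) (cell l [] [])

data Letter : Set where
  𝒜 ℒ : Letter

bump : Letter → Tableau → Tableau
bump 𝒜 = armBump
bump ℒ = legBump

locate : Letter → Tableau → Maybe (ℕ × ℕ × ℕ × Cell)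
locate 𝒜 = findArm
locate ℒ = findLeg

data Apply (f : Letter) (T : Tableau) : Tableau → Set where
  idle : locate f T ≡ nothing → Apply f T T
  grow : (m : ℕ) → size T < size (iter (bump f) m T) →
         (∀ m' → m' < m → ¬ (size T < size (iter (bump f) m' T))) →
         Apply f T (iter (bump f) m T)

data Sym : Set where
  α β : ℕ → Sym

-- a (mixed) filling of a skew shape: same row structure as the outer
-- shape, cells of the inner shape hold nothing
Filling : Set
Filling = List (List (Maybe Sym))

blank : Tableau → Filling
blank T = map (map (λ _ → nothing)) T

label : Letter → Tableau → Maybe Sym
label 𝒜 T with findArm T
... | nothing = nothing
... | just (_ , c , _ , _) = just (α (suc c))
label ℒ T with findLeg T
... | nothing = nothing
... | just (r , _ , _ , _) = just (β (suc r))

firstDiff : List ℕ → List ℕ → ℕ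
firstDiff [] _ = 0
firstDiff (x ∷ xs) [] = 0
firstDiff (x ∷ xs) (y ∷ ys) = if x ≡ᵇ y then suc (firstDiff xs ys) else 0

recordStep : Letter → Tableau → Tableau → Filling → Filling
recordStep f T T' Q =
  if size T <ᵇ size T' then appendAt Q (firstDiff (shape T) (shape T')) (label f T) else Q

-- Uncrowd w T P Q : 𝒰_w(T) = (P , Q), where the word w = f_n ⋯ f_1 is
-- written as in the paper (head = f_n, applied last).
data Uncrowd : List Letter → Tableau → Tableau → Filling → Set where
  done : ∀ {T} → Uncrowd [] T T (blank T)
  next : ∀ {f w T T' T'' Q} → Uncrowd w T T' Q → Apply f T' T'' →
         Uncrowd (f ∷ w) T T'' (recordStep f T' T'' Q)

getQ : Filling → ℕ → ℕ → Maybe Sym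
getQ Q i j = nth nothing (nth [] Q i) j

setQ : ℕ → ℕ → Maybe Sym → Filling → Filling
setQ i j v = modifyAt i (modifyAt j (λ _ → v))

betaAt : Filling → ℕ → ℕ → Maybe ℕ
betaAt Q i j with getQ Q i j
... | just (β k) = just k
... | _ = nothing

isJust : {A : Set} → Maybe A → Bool
isJust (just _) = true
isJust nothing = false

findCand : Filling → Maybe (ℕ × ℕ)
findCand Q = pos (foldl step nothing (cellsOf Q))
  where
  step : Maybe (ℕ × ℕ × ℕ) → ℕ × ℕ × Maybe Sym → Maybe (ℕ × ℕ × ℕ)
  step best (i , j , just (α k)) with isJust (betaAt Q (suc i) j) ∨ isJust (betaAt Q i (suc j))
  ... | false = best
  ... | true with best
  ...   | nothing = just (i , j , k)
  ...   | just (i' , j' , k') =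
          if (k <ᵇ k') ∨ ((k ≡ᵇ k') ∧ (j' <ᵇ j)) then just (i , j , k) else just (i' , j' , k')
  step best (_ , _ , _) = best
  pos : Maybe (ℕ × ℕ × ℕ) → Maybe (ℕ × ℕ)
  pos nothing = nothing
  pos (just (i , j , _)) = just (i , j)

swapQ : ℕ × ℕ → ℕ × ℕ → Filling → Filling
swapQ (i , j) (i' , j') Q = setQ i' j' (getQ Q i j) (setQ i j (getQ Q i' j') Q)

-- state: the filling and the position of the α-entry currently moving
ShuffState : Set
ShuffState = Filling × Maybe (ℕ × ℕ)

shuffStep : ShuffState → ShuffState
shuffStep (Q , nothing) = (Q , findCand Q)
shuffStep (Q , just (i , j)) with betaAt Q (suc i) j | betaAt Q i (suc j)
... | nothing | nothing = (Q , nothing)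
... | just _ | nothing = (swapQ (i , j) (suc i , j) Q , just (suc i , j))
... | nothing | just _ = (swapQ (i , j) (i , suc j) Q , just (i , suc j))
... | just k | just k' =
      if k' <ᵇ k then (swapQ (i , j) (suc i , j) Q , just (suc i , j))
      else (swapQ (i , j) (i , suc j) Q , just (i , suc j))

Shuff : Filling → Filling → Set
Shuff Q Q' = Σ ℕ (λ n → (iter shuffStep n (Q , nothing) ≡ (Q' , nothing)) × (findCand Q' ≡ nothing))

{-# OPTIONS --safe #-}
-- A hook-valued tableau is determined by its hooks together with the multiset of
-- arms of each column and the set of legs of each row.  In these terms an arm
-- bumping replaces one hook, or one leg within its row, by the moving arm, and the
-- replaced value moves on; a leg bumping is the same thing for the transpose.
-- Single arm and leg bumpings therefore commute, except when both are about to
-- create the same cell x: then one of them continues for one more step, into the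
-- cell above x or to the right of x.  Composing, 𝒜 and ℒ commute, and if they add
-- x and then y in one order, they add y and then x in the other unless y is
-- adjacent to x, in which case the new cells are again x and y, with the labels
-- exchanged.  Labels do not change, and consecutive equal labels belong to cells
-- further and further right (for α) or up (for β).  Passing the last α through all
-- β, then the previous one, and so on, performs exactly the swaps of the shuffle.

module Submission where

open import Defs
open import Data.Nat using (_≤′_; ≤′-reflexive; ≤′-step; ℕ; zero; suc; _+_; _∸_; _≤_; _<_; _≤ᵇ_; _<ᵇ_; _≡ᵇ_; _⊔_; z≤n; s≤s; _≟_; _≤?_; _<?_)
open import Data.Nat.Properties
open import Data.Nat.ListAction using (sum)
open import Data.Nat.Solver using (module +-*-Solver)
open import Data.Bool using (Bool; true; false; if_then_else_; _∧_; _∨_; T)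
open import Data.Bool.Properties using (T-≡; ∧-zeroʳ)
open import Data.List using (List; []; _∷_; _++_; length; map; foldl; concatMap; replicate)
open import Data.List.Properties using (length-++; length-map; ++-assoc; ++-identityʳ)
open import Data.List.Relation.Unary.Linked using (Linked)
open import Data.List.Relation.Unary.All as All using (All; []; _∷_)
open import Data.List.Relation.Unary.Any using (Any; here; there)
open import Data.List.Membership.Propositional using (_∈_)
open import Data.List.Membership.Propositional.Properties using (∈-++⁺ˡ; ∈-++⁺ʳ; ∈-++⁻)
open import Data.List.Relation.Unary.AllPairs as AllPairs using (AllPairs; []; _∷_)
import Data.List.Relation.Unary.AllPairs.Properties as AllPairsₚ
open import Data.List.Relation.Unary.Linked.Properties using (Linked⇒AllPairs)
open import Data.Maybe.Properties using (just-injective)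
open import Function.Bundles using (Equivalence)
open import Data.Maybe as Maybe using (Maybe; just; nothing)
open import Data.Product using (Σ; _×_; _,_; proj₁; proj₂; swap)
open import Data.Sum as Sum using (_⊎_; inj₁; inj₂)
open import Data.Empty using (⊥; ⊥-elim)
open import Data.Unit using (tt)
open import Function using (_∘_; id; case_of_)
open import Relation.Nullary using (¬_; Dec; yes; no)
open import Relation.Binary.Definitions using (tri<; tri≈; tri>)
open import Relation.Binary.PropositionalEquality

-- When the source and the target of a bumping share a row (or, for leg bumping, a column), entries
-- other than the bumped one also change cell. This side effect is the obstacle to comparing the two
-- orders cell by cell. In the encoding it disappears: the cell of a leg within its row is decided
-- by the hooks alone, and lowering a hook to `a` reassigns the legs by itself. The creation of a
-- cell is not a separate kind of step either. Empty cells carry fictitious hooks of size at least a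
-- bound `B` exceeding all entries. An arm that reaches an empty cell bumps such a hook, and values
-- from `B` on are disregarded whenever multisets are compared. For the shuffle, the labels are kept
-- in a list in order of creation, of which the filling is a shadow. Exchanging an arm growth with a
-- leg growth permutes two neighbours of the list. The filling is unchanged if the two cells are
-- apart, and undergoes one swap if they are adjacent.

-- Rows are ordered by ◁ and columns by ◀. With (≤ , <) this is a tableau, with
-- (< , ≤) its transpose, so that leg bumping is arm bumping for the swapped orders.
record Orders (_◁_ _◀_ : ℕ → ℕ → Set) : Set where
  field
    ◁⇒≤  : ∀ {u v} → u ◁ v → u ≤ v
    ◀⇒≤  : ∀ {u v} → u ◀ v → u ≤ v
    <⇒◁  : ∀ {u v} → u < v → u ◁ v
    <⇒◀  : ∀ {u v} → u < v → u ◀ v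
    -- With `excl` this says that `v ◀ u` is the negation of `u ◁ v`. In particular exactly one of
    -- `u ◁ u` and `u ◀ u` holds.
    dich : ∀ u v → (u ◁ v) ⊎ (v ◀ u)
    excl : ∀ {u v} → u ◁ v → v ◀ u → ⊥

  ≤◁ : ∀ {u v w} → u ≤ v → v ◁ w → u ◁ w
  ≤◁ u≤v v◁w with m≤n⇒m<n∨m≡n u≤v
  ... | inj₁ u<v = <⇒◁ (<-≤-trans u<v (◁⇒≤ v◁w))
  ... | inj₂ refl = v◁w

  ◁≤ : ∀ {u v w} → u ◁ v → v ≤ w → u ◁ w
  ◁≤ u◁v v≤w with m≤n⇒m<n∨m≡n v≤w
  ... | inj₁ v<w = <⇒◁ (≤-<-trans (◁⇒≤ u◁v) v<w)
  ... | inj₂ refl = u◁v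

  ≤◀ : ∀ {u v w} → u ≤ v → v ◀ w → u ◀ w
  ≤◀ u≤v v◀w with m≤n⇒m<n∨m≡n u≤v
  ... | inj₁ u<v = <⇒◀ (<-≤-trans u<v (◀⇒≤ v◀w))
  ... | inj₂ refl = v◀w

  ◀≤ : ∀ {u v w} → u ◀ v → v ≤ w → u ◀ w
  ◀≤ u◀v v≤w with m≤n⇒m<n∨m≡n v≤w
  ... | inj₁ v<w = <⇒◀ (≤-<-trans (◀⇒≤ u◀v) v<w)
  ... | inj₂ refl = u◀v

  -- Equal ends would make `u ◁ v` and `v ◀ u` hold at once. This spares the proofs below the
  -- question which of the two orders is the strict one.
  ◁◀⇒< : ∀ {u v w} → u ◁ v → v ◀ w → u < w
  ◁◀⇒< {u} {v} {w} u◁v v◀w with m≤n⇒m<n∨m≡n (≤-trans (◁⇒≤ u◁v) (◀⇒≤ v◀w))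
  ... | inj₁ u<w = u<w
  ... | inj₂ refl = ⊥-elim (excl u◁v v◀w)

  ◀◁⇒< : ∀ {u v w} → u ◀ v → v ◁ w → u < w
  ◀◁⇒< {u} {v} {w} u◀v v◁w with m≤n⇒m<n∨m≡n (≤-trans (◀⇒≤ u◀v) (◁⇒≤ v◁w))
  ... | inj₁ u<w = u<w
  ... | inj₂ refl = ⊥-elim (excl v◁w u◀v)

transposed : ∀ {_◁_ _◀_} → Orders _◁_ _◀_ → Orders _◀_ _◁_
transposed O = record
  { ◁⇒≤ = ◀⇒≤ ; ◀⇒≤ = ◁⇒≤ ; <⇒◁ = <⇒◀ ; <⇒◀ = <⇒◁
  ; dich = λ u v → Sum.swap (dich v u) ; excl = λ p q → excl q p }
  where open Orders O

≤-< : Orders _≤_ _<_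
≤-< = record
  { ◁⇒≤ = id ; ◀⇒≤ = <⇒≤ ; <⇒◁ = <⇒≤ ; <⇒◀ = id
  ; dich = λ u v → case u ≤? v of λ { (yes p) → inj₁ p ; (no p) → inj₂ (≰⇒> p) }
  ; excl = λ p q → <⇒≱ q p }

-- Encodings, moves of multisets and bumping steps

pos≟ : ∀ i j i' j' → Dec (i ≡ i' × j ≡ j')
pos≟ i j i' j' with i ≟ i' | j ≟ j'
... | yes p | yes q = yes (p , q)
... | no p | _ = no (p ∘ proj₁)
... | _ | no q = no (q ∘ proj₂)

δ : ℕ → ℕ → ℕ → ℕ → ℕ
δ i k j v with pos≟ i k j v
... | yes _ = 1
... | no _ = 0

δ-hit : ∀ i k → δ i k i k ≡ 1
δ-hit i k with pos≟ i k i k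
... | yes _ = refl
... | no ¬p = ⊥-elim (¬p (refl , refl))

δ-miss : ∀ {i k j v} → ¬ (i ≡ j × k ≡ v) → δ i k j v ≡ 0
δ-miss {i} {k} {j} {v} ¬p with pos≟ i k j v
... | yes p = ⊥-elim (¬p p)
... | no _ = refl

update : (ℕ → ℕ → ℕ) → ℕ → ℕ → ℕ → ℕ → ℕ → ℕ
update f i j a i' j' with pos≟ i j i' j'
... | yes _ = a
... | no _ = f i' j'

update-at : ∀ f i j a → update f i j a i j ≡ a
update-at f i j a with pos≟ i j i j
... | yes _ = refl
... | no ¬p = ⊥-elim (¬p (refl , refl))

update-off : ∀ f i j a {i' j'} → ¬ (i ≡ i' × j ≡ j') → update f i j a i' j' ≡ f i' j'
update-off f i j a {i'} {j'} ¬p with pos≟ i j i' j'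
... | yes p = ⊥-elim (¬p p)
... | no _ = refl

-- An arm v of column j lies in the only row i with H i j ≤ v < H (i+1) j, and a leg
-- v of row i in the only column j with H i j < v ≤ H i (j+1).  Cells outside the
-- shape carry a hook which is at least the bound B below.
record Enc : Set where
  constructor enc
  field
    H A L : ℕ → ℕ → ℕ
open Enc public

_ᵗ : Enc → Enc
e ᵗ = enc (λ i j → H e j i) (L e) (A e)

count : List (ℕ × ℕ) → ℕ → ℕ → ℕ
count [] j v = 0
count ((i , k) ∷ xs) j v = δ i k j v + count xs j v

module Bounded (B : ℕ) where

  Arm Leg : Enc → ℕ → ℕ → Set
  Arm e j v = 0 < A e j v × v < B
  Leg e i v = 0 < L e i v × v < B

  -- f' arises from f by moving one copy of k from line i to a copy of a in line i₂.
  record Move (f f' : ℕ → ℕ → ℕ) (i k i₂ a : ℕ) : Set where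
    constructor move
    field balance : ∀ j v → v < B → f' j v + δ i k j v ≡ f j v + δ i₂ a j v
  open Move public

  module _ {f f' i k i₂ a} (mv' : Move f f' i k i₂ a) where
    private mv = balance mv'

    move-gain : ∀ {j v} → v < B → 0 < f' j v → 0 < f j v ⊎ (i₂ ≡ j × a ≡ v)
    move-gain {j} {v} v<B p with pos≟ i₂ a j v | mv j v v<B
    ... | yes q | _ = inj₂ q
    ... | no _ | eq = inj₁ (subst (0 <_) (trans eq (+-identityʳ _)) (m≤n⇒m≤n+o _ p))

    move-keep : ∀ {j v} → v < B → 0 < f j v → ¬ (i ≡ j × k ≡ v) → 0 < f' j v
    move-keep {j} {v} v<B p ¬q = subst (0 <_) (trans (sym (mv j v v<B)) (trans (cong (f' j v +_) (δ-miss ¬q)) (+-identityʳ _))) (m≤n⇒m≤n+o _ p)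

    move-keep² : ∀ {j v} → v < B → 2 ≤ f j v → 0 < f' j v
    move-keep² {j} {v} v<B p with pos≟ i k j v | mv j v v<B
    ... | yes _ | eq = +-cancelʳ-≤ 1 1 (f' j v) (subst (2 ≤_) (sym eq) (m≤n⇒m≤n+o _ p))
    ... | no _ | eq = subst (0 <_) (trans (sym eq) (+-identityʳ _)) (m≤n⇒m≤n+o _ (<⇒≤ p))

    move-new : a < B → ¬ (i ≡ i₂ × k ≡ a) → 0 < f' i₂ a
    move-new a<B ¬q = subst (0 <_) (trans (sym (mv i₂ a a<B)) (trans (cong (f' i₂ a +_) (δ-miss ¬q)) (+-identityʳ _)))
      (subst (λ z → 0 < f i₂ a + z) (sym (δ-hit i₂ a)) (m≤n+m 1 _))

    -- If source and target coincide, nothing changes and the copy at the source serves.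
    move-new⁺ : a < B → 0 < f i k → 0 < f' i₂ a
    move-new⁺ a<B p with pos≟ i k i₂ a
    ... | no ¬q = move-new a<B ¬q
    ... | yes (refl , refl) = subst (0 <_) (sym (+-cancelʳ-≡ (δ i k i k) _ _ (mv i k a<B))) p

    move-gone : k < B → ¬ (i ≡ i₂ × k ≡ a) → f i k ≡ 1 → f' i k ≡ 0
    move-gone k<B ¬q eq = +-cancelʳ-≡ 1 _ 0 (trans (cong (f' i k +_) (sym (δ-hit i k))) (trans (mv i k k<B)
      (trans (cong (f i k +_) (δ-miss (λ { (refl , refl) → ¬q (refl , refl) }))) (trans (+-identityʳ _) eq))))

    -- A copy that is still there after one has left was one of at least two.
    move-left : k < B → ¬ (i ≡ i₂ × k ≡ a) → 0 < f' i k → 2 ≤ f i k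
    move-left k<B ¬q p = subst (2 ≤_) (trans (cong (f' i k +_) (sym (δ-hit i k))) (trans (mv i k k<B)
      (trans (cong (f i k +_) (δ-miss (λ { (refl , refl) → ¬q (refl , refl) }))) (+-identityʳ _)))) (+-monoˡ-≤ 1 p)

    move-gain² : ∀ {j v} → v < B → 2 ≤ f' j v → 2 ≤ f j v ⊎ (i₂ ≡ j × a ≡ v × 0 < f j v × ¬ (i ≡ j × k ≡ v))
    move-gain² {j} {v} v<B p with pos≟ i₂ a j v | pos≟ i k j v | mv j v v<B
    ... | no _ | _ | eq = inj₁ (subst (2 ≤_) (trans eq (+-identityʳ _)) (m≤n⇒m≤n+o _ p))
    ... | yes _ | yes _ | eq = inj₁ (subst (2 ≤_) (+-cancelʳ-≡ 1 _ _ eq) p)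
    ... | yes (refl , refl) | no ¬q | eq = inj₂ (refl , refl , +-cancelʳ-≤ 1 1 _ (subst (2 ≤_) (trans (sym (+-identityʳ _)) eq) p) , ¬q)

  module Defn (_◁_ _◀_ : ℕ → ℕ → Set) where

    -- In `arm` and `leg` the first two conditions locate the cell, and the third is the one imposed
    -- by the remaining neighbour. In `arm²` and `leg²` the conclusion is always true for a weak
    -- order and never for a strict one, so a single formulation permits repeated arms and forbids
    -- repeated legs, also after transposition.
    record Valid (e : Enc) : Set where
      field
        row  : ∀ i j → H e i j ◁ H e i (suc j)
        col  : ∀ i j → H e i j ◀ H e (suc i) j
        arm  : ∀ j v → Arm e j v → Σ ℕ λ i → (H e i j ◁ v) × (v ◀ H e (suc i) j) × (v ◁ H e i (suc j))
        leg  : ∀ i v → Leg e i v → Σ ℕ λ j → (H e i j ◀ v) × (v ◁ H e i (suc j)) × (v ◀ H e (suc i) j)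
        arm² : ∀ j v → v < B → 2 ≤ A e j v → v ◁ v
        leg² : ∀ i v → v < B → 2 ≤ L e i v → v ◀ v

    record Particle (e : Enc) (c a : ℕ) : Set where
      field
        arm∈ : Arm e c a
        max  : ∀ v → Arm e c v → v ≤ a
        last : ∀ j v → c < j → ¬ Arm e j v

    -- The arm a of column c replaces the hook in row i of column c + 1 ...
    record HStep (e : Enc) (c a i : ℕ) (e' : Enc) : Set where
      field
        part  : Particle e c a
        over  : a ◁ H e i (suc c)
        -- The quantification over a predecessor of `i` makes `under` and `free` vacuous in the
        -- bottom row. In `free`, legs left of the target column need no exception: they precede the
        -- hook in `under` and so are below `a`.
        under : ∀ i' → suc i' ≡ i → H e i' (suc c) ◀ a
        free  : ∀ i' → suc i' ≡ i → ∀ v → Leg e i' v → v ◁ H e i' (suc (suc c)) → v ◀ a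
        at    : H e' i (suc c) ≡ a
        off   : ∀ i' j → ¬ (i ≡ i' × suc c ≡ j) → H e' i' j ≡ H e i' j
        mvA   : Move (A e) (A e') c a (suc c) (H e i (suc c))
        sameL : ∀ j v → v < B → L e' j v ≡ L e j v

    -- ... or a leg k of the cell in row i of column c + 1.
    record GStep (e : Enc) (c a i k : ℕ) (e' : Enc) : Set where
      field
        part  : Particle e c a
        leg∈  : Leg e i k
        under : H e i (suc c) ◀ a
        over  : a ◁ k
        right : k ◁ H e i (suc (suc c))
        -- Demanding this of the whole row costs nothing: legs further left are below `a`, and those
        -- further right are above `k`.
        min   : ∀ v → Leg e i v → a ◁ v → k ≤ v
        sameH : ∀ i j → H e' i j ≡ H e i j
        mvA   : Move (A e) (A e') c a (suc c) k
        mvL   : Move (L e) (L e') i k i a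

    data Slide (e : Enc) (c : ℕ) (e' : Enc) : Set where
      bump-hook : ∀ {a i} → HStep e c a i e' → H e i (suc c) < B → Slide e c e'
      bump-leg  : ∀ {a i k} → GStep e c a i k e' → Slide e c e'

    data Exit (e : Enc) (c i : ℕ) (e' : Enc) : Set where
      exit : ∀ {a} → HStep e c a i e' → B ≤ H e i (suc c) → Exit e c i e'

    -- One application of `𝒜`, or of `ℒ` in the transposed reading: bumpings that keep the shape,
    -- then one that leaves it.
    data Grow : Enc → (c i j : ℕ) → Enc → Set where
      exits  : ∀ {e c i e'} → Exit e c i e' → Grow e c i (suc c) e'
      slides : ∀ {e c i j e₁ e'} → Slide e c e₁ → Grow e₁ (suc c) i j e' → Grow e c i j e'

    infixr 5 _∷_
    data Grows : Enc → List (ℕ × ℕ × ℕ) → Enc → Set where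
      []  : ∀ {e} → Grows e [] e
      _∷_ : ∀ {e c i j e₁ ps e'} → Grow e c i j e₁ → Grows e₁ ps e' → Grows e ((c , i , j) ∷ ps) e'

  Valid-ᵗ : ∀ {_◁_ _◀_ e} → Defn.Valid _◁_ _◀_ e → Defn.Valid _◀_ _◁_ (e ᵗ)
  Valid-ᵗ V = record { row = λ i j → col j i ; col = λ i j → row j i ; arm = leg ; leg = arm ; arm² = leg² ; leg² = arm² }
    where open Defn.Valid V

  record Adds (e : Enc) (i j : ℕ) (e' : Enc) : Set where
    field
      before : B ≤ H e i j
      after  : H e' i j < B
      kept   : ∀ i' j' → H e i' j' < B → H e' i' j' < B
      fresh  : ∀ i' j' → H e' i' j' < B → H e i' j' < B ⊎ (i ≡ i' × j ≡ j')

  -- A finite list behind a multiplicity function. For arms its length drops by one with every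
  -- growth, so the construction of all growths recurses on it.
  record Listed (f : ℕ → ℕ → ℕ) (n : ℕ) : Set where
    constructor listed
    field
      list   : List (ℕ × ℕ)
      len    : length list ≡ n
      small  : All (λ p → proj₂ p < B) list
      counts : ∀ j v → v < B → f j v ≡ count list j v

  -- Bounds the shape to the right, which forces every bumping path to end.
  Narrow : Enc → Set
  Narrow e = Σ ℕ λ w → ∀ i j → w ≤ j → B ≤ H e i j

-- Geometry of encodings; validity and existence of steps

monotone : ∀ {f : ℕ → ℕ} → (∀ n → f n ≤ f (suc n)) → ∀ {m n} → m ≤ n → f m ≤ f n
monotone {f} s {m} {n} m≤n = go (≤⇒≤′ m≤n)
  where
  go : ∀ {n} → m ≤′ n → f m ≤ f n
  go (≤′-reflexive refl) = ≤-refl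
  go (≤′-step p) = ≤-trans (go p) (s _)

least : (P : ℕ → Set) → (∀ n → Dec (P n)) → ∀ n →
        (Σ ℕ λ m → m < n × P m × (∀ m' → m' < m → ¬ P m')) ⊎ (∀ m → m < n → ¬ P m)
least P P? zero = inj₂ λ _ ()
least P P? (suc n) with least P P? n
... | inj₁ (m , m<n , p , q) = inj₁ (m , m≤n⇒m≤1+n m<n , p , q)
... | inj₂ none with P? n
...   | yes p = inj₁ (n , ≤-refl , p , none)
...   | no ¬p = inj₂ λ m m<1+n → case m≤n⇒m<n∨m≡n (≤-pred m<1+n) of λ { (inj₁ m<n) → none m m<n ; (inj₂ refl) → ¬p }

module Half (B : ℕ) (_◁_ _◀_ : ℕ → ℕ → Set) (orders : Orders _◁_ _◀_) where
  open Bounded B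
  open Defn _◁_ _◀_ public
  open Orders orders

  ◁? : ∀ u v → Dec (u ◁ v)
  ◁? u v with dich u v
  ... | inj₁ p = yes p
  ... | inj₂ q = no λ p → excl p q

  same-particle : ∀ {e e' c a} → (∀ j v → v < B → A e' j v ≡ A e j v) → Particle e c a → Particle e' c a
  same-particle eq P = record
    { arm∈ = subst (0 <_) (sym (eq _ _ (proj₂ arm∈))) (proj₁ arm∈) , proj₂ arm∈
    ; max = λ v (p , v<B) → max v (subst (0 <_) (eq _ _ v<B) p , v<B)
    ; last = λ j v c<j (p , v<B) → last j v c<j (subst (0 <_) (eq _ _ v<B) p , v<B) }
    where open Particle P

  module Geometry {e} (V : Valid e) where
    open Valid V

    H-row : ∀ i {j j'} → j ≤ j' → H e i j ≤ H e i j'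
    H-row i = monotone λ j → ◁⇒≤ (row i j)

    H-col : ∀ j {i i'} → i ≤ i' → H e i j ≤ H e i' j
    H-col j = monotone {λ i → H e i j} λ i → ◀⇒≤ (col i j)

    H-mono : ∀ {i j i' j'} → i ≤ i' → j ≤ j' → H e i j ≤ H e i' j'
    H-mono p q = ≤-trans (H-row _ q) (H-col _ p)

    arm-row-unique : ∀ {j v i i'} → H e i j ◁ v → v ◀ H e (suc i) j → H e i' j ◁ v → v ◀ H e (suc i') j → i ≡ i'
    arm-row-unique {j} {v} {i} {i'} p q p' q' with <-cmp i i'
    ... | tri< lt _ _ = ⊥-elim (excl p' (◀≤ q (H-col j lt)))
    ... | tri≈ _ eq _ = eq
    ... | tri> _ _ gt = ⊥-elim (excl p (◀≤ q' (H-col j gt)))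

    leg-col-unique : ∀ {i v j j'} → H e i j ◀ v → v ◁ H e i (suc j) → H e i j' ◀ v → v ◁ H e i (suc j') → j ≡ j'
    leg-col-unique {i} {v} {j} {j'} p q p' q' with <-cmp j j'
    ... | tri< lt _ _ = ⊥-elim (excl (◁≤ q (H-row i lt)) p')
    ... | tri≈ _ eq _ = eq
    ... | tri> _ _ gt = ⊥-elim (excl (◁≤ q' (H-row i gt)) p)

    -- `Valid.leg` provides some column for the leg; uniqueness makes it the given one.
    leg-above : ∀ {i j v} → Leg e i v → H e i j ◀ v → v ◁ H e i (suc j) → v ◀ H e (suc i) j
    leg-above v∈ p q with leg _ _ v∈
    ... | _ , p' , q' , r with leg-col-unique p q p' q'
    ...   | refl = r

    -- A smaller arm is `◁ a` since `<` implies `◁`. A further copy of `a` can only remain if `a`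
    -- occurred twice, and then `arm²` gives `a ◁ a`.
    rest≤ : ∀ {c a f' c' k} → Particle e c a → Move (A e) f' c a c' k → ¬ (c ≡ c' × a ≡ k) →
            ∀ {v} → v < B → 0 < f' c v → ¬ (c' ≡ c) → v ◁ a
    rest≤ P mv ¬eq {v} v<B p c'≢c with move-gain mv v<B p
    ... | inj₂ (q , _) = ⊥-elim (c'≢c q)
    ... | inj₁ p₀ with m≤n⇒m<n∨m≡n (Particle.max P v (p₀ , v<B))
    ...   | inj₁ v<a = <⇒◁ v<a
    ...   | inj₂ refl = arm² _ _ v<B (move-left mv v<B ¬eq p)

    module OfHStep {c a i e'} (S : HStep e c a i e') where
      open HStep S
      open Particle part

      k : ℕ
      k = H e i (suc c)

      place : Σ ℕ λ ρ → (H e ρ c ◁ a) × (a ◀ H e (suc ρ) c) × (a ◁ H e ρ (suc c))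
      place = arm c a arm∈

      ρ : ℕ
      ρ = proj₁ place

      -- The hook to the right of the arm is already one that `a` may replace, so the lowest such
      -- hook is not above that row.
      i≤ρ : i ≤ ρ
      i≤ρ = ≮⇒≥ (below i refl)
        where
        below : ∀ i₀ → i₀ ≡ i → ¬ ρ < i₀
        below (suc i') eq (s≤s ρ≤i') = excl (proj₂ (proj₂ (proj₂ place))) (≤◀ (H-col (suc c) ρ≤i') (under i' eq))

      left : H e i c ◁ a
      left = ≤◁ (H-col c i≤ρ) (proj₁ (proj₂ place))

      a≤k : a ≤ k
      a≤k = ◁⇒≤ over

      rest◁ : ∀ {v} → v < B → 0 < A e' c v → v ◁ a
      rest◁ v<B p = rest≤ part mvA (λ { (() , _) }) v<B p (λ ())

      H'≤ : ∀ i' j → H e' i' j ≤ H e i' j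
      H'≤ i' j with pos≟ i (suc c) i' j
      ... | yes (refl , refl) = subst (_≤ k) (sym at) a≤k
      ... | no ¬p = ≤-reflexive (off i' j ¬p)

    module OfGStep {c a i k e'} (S : GStep e c a i k e') where
      open GStep S
      open Particle part

      place : Σ ℕ λ ρ → (H e ρ c ◁ a) × (a ◀ H e (suc ρ) c) × (a ◁ H e ρ (suc c))
      place = arm c a arm∈

      ρ : ℕ
      ρ = proj₁ place

      i<ρ : i < ρ
      i<ρ = ≰⇒> λ ρ≤i → excl (proj₂ (proj₂ (proj₂ place))) (≤◀ (H-col (suc c) ρ≤i) under)

      left : H e (suc i) c ◁ a
      left = ≤◁ (H-col c i<ρ) (proj₁ (proj₂ place))

      a≤k : a ≤ k
      a≤k = ◁⇒≤ over

      k-above : k ◀ H e (suc i) (suc c)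
      k-above = leg-above leg∈ (◀≤ under a≤k) right

      rest◁ : ∀ {v} → v < B → 0 < A e' c v → v ◁ a
      rest◁ v<B p = rest≤ part mvA (λ { (() , _) }) v<B p (λ ())

  open Geometry public

  HStep-valid : ∀ {e c a i e'} → Valid e → HStep e c a i e' → Valid e'
  HStep-valid {e} {c} {a} {i} {e'} V S = record
    { row = row' ; col = col' ; arm = arm' ; leg = leg' ; arm² = arm²' ; leg² = leg²' }
    where
    open Valid V
    open HStep S
    open Particle part
    open OfHStep V S
    row' : ∀ i' j → H e' i' j ◁ H e' i' (suc j)
    row' i' j with pos≟ i (suc c) i' (suc j)
    ... | yes (refl , refl) = subst₂ _◁_ (sym (off i c λ ())) (sym at) left
    ... | no ¬p = subst (H e' i' j ◁_) (sym (off i' (suc j) ¬p)) (≤◁ (H'≤ i' j) (row i' j))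
    col' : ∀ i' j → H e' i' j ◀ H e' (suc i') j
    col' i' j with pos≟ i (suc c) (suc i') j
    ... | yes (refl , refl) = subst₂ _◀_ (sym (off i' (suc c) λ ())) (sym at) (under i' refl)
    ... | no ¬p = subst (H e' i' j ◀_) (sym (off (suc i') j ¬p)) (≤◀ (H'≤ i' j) (col i' j))
    arm' : ∀ j v → Arm e' j v → Σ ℕ λ i → (H e' i j ◁ v) × (v ◀ H e' (suc i) j) × (v ◁ H e' i (suc j))
    arm' j v (p , v<B) with move-gain mvA v<B p
    ... | inj₂ (refl , refl) = i , subst (_◁ k) (sym at) over
                             , subst (k ◀_) (sym (off (suc i) (suc c) λ { (() , _) })) (col i (suc c))
                             , subst (k ◁_) (sym (off i (suc (suc c)) λ ())) (row i (suc c))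
    ... | inj₁ p₀ with arm j v (p₀ , v<B)
    ...   | i* , q , r , s = i* , ≤◁ (H'≤ i* j) q
                           , subst (v ◀_) (sym (off (suc i*) j λ { (_ , refl) → last _ _ ≤-refl (p₀ , v<B) })) r , s'
      where
      s' : v ◁ H e' i* (suc j)
      s' with pos≟ i (suc c) i* (suc j)
      ... | yes (refl , refl) = subst (v ◁_) (sym at) (rest◁ v<B p)
      ... | no ¬p = subst (v ◁_) (sym (off i* (suc j) ¬p)) s
    leg' : ∀ i v → Leg e' i v → Σ ℕ λ j → (H e' i j ◀ v) × (v ◁ H e' i (suc j)) × (v ◀ H e' (suc i) j)
    leg' i* v (p , v<B) with subst (0 <_) (sameL i* v v<B) p
    ... | p₀ with leg i* v (p₀ , v<B)
    ...   | j , q , r , s with pos≟ i (suc c) i* (suc j)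
    ...     | no ¬p = j , ≤◀ (H'≤ i* j) q , subst (v ◁_) (sym (off i* (suc j) ¬p)) r , s'
      where
      s' : v ◀ H e' (suc i*) j
      s' with pos≟ i (suc c) (suc i*) j
      ... | yes (refl , refl) = subst (v ◀_) (sym at) (free i* refl v (p₀ , v<B) r)
      ... | no ¬p = subst (v ◀_) (sym (off (suc i*) j ¬p)) s
    -- The leg lies in the cell left of the target. Once the target hook is `a`, the legs with
    -- `a ◀ v` belong to the target cell: this is the transfer of legs in the bumping rule.
    ...     | yes (refl , refl) with dich v a
    ...       | inj₁ v◁a = c , ≤◀ (H'≤ i c) q , subst (v ◁_) (sym at) v◁a , subst (v ◀_) (sym (off (suc i) c λ ())) s
    ...       | inj₂ a◀v = suc c , subst (_◀ v) (sym at) a◀v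
                         , subst (v ◁_) (sym (off i (suc (suc c)) λ ())) (◁≤ r (◁⇒≤ (row i (suc c))))
                         , subst (v ◀_) (sym (off (suc i) (suc c) λ { (() , _) })) (≤◀ (◁⇒≤ r) (col i (suc c)))
    arm²' : ∀ j v → v < B → 2 ≤ A e' j v → v ◁ v
    arm²' j v v<B p with move-gain² mvA v<B p
    ... | inj₁ q = arm² j v v<B q
    -- The column next to the particle had no arms, so the arriving value repeats none.
    ... | inj₂ (refl , refl , q , _) = ⊥-elim (last _ _ ≤-refl (q , v<B))
    leg²' : ∀ i v → v < B → 2 ≤ L e' i v → v ◀ v
    leg²' i v v<B p = leg² i v v<B (subst (2 ≤_) (sameL i v v<B) p)

  GStep-valid : ∀ {e c a i k e'} → Valid e → GStep e c a i k e' → Valid e'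
  GStep-valid {e} {c} {a} {i} {k} {e'} V S = record
    { row = λ i j → subst₂ _◁_ (sym (sameH i j)) (sym (sameH i (suc j))) (row i j)
    ; col = λ i j → subst₂ _◀_ (sym (sameH i j)) (sym (sameH (suc i) j)) (col i j)
    ; arm = λ j v p → case arm' j v p of λ (i , q , r , s) → i , subst (_◁ v) (sym (sameH _ _)) q , subst (v ◀_) (sym (sameH _ _)) r , subst (v ◁_) (sym (sameH _ _)) s
    ; leg = λ i v p → case leg' i v p of λ (j , q , r , s) → j , subst (_◀ v) (sym (sameH _ _)) q , subst (v ◁_) (sym (sameH _ _)) r , subst (v ◀_) (sym (sameH _ _)) s
    ; arm² = arm²' ; leg² = leg²' }
    where
    open Valid V
    open GStep S
    open Particle part
    open OfGStep V S
    a<B : a < B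
    a<B = proj₂ arm∈
    arm' : ∀ j v → Arm e' j v → Σ ℕ λ i → (H e i j ◁ v) × (v ◀ H e (suc i) j) × (v ◁ H e i (suc j))
    arm' j v (p , v<B) with move-gain mvA v<B p
    ... | inj₁ p₀ = arm j v (p₀ , v<B)
    ... | inj₂ (refl , refl) = i , <⇒◁ (◀◁⇒< under over) , k-above , right
    leg' : ∀ i v → Leg e' i v → Σ ℕ λ j → (H e i j ◀ v) × (v ◁ H e i (suc j)) × (v ◀ H e (suc i) j)
    leg' i* v (p , v<B) with move-gain mvL v<B p
    ... | inj₁ p₀ = leg i* v (p₀ , v<B)
    ... | inj₂ (refl , refl) = suc c , under , ≤◁ a≤k right , ≤◀ a≤k k-above
    arm²' : ∀ j v → v < B → 2 ≤ A e' j v → v ◁ v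
    arm²' j v v<B p with move-gain² mvA v<B p
    ... | inj₁ q = arm² j v v<B q
    ... | inj₂ (refl , refl , q , _) = ⊥-elim (last _ _ ≤-refl (q , v<B))
    leg²' : ∀ i v → v < B → 2 ≤ L e' i v → v ◀ v
    leg²' i* v v<B p with move-gain² mvL v<B p
    ... | inj₁ q = leg² i* v v<B q
    ... | inj₂ (refl , refl , q , ¬eq) with dich v v
    ...   | inj₂ r = r
    -- With `a ◁ a`, an old leg equal to `a` would itself be a candidate, so minimality forces
    -- `k ≡ a` and no second copy arises.
    ...   | inj₁ r = ⊥-elim (¬eq (refl , ≤-antisym (min v (q , v<B) r) a≤k))

  moved : (f : ℕ → ℕ → ℕ) (i k i₂ a : ℕ) → ℕ → ℕ → ℕ
  moved f i k i₂ a j v = (f j v + δ i₂ a j v) ∸ δ i k j v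

  -- The truncated subtraction is exact because a copy is present at the source.
  moved-Move : ∀ {f i k i₂ a} → 0 < f i k → Move f (moved f i k i₂ a) i k i₂ a
  moved-Move {f} {i} {k} {i₂} {a} p = move λ j v _ → m∸n+n≡m (≤-trans (le j v) (m≤m+n _ _))
    where
    le : ∀ j v → δ i k j v ≤ f j v
    le j v with pos≟ i k j v
    ... | yes (refl , refl) = p
    ... | no _ = z≤n

  -- The target is the lowest hook of the next column that `a` may replace, unless the cell just
  -- below it has a leg that `a` may replace; such a leg has priority. The first search succeeds by
  -- the row of the arm itself, where the third condition of `Valid.arm` holds.
  step-exists : ∀ {e c a} → Valid e → Particle e c a →
                (Σ ℕ λ i → Σ Enc λ e' → HStep e c a i e') ⊎ (Σ ℕ λ i → Σ ℕ λ k → Σ Enc λ e' → GStep e c a i k e')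
  step-exists {e} {c} {a} V P = search
    where
    open Particle P
    hook-step : ∀ i → a ◁ H e i (suc c) → (∀ i' → suc i' ≡ i → H e i' (suc c) ◀ a) →
                (∀ i' → suc i' ≡ i → ∀ v → Leg e i' v → v ◁ H e i' (suc (suc c)) → v ◀ a) → Σ Enc λ e' → HStep e c a i e'
    hook-step i ov un fr = enc (update (H e) i (suc c) a) (moved (A e) c a (suc c) (H e i (suc c))) (L e) , record
      { part = P ; over = ov ; under = un ; free = fr ; at = update-at (H e) i (suc c) a
      ; off = λ _ _ → update-off (H e) i (suc c) a ; mvA = moved-Move {A e} (proj₁ arm∈) ; sameL = λ _ _ _ → refl }
    target? : ∀ i → Dec (a ◁ H e i (suc c))
    target? i = ◁? a _
    leg? : ∀ i v → Dec (0 < L e i v × a ◁ v × v ◁ H e i (suc (suc c)))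
    leg? i v with 0 <? L e i v | ◁? a v | ◁? v (H e i (suc (suc c)))
    ... | yes p | yes q | yes r = yes (p , q , r)
    ... | no ¬p | _ | _ = no (¬p ∘ proj₁)
    ... | _ | no ¬p | _ = no (¬p ∘ proj₁ ∘ proj₂)
    ... | _ | _ | no ¬p = no (¬p ∘ proj₂ ∘ proj₂)
    ¬◁⇒◀ : ∀ {u v} → ¬ (u ◁ v) → v ◀ u
    ¬◁⇒◀ {u} {v} ¬p with dich u v
    ... | inj₁ p = ⊥-elim (¬p p)
    ... | inj₂ q = q
    search : _
    search with Valid.arm V c a arm∈
    ... | ρ , _ , _ , a◁ with least _ target? (suc ρ)
    ...   | inj₂ none = ⊥-elim (none ρ ≤-refl a◁)
    ...   | inj₁ (zero , _ , ov , _) = inj₁ (zero , hook-step zero ov (λ _ ()) (λ _ ()))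
    ...   | inj₁ (suc i , _ , ov , before) with least _ (leg? i) B
    ...     | inj₂ none = inj₁ (suc i , hook-step (suc i) ov
                (λ { _ refl → ¬◁⇒◀ (before i ≤-refl) })
                (λ { _ refl v (p , v<B) r → ¬◁⇒◀ λ q → none v v<B (p , q , r) }))
    ...     | inj₁ (k , k<B , (p , q , r) , smallest) = inj₂ (i , k , enc (H e) (moved (A e) c a (suc c) k) (moved (L e) i k i a) , record
                { part = P ; leg∈ = p , k<B ; under = ¬◁⇒◀ (before i ≤-refl) ; over = q ; right = r
                ; min = least-leg ; sameH = λ _ _ → refl ; mvA = moved-Move {A e} (proj₁ arm∈) ; mvL = moved-Move {L e} p })
      where
      least-leg : ∀ v → Leg e i v → a ◁ v → k ≤ v
      least-leg v (p' , v<B) q' with dich v (H e i (suc (suc c)))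
      ... | inj₂ s = ≤-trans (◁⇒≤ r) (◀⇒≤ s)
      ... | inj₁ s = ≮⇒≥ λ v<k → smallest v v<k (p' , q' , s)

-- Commutation of single bumping steps

module _ {B : ℕ} where
  open Bounded B

  private
    open +-*-Solver
    exchange : ∀ {x y z p q r s : ℕ} → y + p ≡ x + q → z + r ≡ x + s → (z + q) + r ≡ (y + s) + p
    exchange {x} {y} {z} {p} {q} {r} {s} e₁ e₂ = trans
      (solve 3 (λ z q r → (z :+ q) :+ r := (z :+ r) :+ q) refl z q r) (trans (cong (_+ q) e₂) (trans
      (solve 3 (λ x s q → (x :+ s) :+ q := (x :+ q) :+ s) refl x s q) (trans (cong (_+ s) (sym e₁))
      (solve 3 (λ y p s → (y :+ p) :+ s := (y :+ s) :+ p) refl y p s))))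

  -- Both moves take away the same entry, so the results differ only by the two targets.
  move-retarget : ∀ {f f₂ f₃ i l i₂ k i₃ a} → Move f f₂ i l i₂ k → Move f f₃ i l i₃ a → Move f₂ f₃ i₂ k i₃ a
  move-retarget {f} {f₂} {f₃} {i} {l} {i₂} {k} {i₃} {a} m₂ m₃ = move λ j v v<B →
    +-cancelʳ-≡ (δ i l j v) _ _ (exchange {f j v} {f₂ j v} {f₃ j v} (balance m₂ j v v<B) (balance m₃ j v v<B))

  move-square : ∀ {f f₁ f₂ f₃ p k q a r l s b} → Move f f₁ p k q a → Move f f₂ r l s b → Move f₂ f₃ p k q a → Move f₁ f₃ r l s b
  move-square {f} {f₁} {f₂} {f₃} {p} {k} {q} {a} {r} {l} {s} {b} m₁ m₂ m₃ = move λ j v v<B →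
    +-cancelʳ-≡ (δ p k j v) _ _ (trans
      (solve 3 (λ x y z → (x :+ y) :+ z := (x :+ z) :+ y) refl (f₃ j v) (δ r l j v) (δ p k j v)) (trans
      (cong (_+ δ r l j v) (balance m₃ j v v<B))
      (exchange {f j v} {f₁ j v} {f₂ j v} (balance m₁ j v v<B) (balance m₂ j v v<B))))

  move-source : ∀ {f g f' i k i₂ a} → (∀ j v → v < B → g j v ≡ f j v) → Move f f' i k i₂ a → Move g f' i k i₂ a
  move-source eq m = move λ j v v<B → trans (balance m j v v<B) (cong (_+ _) (sym (eq j v v<B)))

  δ-big : ∀ {i k j v} → B ≤ k → v < B → δ i k j v ≡ 0
  δ-big B≤k v<B = δ-miss λ { (_ , refl) → <⇒≱ v<B B≤k }

  -- Values at or above B are invisible, so moving one is no move at all.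
  move-big : ∀ {f f' i k i₂ a i₃ a'} → B ≤ a → B ≤ a' → Move f f' i k i₂ a → Move f f' i k i₃ a'
  move-big {f} big big' m = move λ j v v<B → trans (balance m j v v<B) (cong (f j v +_) (trans (δ-big big v<B) (sym (δ-big big' v<B))))

  -- A source from `B` on removes nothing visible, so the given move only added `a`; sending `a` to
  -- an invisible place undoes it.
  move-back : ∀ {f f' i k i₂ a i₃ a'} → B ≤ k → B ≤ a' → Move f f' i k i₂ a → Move f' f i₂ a i₃ a'
  move-back {f} {f'} big big' m = move λ j v v<B → trans (sym (balance m j v v<B)) (cong (f' j v +_) (trans (δ-big big v<B) (sym (δ-big big' v<B))))

module TileHalf (B : ℕ) (_◁_ _◀_ : ℕ → ℕ → Set) (orders : Orders _◁_ _◀_) where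
  open Bounded B
  open Half B _◁_ _◀_ orders
  open Orders orders
  module D = Half B _◀_ _◁_ (transposed orders)

  module HH {e c a i e₁ r l j e₂} (V : Valid e) (S : HStep e c a i e₁) (R : D.HStep (e ᵗ) r l j (e₂ ᵗ)) where
    module S = HStep S
    module R = D.HStep R
    module GS = OfHStep V S
    module GR = D.OfHStep (Valid-ᵗ V) R
    V₂ : Valid e₂
    V₂ = Valid-ᵗ (D.HStep-valid (Valid-ᵗ V) R)

    -- The leg step lowers some other hook and turns its old value into a leg. That leg could
    -- violate `free` only in the row below the target. Up to the target column it is bounded by the
    -- hook under the target; further right it is not `◁` the lowered hook.
    distinct : ¬ (i ≡ suc r × suc c ≡ j) → ∀ {H'} → H' i (suc c) ≡ a → (∀ i' j → ¬ (i ≡ i' × suc c ≡ j) → H' i' j ≡ H e₂ i' j) →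
               HStep e₂ c a i (enc H' (A e₁) (L e₂))
    distinct ¬p at' off' = record
      { part = same-particle R.sameL S.part
      ; over = subst (a ◁_) (sym same) S.over
      ; under = λ i' eq → ≤◀ (GR.H'≤ (suc c) i') (S.under i' eq)
      ; free = free'
      ; at = at' ; off = off'
      ; mvA = subst (Move (A e₂) (A e₁) c a (suc c)) (sym same) (move-source R.sameL S.mvA)
      ; sameL = λ _ _ _ → refl }
      where
      same : H e₂ i (suc c) ≡ H e i (suc c)
      same = R.off (suc c) i λ { (refl , refl) → ¬p (refl , refl) }
      free' : ∀ i' → suc i' ≡ i → ∀ v → Leg e₂ i' v → v ◁ H e₂ i' (suc (suc c)) → v ◀ a
      free' i' eq v (p , v<B) v◁ with move-gain R.mvA v<B p
      ... | inj₁ p₀ = S.free i' eq v (p₀ , v<B) (◁≤ v◁ (GR.H'≤ (suc (suc c)) i'))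
      ... | inj₂ (refl , refl) with j ≤? suc c
      ...   | yes j≤ = ≤◀ (H-row V i' j≤) (S.under i' eq)
      ...   | no j≰ = ⊥-elim (excl (◁≤ v◁ (≤-trans (H-row V₂ i' (≰⇒> j≰)) (≤-reflexive R.at))) R.over)

  -- Both entries head for the same hook `k`, and `l` comes first. If `k` is visible, the cell ends
  -- with hook `l`, arm `k` and leg `a` in either order: when `a` is second it bumps the leg `k`,
  -- and when `l` is second it bumps the hook `a`, which becomes a leg.
  module Up {e c a r l e₁ e₂} (V : Valid e) (S : HStep e c a (suc r) e₁) (R : D.HStep (e ᵗ) r l (suc c) (e₂ ᵗ)) (l◀a : l ◀ a) where
    open HH V S R

    k : ℕ
    k = H e (suc r) (suc c)

    L₃ : ℕ → ℕ → ℕ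
    L₃ = moved (L e) r l (suc r) a

    mv₃ : Move (L e) L₃ r l (suc r) a
    mv₃ = moved-Move {L e} (proj₁ (D.Particle.arm∈ R.part))

    e₃ : Enc
    e₃ = enc (H e₂) (A e₁) L₃

    a<B : a < B
    a<B = proj₂ (Particle.arm∈ S.part)

    at₁ : H e₁ (suc r) (suc c) ≡ a
    at₁ = S.at

    rows-clear : ∀ {j v} → r < j → ¬ Leg e j v
    rows-clear = D.Particle.last R.part _ _

    leg-step : D.HStep (e₁ ᵗ) r l (suc c) (e₃ ᵗ)
    leg-step = record
      { part = D.same-particle {e ᵗ} {e₁ ᵗ} S.sameL R.part
      ; over = subst (l ◀_) (sym at₁) l◀a
      ; under = λ { _ refl → subst (_◁ l) (sym (S.off (suc r) c λ ())) (R.under c refl) }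
      ; free = λ { _ refl v (p , v<B) v◀ → case move-gain S.mvA v<B p of λ
          { (inj₁ p₀) → R.free c refl v (p₀ , v<B) (subst (v ◀_) (S.off (suc (suc r)) c λ { (() , _) }) v◀)
          ; (inj₂ ()) } }
      ; at = R.at
      ; off = λ j' i' ¬p → trans (R.off j' i' ¬p) (sym (S.off i' j' λ { (refl , refl) → ¬p (refl , refl) }))
      ; mvA = subst (Move (L e₁) L₃ r l (suc r)) (sym at₁) (move-source S.sameL mv₃)
      ; sameL = λ _ _ _ → refl }

    arm-step : k < B → GStep e₂ c a (suc r) k e₃
    arm-step k<B = record
      { part = same-particle R.sameL S.part
      ; leg∈ = move-new R.mvA k<B (λ { (() , _) }) , k<B
      ; under = subst (_◀ a) (sym R.at) l◀a
      ; over = S.over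
      ; right = subst (k ◁_) (sym (R.off (suc (suc c)) (suc r) λ { (() , _) })) (Valid.row V (suc r) (suc c))
      ; min = λ v (p , v<B) _ → case move-gain R.mvA v<B p of λ
          { (inj₁ p₀) → ⊥-elim (rows-clear ≤-refl (p₀ , v<B)) ; (inj₂ (_ , refl)) → ≤-refl }
      ; sameH = λ _ _ → refl
      ; mvA = move-source R.sameL S.mvA
      ; mvL = move-retarget R.mvA mv₃ }

    -- If `k` is fictitious, the new cell keeps `l`, and `a` continues into the cell above it, whose
    -- fictitious hook is `K`.
    K : ℕ
    K = H e (suc (suc r)) (suc c)

    e₄ : Enc
    e₄ = enc (update (H e₂) (suc (suc r)) (suc c) a) (A e₁) (L e₂)

    a<K : a < K
    a<K = ◁◀⇒< S.over (Valid.col V (suc r) (suc c))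

    same-K : H e₂ (suc (suc r)) (suc c) ≡ K
    same-K = R.off (suc c) (suc (suc r)) λ { (_ , ()) }

    K-big : B ≤ k → B ≤ K
    K-big big = ≤-trans big (◀⇒≤ (Valid.col V (suc r) (suc c)))

    exit-arm : B ≤ k → HStep e₂ c a (suc (suc r)) e₄
    exit-arm big = record
      { part = same-particle R.sameL S.part
      ; over = <⇒◁ (subst (a <_) (sym same-K) a<K)
      ; under = λ { _ refl → subst (_◀ a) (sym R.at) l◀a }
      ; free = λ { _ refl v (p , v<B) _ → ⊥-elim (case move-gain R.mvA v<B p of λ
          { (inj₁ p₀) → rows-clear ≤-refl (p₀ , v<B) ; (inj₂ (_ , refl)) → <⇒≱ v<B big }) }
      ; at = update-at (H e₂) (suc (suc r)) (suc c) a
      ; off = λ _ _ → update-off (H e₂) (suc (suc r)) (suc c) a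
      -- The arm now bumps `K` instead of `k`; both are invisible, so the multisets do not notice.
      ; mvA = move-big big (subst (B ≤_) (sym same-K) (K-big big)) (move-source R.sameL S.mvA)
      ; sameL = λ _ _ _ → refl }

    exit-leg : B ≤ k → D.HStep (e₃ ᵗ) (suc r) a (suc c) (e₄ ᵗ)
    exit-leg big = record
      { part = record
          { arm∈ = move-new mv₃ a<B (λ { (() , _) }) , a<B
          ; max = λ v (p , v<B) → case move-gain mv₃ v<B p of λ
              { (inj₁ p₀) → ⊥-elim (rows-clear ≤-refl (p₀ , v<B)) ; (inj₂ (_ , refl)) → ≤-refl }
          ; last = λ j v r<j (p , v<B) → case move-gain mv₃ v<B p of λ
              { (inj₁ p₀) → rows-clear (<-trans ≤-refl r<j) (p₀ , v<B) ; (inj₂ (refl , _)) → <-irrefl refl r<j } }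
      ; over = <⇒◀ (subst (a <_) (sym same-K) a<K)
      ; under = λ { _ refl → subst (_◁ a) (sym (R.off c (suc (suc r)) λ { (_ , ()) })) left }
      ; free = λ { _ refl v (p , v<B) _ → GS.rest◁ v<B p }
      ; at = update-at (H e₂) (suc (suc r)) (suc c) a
      ; off = λ j' i' ¬p → update-off (H e₂) (suc (suc r)) (suc c) a λ { (refl , refl) → ¬p (refl , refl) }
      ; mvA = move-back big (subst (B ≤_) (sym same-K) (K-big big)) (move-retarget R.mvA mv₃)
      ; sameL = λ _ _ _ → refl }
      where
      -- Otherwise `R.free`, applied to the arm `a` of column `c`, would give `a ◁ l`.
      left : H e (suc (suc r)) c ◁ a
      left with dich (H e (suc (suc r)) c) a
      ... | inj₁ p = p
      ... | inj₂ q = ⊥-elim (excl (R.free c refl a (Particle.arm∈ S.part) q) l◀a)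

  module GH {e c a i k e₁ r l j e₂} (V : Valid e) (S : GStep e c a i k e₁) (R : D.HStep (e ᵗ) r l j (e₂ ᵗ)) where
    module S = GStep S
    module R = D.HStep R
    module GS = OfGStep V S
    module GR = D.OfHStep (Valid-ᵗ V) R
    module RP = D.Particle R.part

    i≤r : i ≤ r
    i≤r = ≮⇒≥ λ r<i → RP.last _ _ r<i S.leg∈

    k<B : k < B
    k<B = proj₂ S.leg∈

    k≤l : i ≡ r → k ≤ l
    k≤l eq = RP.max k (subst (λ z → Leg e z k) eq S.leg∈)

    off-r : ∀ i' j' → i' ≤ r → H e₂ i' j' ≡ H e i' j'
    off-r i' j' i'≤r = R.off j' i' λ { (_ , refl) → <⇒≱ ≤-refl i'≤r }

    L₃ : ℕ → ℕ → ℕ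
    L₃ = moved (L e₂) i k i a

    -- As long as `k` is still a leg of its row after the leg step, the two steps do not interfere.
    module Generic (k∈ : 0 < L e₂ i k) where
      e₃ : Enc
      e₃ = enc (H e₂) (A e₁) L₃

      mv₃ : Move (L e₂) L₃ i k i a
      mv₃ = moved-Move {L e₂} k∈

      arm-step : GStep e₂ c a i k e₃
      arm-step = record
        { part = same-particle R.sameL S.part
        ; leg∈ = k∈ , k<B
        ; under = ≤◀ (GR.H'≤ (suc c) i) S.under
        ; over = S.over
        ; right = subst (k ◁_) (sym (off-r i (suc (suc c)) i≤r)) S.right
        ; min = λ v (p , v<B) a◁v → case move-gain R.mvA v<B p of λ
            { (inj₁ p₀) → S.min v (p₀ , v<B) a◁v ; (inj₂ (eq , _)) → ⊥-elim (<⇒≱ (≤-reflexive eq) i≤r) }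
        ; sameH = λ _ _ → refl
        ; mvA = move-source R.sameL S.mvA
        ; mvL = mv₃ }

      l∈ : 0 < L e₁ r l
      l∈ with pos≟ i k r l
      ... | no ¬p = move-keep S.mvL (proj₂ RP.arm∈) (proj₁ RP.arm∈) ¬p
      -- The moving leg has the value `k`, and `k` survived because it occurred twice. This concerns
      -- the transposed reading, where legs stand for arms.
      ... | yes (eq , eq') = move-keep² S.mvL (proj₂ RP.arm∈) (subst₂ (λ r l → 2 ≤ L e r l) eq eq'
                               (move-left (subst₂ (λ x y → Move (L e) (L e₂) x y (suc r) (H e (suc r) j)) (sym eq) (sym eq') R.mvA)
                                 k<B (λ { (eq₂ , _) → <⇒≱ (≤-reflexive (sym eq₂)) i≤r }) k∈))

      leg-step : D.HStep (e₁ ᵗ) r l j (e₃ ᵗ)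
      leg-step = record
        { part = record
            { arm∈ = l∈ , proj₂ RP.arm∈
            ; max = λ v (p , v<B) → case move-gain S.mvL v<B p of λ
                { (inj₁ p₀) → RP.max v (p₀ , v<B) ; (inj₂ (eq , refl)) → ≤-trans GS.a≤k (k≤l eq) }
            ; last = λ j' v r<j' (p , v<B) → case move-gain S.mvL v<B p of λ
                { (inj₁ p₀) → RP.last j' v r<j' (p₀ , v<B) ; (inj₂ (refl , _)) → <⇒≱ r<j' i≤r } }
        ; over = subst (l ◀_) (sym (S.sameH (suc r) j)) R.over
        ; under = λ j' eq → subst (_◁ l) (sym (S.sameH (suc r) j')) (R.under j' eq)
        ; free = λ j' eq v (p , v<B) v◀ → case move-gain S.mvA v<B p of λ
            { (inj₁ p₀) → R.free j' eq v (p₀ , v<B) (subst (v ◀_) (S.sameH (suc (suc r)) j') v◀)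
            -- The bumped `k` is the only new arm. If its column is the one left of the leg's
            -- target, it is bounded by the hook there, which precedes `l`.
            ; (inj₂ (refl , refl)) → <⇒◁ (◀◁⇒< (◀≤ GS.k-above (H-col V (suc c) (s≤s i≤r))) (R.under (suc c) eq)) }
        ; at = R.at
        ; off = λ j' i' ¬p → trans (R.off j' i' ¬p) (sym (S.sameH i' j'))
        ; mvA = subst (Move (L e₁) L₃ r l (suc r)) (sym (S.sameH (suc r) j)) (move-square S.mvL R.mvA mv₃)
        ; sameL = λ _ _ _ → refl }

  -- In the row above, the hook of column `c` is `◁ k`, because it is `◁ a`, and the hook of column
  -- `suc c` is not. The leg `k` therefore replaces the latter.
  crossing-column : ∀ {e c a i k e₁ j e₂} → Valid e → GStep e c a i k e₁ → D.HStep (e ᵗ) i k j (e₂ ᵗ) → suc c ≡ j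
  crossing-column {c = c} {i = i} {j = j} V S R with <-cmp (suc c) j
  ... | tri≈ _ eq _ = eq
  ... | tri> _ _ (s≤s j≤c) = ⊥-elim (excl (≤◁ (H-row V (suc i) j≤c) (◁≤ (OfGStep.left V S) (OfGStep.a≤k V S))) (D.HStep.over R))
  ... | tri< (s≤s c≤j') _ _ = ⊥-elim (excl (≤◁ (H-row V (suc i) c≤j') (D.HStep.under R _ refl)) (OfGStep.k-above V S))

  -- The leg k bumped by the arm is the leg about to move: it takes the arm's
  -- place as the moving arm, and the arm becomes the moving leg.
  module Crossing {e c a i k e₁ e₂} (V : Valid e) (S : GStep e c a i k e₁) (R : D.HStep (e ᵗ) i k (suc c) (e₂ ᵗ))
                  (gone : L e₂ i k ≡ 0) where
    open GH V S R using (module S; module R; module GS; module GR; module RP; k<B)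

    e₃ : Enc
    e₃ = enc (update (H e₂) (suc i) (suc c) a) (A e₁) (L e₂)

    only : ∀ {v} → Leg e i v → a ◁ v → v ≡ k
    only v∈ a◁v = ≤-antisym (RP.max _ v∈) (S.min _ v∈ a◁v)

    arm-step : HStep e₂ c a (suc i) e₃
    arm-step = record
      { part = same-particle R.sameL S.part
      ; over = subst (a ◁_) (sym R.at) S.over
      ; under = λ { _ refl → ≤◀ (GR.H'≤ (suc c) i) S.under }
      ; free = λ { _ refl v v∈ _ → free' v v∈ }
      ; at = update-at (H e₂) (suc i) (suc c) a
      ; off = λ _ _ → update-off (H e₂) (suc i) (suc c) a
      ; mvA = subst (Move (A e₂) (A e₁) c a (suc c)) (sym R.at) (move-source R.sameL S.mvA)
      ; sameL = λ _ _ _ → refl }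
      where
      free' : ∀ v → Leg e₂ i v → v ◀ a
      free' v (p , v<B) with move-gain R.mvA v<B p | dich a v
      ... | _ | inj₂ q = q
      ... | inj₁ p₀ | inj₁ a◁v = ⊥-elim (<⇒≢ p (sym (subst (λ z → L e₂ i z ≡ 0) (sym (only (p₀ , v<B) a◁v)) gone)))

    arm-fin : H e₂ (suc i) (suc c) < B
    arm-fin = subst (_< B) (sym R.at) k<B

    leg-step : D.HStep (e₁ ᵗ) i a (suc c) (e₃ ᵗ)
    leg-step = record
      { part = record
          { arm∈ = move-new⁺ S.mvL a<B (proj₁ S.leg∈) , a<B
          ; max = max'
          ; last = λ j' v i<j' (p , v<B) → case move-gain S.mvL v<B p of λ
              { (inj₁ p₀) → RP.last j' v i<j' (p₀ , v<B) ; (inj₂ (refl , _)) → <-irrefl refl i<j' } }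
      ; over = subst (a ◀_) (sym (S.sameH (suc i) (suc c))) (≤◀ GS.a≤k R.over)
      ; under = λ { _ refl → subst (_◁ a) (sym (S.sameH (suc i) c)) GS.left }
      ; free = λ { _ refl v (p , v<B) _ → GS.rest◁ v<B p }
      ; at = update-at (H e₂) (suc i) (suc c) a
      ; off = λ j' i' ¬p → trans (update-off (H e₂) (suc i) (suc c) a λ { (refl , refl) → ¬p (refl , refl) })
                             (trans (R.off j' i' ¬p) (sym (S.sameH i' j')))
      ; mvA = subst (Move (L e₁) (L e₂) i a (suc i)) (sym (S.sameH (suc i) (suc c))) (move-retarget S.mvL R.mvA)
      ; sameL = λ _ _ _ → refl }
      where
      a<B : a < B
      a<B = proj₂ (Particle.arm∈ S.part)
      once : L e i k ≡ 1
      once = trans (sym (trans (balance R.mvA i k k<B) (trans (cong (L e i k +_) (δ-miss λ { (() , _) })) (+-identityʳ _))))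
                   (cong₂ _+_ gone (δ-hit i k))
      absent : a ≢ k → ∀ {v} → v ≡ k → ¬ 0 < L e₁ i v
      absent a≢k refl p = <⇒≢ p (sym (move-gone S.mvL k<B (λ { (_ , eq) → a≢k (sym eq) }) once))
      max' : ∀ v → Leg e₁ i v → v ≤ a
      max' v (p , v<B) with move-gain S.mvL v<B p | dich a v
      ... | inj₂ (_ , refl) | _ = ≤-refl
      ... | _ | inj₂ q = ◀⇒≤ q
      ... | inj₁ p₀ | inj₁ a◁v with a ≟ k
      ...   | yes eq = ≤-reflexive (trans (only (p₀ , v<B) a◁v) (sym eq))
      ...   | no a≢k = ⊥-elim (absent a≢k (only (p₀ , v<B) a◁v) p)

  -- A leg step into a hook takes only the moving leg from the legs. So if `k` has disappeared from
  -- its row, `k` was the moving leg and the paths cross.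
  leg-hook : ∀ {e c a i k e₁ r l j e₂} → Valid e → GStep e c a i k e₁ → D.HStep (e ᵗ) r l j (e₂ ᵗ) →
             Σ Enc λ e₃ → Slide e₂ c e₃ × Σ ℕ λ l' → D.HStep (e₁ ᵗ) r l' j (e₃ ᵗ)
  leg-hook {e} {i = i} {k = k} {r = r} {l = l} {e₂ = e₂} V S R with L e₂ i k in eq
  ... | suc n = e₃ , bump-leg arm-step , _ , leg-step
    where open GH.Generic V S R (subst (0 <_) (sym eq) (s≤s z≤n))
  ... | zero with pos≟ r l i k
  ...   | no ¬p = ⊥-elim (<⇒≢ (move-keep (D.HStep.mvA R) (proj₂ (GStep.leg∈ S)) (proj₁ (GStep.leg∈ S)) ¬p) (sym eq))
  ...   | yes (refl , refl) with crossing-column V S R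
  ...     | refl = Crossing.e₃ V S R eq , bump-hook (Crossing.arm-step V S R eq) (Crossing.arm-fin V S R eq) , _ , Crossing.leg-step V S R eq

  module GG {e c a i k e₁ r l j k' e₂} (V : Valid e) (S : GStep e c a i k e₁) (R : D.GStep (e ᵗ) r l j k' (e₂ ᵗ)) where
    module S = GStep S
    module R = D.GStep R
    module GS = OfGStep V S
    module GR = D.OfGStep (Valid-ᵗ V) R
    module SP = Particle S.part
    module RP = D.Particle R.part

    i≤r : i ≤ r
    i≤r = ≮⇒≥ λ r<i → RP.last _ _ r<i S.leg∈

    j≤c : j ≤ c
    j≤c = ≮⇒≥ λ c<j → SP.last _ _ c<j R.leg∈

    k'≤a : ∀ {j'} → j ≡ j' → j' ≡ c → k' ≤ a
    k'≤a eq refl = SP.max k' (subst (λ z → Arm e z k') eq R.leg∈)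

    -- In column `c`, maximality of `a` gives `k' ≤ a`, whereas `a ◁ k` and `k ◀ k'` give `a < k'`.
    -- In an earlier column, `k'` precedes the hook to its right, which is at most a hook that is
    -- `◁ a`; then `k' ◁ k`, and `k` could not have bumped `k'`.
    no-crossing : ¬ (r ≡ i × l ≡ k)
    no-crossing (r≡i , l≡k) with m≤n⇒m<n∨m≡n j≤c
    ... | inj₂ j≡c = <⇒≱ (◁◀⇒< S.over (subst (_◀ k') l≡k R.over)) (k'≤a j≡c refl)
    ... | inj₁ j<c = excl (◁≤ (≤◁ (≤-trans (◁⇒≤ GR.k-above) (H-row V (suc r) j<c)) (subst (λ z → H e (suc z) c ◁ a) (sym r≡i) GS.left)) GS.a≤k)
                          (subst (_◀ k') l≡k R.over)

    stays : ∀ {e₃} → (∀ i j → H e₃ i j ≡ H e₂ i j) → ¬ (j ≡ c × k' ≡ a) → Move (A e₂) (A e₃) c a (suc c) k → Move (L e₂) (L e₃) i k i a →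
            GStep e₂ c a i k e₃
    stays sameH ¬p mA mL = record
      { part = record
          { arm∈ = move-keep R.mvL (proj₂ SP.arm∈) (proj₁ SP.arm∈) ¬p , proj₂ SP.arm∈
          ; max = λ v (p , v<B) → case move-gain R.mvL v<B p of λ
              { (inj₁ p₀) → SP.max v (p₀ , v<B) ; (inj₂ (eq , refl)) → ≤-trans GR.a≤k (k'≤a eq refl) }
          ; last = λ j' v c<j' (p , v<B) → case move-gain R.mvL v<B p of λ
              { (inj₁ p₀) → SP.last j' v c<j' (p₀ , v<B) ; (inj₂ (refl , _)) → <⇒≱ c<j' j≤c } }
      ; leg∈ = move-keep R.mvA (proj₂ S.leg∈) (proj₁ S.leg∈) no-crossing , proj₂ S.leg∈
      ; under = subst (_◀ a) (sym (R.sameH (suc c) i)) S.under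
      ; over = S.over
      ; right = subst (k ◁_) (sym (R.sameH (suc (suc c)) i)) S.right
      ; min = λ v (p , v<B) a◁v → case move-gain R.mvA v<B p of λ
          { (inj₁ p₀) → S.min v (p₀ , v<B) a◁v ; (inj₂ (eq , _)) → ⊥-elim (<⇒≱ (≤-reflexive eq) i≤r) }
      ; sameH = sameH ; mvA = mA ; mvL = mL }

module Tile (B : ℕ) (_◁_ _◀_ : ℕ → ℕ → Set) (orders : Orders _◁_ _◀_) where
  open Bounded B
  open Half B _◁_ _◀_ orders
  open Orders orders
  open TileHalf B _◁_ _◀_ orders
  module U = TileHalf B _◀_ _◁_ (transposed orders)

  hook-hook : ∀ {e c a i e₁ r l j e₂} → Valid e → HStep e c a i e₁ → D.HStep (e ᵗ) r l j (e₂ ᵗ) → ¬ (i ≡ suc r × suc c ≡ j) →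
              Σ Enc λ e₃ → HStep e₂ c a i e₃ × D.HStep (e₁ ᵗ) r l j (e₃ ᵗ)
  hook-hook {e} {c} {a} {i} {e₁} {r} {l} {j} {e₂} V S R ¬p =
    enc H₃ (A e₁) (L e₂) ,
    HH.distinct V S R ¬p (update-at (H e₂) i (suc c) a) (λ _ _ → update-off (H e₂) i (suc c) a) ,
    U.HH.distinct (Valid-ᵗ V) R S (λ (p , q) → ¬p (sym q , sym p))
      (trans (update-off (H e₂) i (suc c) a ¬p) (D.HStep.at R)) off'
    where
    H₃ = update (H e₂) i (suc c) a
    off' : ∀ j' i' → ¬ (j ≡ j' × suc r ≡ i') → H₃ i' j' ≡ H e₁ i' j'
    off' j' i' ¬q with pos≟ i (suc c) i' j'
    ... | yes (refl , refl) = sym (HStep.at S)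
    ... | no ¬p' = trans (D.HStep.off R j' i' ¬q) (sym (HStep.off S i' j' ¬p'))

  leg-leg : ∀ {e c a i k e₁ r l j k' e₂} → Valid e → GStep e c a i k e₁ → D.GStep (e ᵗ) r l j k' (e₂ ᵗ) →
            Σ Enc λ e₃ → GStep e₂ c a i k e₃ × D.GStep (e₁ ᵗ) r l j k' (e₃ ᵗ)
  leg-leg {e} {c} {a} {i} {k} {e₁} {r} {l} {j} {k'} {e₂} V S R =
    enc (H e) (moved (A e₂) c a (suc c) k) (moved (L e₂) i k i a) ,
    G.stays (λ i j → sym (R.sameH j i)) (λ (p , q) → U.GG.no-crossing (Valid-ᵗ V) R S (sym p , sym q)) mvA mvL ,
    U.GG.stays (Valid-ᵗ V) R S (λ j i → sym (S.sameH i j)) (λ (p , q) → G.no-crossing (sym p , sym q))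
      (move-square S.mvL R.mvA mvL) (move-square S.mvA R.mvL mvA)
    where
    module S = GStep S
    module R = D.GStep R
    module G = GG V S R
    mvA = moved-Move {A e₂} (move-keep R.mvL (proj₂ G.SP.arm∈) (proj₁ G.SP.arm∈) (λ (p , q) → U.GG.no-crossing (Valid-ᵗ V) R S (sym p , sym q)))
    mvL = moved-Move {L e₂} (move-keep R.mvA (proj₂ S.leg∈) (proj₁ S.leg∈) G.no-crossing)

  hook-leg : ∀ {e c a i e₁ r l j k' e₂} → Valid e → HStep e c a i e₁ → D.GStep (e ᵗ) r l j k' (e₂ ᵗ) →
             Σ Enc λ e₃ → D.Slide (e₁ ᵗ) r (e₃ ᵗ) × Σ ℕ λ a' → HStep e₂ c a' i e₃
  hook-leg V S R with U.leg-hook (Valid-ᵗ V) R S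
  ... | e₃ , R' , a' , S' = e₃ ᵗ , R' , a' , S'

  slide-slide : ∀ {e c e₁ r e₂} → Valid e → Slide e c e₁ → D.Slide (e ᵗ) r (e₂ ᵗ) →
                Σ Enc λ e₃ → Slide e₂ c e₃ × D.Slide (e₁ ᵗ) r (e₃ ᵗ)
  slide-slide {c = c} {r = r} V (bump-hook {a} {i} S p) (D.bump-hook {l} {j} R q) with pos≟ i (suc c) (suc r) j
  ... | no ¬p with hook-hook V S R ¬p
  ...   | e₃ , S' , R' = e₃ , bump-hook S' (subst (_< B) (sym (D.HStep.off R _ _ λ (p , q) → ¬p (sym q , sym p))) p)
                            , D.bump-hook R' (subst (_< B) (sym (HStep.off S _ _ ¬p)) q)
  slide-slide V (bump-hook {a} S p) (D.bump-hook {l} R q) | yes (refl , refl) with dich a l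
  ... | inj₂ l◀a = Up.e₃ V S R l◀a , bump-leg (Up.arm-step V S R l◀a p) ,
                   D.bump-hook (Up.leg-step V S R l◀a) (subst (_< B) (sym (HStep.at S)) (proj₂ (Particle.arm∈ (HStep.part S))))
  ... | inj₁ a◁l = U.Up.e₃ (Valid-ᵗ V) R S a◁l ᵗ ,
                   bump-hook (U.Up.leg-step (Valid-ᵗ V) R S a◁l) (subst (_< B) (sym (D.HStep.at R)) (proj₂ (D.Particle.arm∈ (D.HStep.part R)))) ,
                   D.bump-leg (U.Up.arm-step (Valid-ᵗ V) R S a◁l q)
  slide-slide V (bump-leg S) (D.bump-hook R q) with leg-hook V S R
  ... | e₃ , S' , _ , R' = e₃ , S' , D.bump-hook R' (subst (_< B) (sym (GStep.sameH S _ _)) q)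
  slide-slide V (bump-hook S p) (D.bump-leg R) with hook-leg V S R
  ... | e₃ , R' , _ , S' = e₃ , bump-hook S' (subst (_< B) (sym (D.GStep.sameH R _ _)) p) , R'
  slide-slide V (bump-leg S) (D.bump-leg R) with leg-leg V S R
  ... | e₃ , S' , R' = e₃ , bump-leg S' , D.bump-leg R'

  exit-slide : ∀ {e c i e₁ r e₂} → Valid e → Exit e c i e₁ → D.Slide (e ᵗ) r (e₂ ᵗ) →
               Σ Enc λ e₃ → Exit e₂ c i e₃ × D.Slide (e₁ ᵗ) r (e₃ ᵗ)
  exit-slide {e} {c} {i} {r = r} V (exit S p) (D.bump-hook {l} {j} R q) with pos≟ i (suc c) (suc r) j
  ... | yes (refl , refl) = ⊥-elim (<⇒≱ q p)
  ... | no ¬p with hook-hook V S R ¬p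
  ...   | e₃ , S' , R' = e₃ , exit S' (subst (B ≤_) (sym (D.HStep.off R _ _ λ (p , q) → ¬p (sym q , sym p))) p)
                            , D.bump-hook R' (subst (_< B) (sym (HStep.off S _ _ ¬p)) q)
  exit-slide V (exit S p) (D.bump-leg R) with hook-leg V S R
  ... | e₃ , R' , _ , S' = e₃ , exit S' (subst (B ≤_) (sym (D.GStep.sameH R _ _)) p) , R'

  -- Two exits commute, except that two exits into the same cell make the second
  -- one continue for one more step, into the cell above or to the right of it.
  data Corner (c i r j : ℕ) (e₁ e₂ e₃ : Enc) : Set where
    apart : ¬ (i ≡ suc r × suc c ≡ j) → Exit e₂ c i e₃ → D.Exit (e₁ ᵗ) r j (e₃ ᵗ) → Corner c i r j e₁ e₂ e₃
    up    : ∀ f → i ≡ suc r → suc c ≡ j → Exit e₂ c (suc i) e₃ →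
            D.Slide (e₁ ᵗ) r (f ᵗ) → D.Exit (f ᵗ) (suc r) j (e₃ ᵗ) → Corner c i r j e₁ e₂ e₃
    right : ∀ f → i ≡ suc r → suc c ≡ j → D.Exit (e₁ ᵗ) r (suc j) (e₃ ᵗ) →
            Slide e₂ c f → Exit f (suc c) i e₃ → Corner c i r j e₁ e₂ e₃

  exit-exit : ∀ {e c i e₁ r j e₂} → Valid e → Exit e c i e₁ → D.Exit (e ᵗ) r j (e₂ ᵗ) → Σ Enc (Corner c i r j e₁ e₂)
  exit-exit {c = c} {i} {r = r} {j} V (exit {a} S p) (D.exit {l} R q) with pos≟ i (suc c) (suc r) j
  ... | no ¬p with hook-hook V S R ¬p
  ...   | e₃ , S' , R' = e₃ , apart ¬p (exit S' (subst (B ≤_) (sym (D.HStep.off R _ _ λ (p , q) → ¬p (sym q , sym p))) p))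
                                       (D.exit R' (subst (B ≤_) (sym (HStep.off S _ _ ¬p)) q))
  exit-exit V (exit {a} S p) (D.exit {l} R q) | yes (refl , refl) with dich a l
  ... | inj₂ l◀a = X.e₄ , up X.e₃ refl refl (exit (X.exit-arm p) (subst (B ≤_) (sym X.same-K) (X.K-big p)))
                     (D.bump-hook X.leg-step (subst (_< B) (sym (HStep.at S)) (proj₂ (Particle.arm∈ (HStep.part S)))))
                     (D.exit (X.exit-leg p) (subst (B ≤_) (sym X.same-K) (X.K-big p)))
    where module X = Up V S R l◀a
  ... | inj₁ a◁l = X.e₄ ᵗ , right (X.e₃ ᵗ) refl refl (D.exit (X.exit-arm q) (subst (B ≤_) (sym X.same-K) (X.K-big q)))
                     (bump-hook X.leg-step (subst (_< B) (sym (D.HStep.at R)) (proj₂ (D.Particle.arm∈ (D.HStep.part R)))))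
                     (exit (X.exit-leg q) (subst (B ≤_) (sym X.same-K) (X.K-big q)))
    where module X = U.Up (Valid-ᵗ V) R S a◁l

-- Growth of the shape

count-head : ∀ i k xs → 0 < count ((i , k) ∷ xs) i k
count-head i k xs = subst (λ z → 0 < z + count xs i k) (sym (δ-hit i k)) (s≤s z≤n)

count-tail : ∀ i k xs {j v} → 0 < count xs j v → 0 < count ((i , k) ∷ xs) j v
count-tail i k xs {j} {v} p = m≤n⇒m≤o+n (δ i k j v) p

count-cases : ∀ i k xs {j v} → 0 < count ((i , k) ∷ xs) j v → (i ≡ j × k ≡ v) ⊎ 0 < count xs j v
count-cases i k xs {j} {v} p with pos≟ i k j v
... | yes q = inj₁ q
... | no _ = inj₂ p

count-remove : ∀ xs {i k} → 0 < count xs i k →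
               Σ (List (ℕ × ℕ)) λ ys → length xs ≡ suc (length ys) ×
               (∀ {P : ℕ × ℕ → Set} → All P xs → All P ys) × (∀ j v → count xs j v ≡ count ys j v + δ i k j v)
count-remove ((i' , k') ∷ xs) {i} {k} p with pos≟ i' k' i k
... | yes (refl , refl) = xs , refl , (λ { (_ ∷ ps) → ps }) , λ j v → +-comm (δ i k j v) (count xs j v)
... | no _ with count-remove xs p
...   | ys , eq , sub , bal = (i' , k') ∷ ys , cong suc eq , (λ { (q ∷ qs) → q ∷ sub qs }) , λ j v →
          trans (cong (δ i' k' j v +_) (bal j v)) (sym (+-assoc (δ i' k' j v) _ _))

module _ {B : ℕ} where
  open Bounded B

  move-trans : ∀ {f f₁ f₂ c a p k q b} → Move f f₁ c a p k → Move f₁ f₂ p k q b → Move f f₂ c a q b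
  move-trans {f} {f₁} {f₂} {c} {a} {p} {k} {q} {b} m₁ m₂ = move λ j v v<B →
    +-cancelʳ-≡ (δ p k j v) _ _ (trans
      (solve 3 (λ x y z → (x :+ y) :+ z := (x :+ z) :+ y) refl (f₂ j v) (δ c a j v) (δ p k j v)) (trans
      (cong (_+ δ c a j v) (balance m₂ j v v<B)) (trans
      (solve 3 (λ x y z → (x :+ y) :+ z := (x :+ z) :+ y) refl (f₁ j v) (δ q b j v) (δ c a j v)) (trans
      (cong (_+ δ q b j v) (balance m₁ j v v<B))
      (solve 3 (λ x y z → (x :+ y) :+ z := (x :+ z) :+ y) refl (f j v) (δ p k j v) (δ q b j v))))))
    where open +-*-Solver

  listed-drop : ∀ {f f' i k i₂ n} → 0 < f i k → k < B → Move f f' i k i₂ B → Listed f (suc n) → Listed f' n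
  listed-drop {f} {f'} {i} {k} p k<B m (listed xs len sm cs) with count-remove xs (subst (0 <_) (cs i k k<B) p)
  ... | ys , eq , sub , bal = listed ys (suc-injective (trans (sym eq) len)) (sub sm) λ j v v<B →
        +-cancelʳ-≡ (δ i k j v) _ _ (trans (balance m j v v<B) (trans (cong (f j v +_) (δ-big ≤-refl v<B))
          (trans (+-identityʳ _) (trans (cs j v v<B) (bal j v)))))

  listed-move : ∀ {f f' i k i₂ a n} → 0 < f i k → k < B → a < B → Move f f' i k i₂ a → Listed f n → Listed f' n
  listed-move {f} {f'} {i} {k} {i₂} {a} p k<B a<B m (listed xs len sm cs) with count-remove xs (subst (0 <_) (cs i k k<B) p)
  ... | ys , eq , sub , bal = listed ((i₂ , a) ∷ ys) (trans (sym eq) len) (a<B ∷ sub sm) λ j v v<B →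
        +-cancelʳ-≡ (δ i k j v) _ _ (trans (balance m j v v<B) (trans (cong (_+ δ i₂ a j v) (trans (cs j v v<B) (bal j v)))
          (trans (+-comm _ (δ i₂ a j v)) (sym (+-assoc (δ i₂ a j v) _ _)))))

  listed-cong : ∀ {f f' n} → (∀ j v → v < B → f' j v ≡ f j v) → Listed f n → Listed f' n
  listed-cong eq (listed xs len sm cs) = listed xs len sm λ j v v<B → trans (eq j v v<B) (cs j v v<B)

  listed-zero : ∀ {f} → Listed f 0 → ∀ {j v} → v < B → ¬ 0 < f j v
  listed-zero (listed [] _ _ cs) v<B p = <⇒≢ p (sym (cs _ _ v<B))

  Adds-narrow : ∀ {e i j e'} → Adds e i j e' → Narrow e → Narrow e'
  Adds-narrow {j = j} ad (w , big) = w ⊔ suc j , λ i' j' le → ≮⇒≥ λ fin → case Adds.fresh ad i' j' fin of λ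
    { (inj₁ fin₀) → <⇒≱ fin₀ (big i' j' (≤-trans (m≤m⊔n w (suc j)) le))
    ; (inj₂ (_ , refl)) → <⇒≱ ≤-refl (≤-trans (m≤n⊔m w (suc j)) le) }

module Growth (B : ℕ) (_◁_ _◀_ : ℕ → ℕ → Set) (orders : Orders _◁_ _◀_) where
  open Bounded B
  open Half B _◁_ _◀_ orders
  open Orders orders

  Slide-valid : ∀ {e c e'} → Valid e → Slide e c e' → Valid e'
  Slide-valid V (bump-hook S _) = HStep-valid V S
  Slide-valid V (bump-leg S) = GStep-valid V S

  Exit-valid : ∀ {e c i e'} → Valid e → Exit e c i e' → Valid e'
  Exit-valid V (exit S _) = HStep-valid V S

  Grow-valid : ∀ {e c i j e'} → Valid e → Grow e c i j e' → Valid e'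
  Grow-valid V (exits X) = Exit-valid V X
  Grow-valid V (slides S G) = Grow-valid (Slide-valid V S) G

  Grows-valid : ∀ {e ps e'} → Valid e → Grows e ps e' → Valid e'
  Grows-valid V [] = V
  Grows-valid V (G ∷ Gs) = Grows-valid (Grow-valid V G) Gs

  Slide-shape : ∀ {e c e'} → Slide e c e' → ∀ i j → (H e i j < B → H e' i j < B) × (H e' i j < B → H e i j < B)
  Slide-shape (bump-leg S) i j = subst (_< B) (sym (GStep.sameH S i j)) , subst (_< B) (GStep.sameH S i j)
  Slide-shape {c = c} (bump-hook {a} {i₀} S p) i j with pos≟ i₀ (suc c) i j
  ... | no ¬p = subst (_< B) (sym (HStep.off S i j ¬p)) , subst (_< B) (HStep.off S i j ¬p)
  ... | yes (refl , refl) = (λ _ → subst (_< B) (sym (HStep.at S)) (proj₂ (Particle.arm∈ (HStep.part S)))) , λ _ → p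

  Exit-adds : ∀ {e c i e'} → Exit e c i e' → Adds e i (suc c) e'
  Exit-adds {e} {c} {i} {e'} (exit S big) = record { before = big ; after = fin ; kept = kept ; fresh = fresh }
    where
    fin : H e' i (suc c) < B
    fin = subst (_< B) (sym (HStep.at S)) (proj₂ (Particle.arm∈ (HStep.part S)))
    kept : ∀ i' j' → H e i' j' < B → H e' i' j' < B
    kept i' j' p with pos≟ i (suc c) i' j'
    ... | yes (refl , refl) = fin
    ... | no ¬p = subst (_< B) (sym (HStep.off S i' j' ¬p)) p
    fresh : ∀ i' j' → H e' i' j' < B → H e i' j' < B ⊎ (i ≡ i' × suc c ≡ j')
    fresh i' j' p with pos≟ i (suc c) i' j'
    ... | yes q = inj₂ q
    ... | no ¬p = inj₁ (subst (_< B) (HStep.off S i' j' ¬p) p)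

  Grow-adds : ∀ {e c i j e'} → Grow e c i j e' → Adds e i j e'
  Grow-adds (exits X) = Exit-adds X
  Grow-adds {i = i} {j} (slides S G) = record
    { before = ≮⇒≥ λ p → <⇒≱ (proj₁ (Slide-shape S i j) p) before
    ; after = after
    ; kept = λ i' j' p → kept i' j' (proj₁ (Slide-shape S i' j') p)
    ; fresh = λ i' j' p → Sum.map₁ (proj₂ (Slide-shape S i' j')) (fresh i' j' p) }
    where open Adds (Grow-adds G)

  -- The particle was in the last column with arms, so the bumped value is alone in the next one.
  follow : ∀ {e c a e' k} → Particle e c a → Move (A e) (A e') c a (suc c) k → k < B → Particle e' (suc c) k
  follow P m k<B = record
    { arm∈ = move-new m k<B (λ { (() , _) }) , k<B
    ; max = λ v (p , v<B) → case move-gain m v<B p of λ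
        { (inj₁ p₀) → ⊥-elim (last' _ _ ≤-refl (p₀ , v<B)) ; (inj₂ (_ , refl)) → ≤-refl }
    ; last = λ j v c<j (p , v<B) → case move-gain m v<B p of λ
        { (inj₁ p₀) → last' j v (<-trans ≤-refl c<j) (p₀ , v<B) ; (inj₂ (refl , _)) → <-irrefl refl c<j } }
    where open Particle P renaming (last to last')

  record SlideData (e : Enc) (c : ℕ) (e' : Enc) : Set where
    field
      {a k} : ℕ
      part  : Particle e c a
      moved-on : Particle e' (suc c) k
      mvA   : Move (A e) (A e') c a (suc c) k

  slide-data : ∀ {e c e'} → Slide e c e' → SlideData e c e'
  slide-data (bump-hook S p) = record { part = HStep.part S ; moved-on = follow (HStep.part S) (HStep.mvA S) p ; mvA = HStep.mvA S }
  slide-data (bump-leg S) = record { part = GStep.part S ; moved-on = follow (GStep.part S) (GStep.mvA S) (proj₂ (GStep.leg∈ S)) ; mvA = GStep.mvA S }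

  particle-unique : ∀ {e c a a'} → Particle e c a → Particle e c a' → a ≡ a'
  particle-unique P P' = ≤-antisym (Particle.max P' _ (Particle.arm∈ P)) (Particle.max P _ (Particle.arm∈ P'))

  -- The target value B stands for the exited arm, which is invisible from then on.
  grow-arms : ∀ {e c i j e'} → Grow e c i j e' → Σ ℕ λ a → Particle e c a × Move (A e) (A e') c a (suc c) B
  grow-arms (exits (exit S big)) = _ , HStep.part S , move-big big ≤-refl (HStep.mvA S)
  grow-arms (slides S G) with grow-arms G | slide-data S
  ... | k' , P' , m' | d with particle-unique (SlideData.moved-on d) P'
  ...   | refl = _ , SlideData.part d , move-big ≤-refl ≤-refl (move-trans (SlideData.mvA d) m')

  slide-legs : ∀ {e c e' n} → Slide e c e' → Listed (L e) n → Listed (L e') n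
  slide-legs (bump-hook S _) = listed-cong (HStep.sameL S)
  slide-legs (bump-leg S) = listed-move (proj₁ (GStep.leg∈ S)) (proj₂ (GStep.leg∈ S)) (proj₂ (Particle.arm∈ (GStep.part S))) (GStep.mvL S)

  grow-legs : ∀ {e c i j e' n} → Grow e c i j e' → Listed (L e) n → Listed (L e') n
  grow-legs (exits (exit S _)) ls = listed-cong (HStep.sameL S) ls
  grow-legs (slides S G) ls = grow-legs G (slide-legs S ls)

  grows-legs : ∀ {e ps e' n} → Grows e ps e' → Listed (L e) n → Listed (L e') n
  grows-legs [] ls = ls
  grows-legs (G ∷ Gs) ls = grows-legs Gs (grow-legs G ls)

  -- The particle is the lexicographic maximum among the pairs of column and value in the list.
  particle-exists : ∀ {e n} → Listed (A e) (suc n) → Σ ℕ λ c → Σ ℕ λ a → Particle e c a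
  particle-exists {e} (listed (x ∷ xs) _ (x<B ∷ sm) cs) with maximum x xs x<B sm
    where
    maximum : ∀ x xs → proj₂ x < B → All (λ p → proj₂ p < B) xs → Σ ℕ λ c → Σ ℕ λ a → 0 < count (x ∷ xs) c a × a < B ×
              (∀ j v → 0 < count (x ∷ xs) j v → j < c ⊎ (j ≡ c × v ≤ a))
    maximum (i , k) [] k<B [] = i , k , count-head i k [] , k<B , λ j v q → case count-cases i k [] q of λ
      { (inj₁ (refl , refl)) → inj₂ (refl , ≤-refl) ; (inj₂ ()) }
    maximum (i , k) (x ∷ xs) k<B (x<B ∷ sm) with maximum x xs x<B sm
    ... | c , a , p , a<B , top with <-cmp i c | k ≤? a
    ...   | tri< i<c _ _ | _ = c , a , count-tail i k (x ∷ xs) p , a<B , λ j v q → case count-cases i k (x ∷ xs) q of λ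
              { (inj₁ (refl , refl)) → inj₁ i<c ; (inj₂ q') → top j v q' }
    ...   | tri≈ _ refl _ | yes k≤a = c , a , count-tail i k (x ∷ xs) p , a<B , λ j v q → case count-cases i k (x ∷ xs) q of λ
              { (inj₁ (refl , refl)) → inj₂ (refl , k≤a) ; (inj₂ q') → top j v q' }
    ...   | tri≈ _ refl _ | no k≰a = i , k , count-head i k (x ∷ xs) , k<B , λ j v q → case count-cases i k (x ∷ xs) q of λ
              { (inj₁ (refl , refl)) → inj₂ (refl , ≤-refl)
              ; (inj₂ q') → Sum.map₂ (λ (eq , le) → eq , ≤-trans le (<⇒≤ (≰⇒> k≰a))) (top j v q') }
    ...   | tri> _ _ c<i | _ = i , k , count-head i k (x ∷ xs) , k<B , λ j v q → case count-cases i k (x ∷ xs) q of λ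
              { (inj₁ (refl , refl)) → inj₂ (refl , ≤-refl)
              ; (inj₂ q') → inj₁ (case top j v q' of λ { (inj₁ j<c) → <-trans j<c c<i ; (inj₂ (refl , _)) → c<i }) }
  ... | c , a , p , a<B , top = c , a , record
        { arm∈ = subst (0 <_) (sym (cs c a a<B)) p , a<B
        ; max = λ v (q , v<B) → case top c v (subst (0 <_) (cs c v v<B) q) of λ
            { (inj₁ c<c) → ⊥-elim (<-irrefl refl c<c) ; (inj₂ (_ , le)) → le }
        ; last = λ j v c<j (q , v<B) → case top j v (subst (0 <_) (cs j v v<B) q) of λ
            { (inj₁ j<c) → <-asym c<j j<c ; (inj₂ (refl , _)) → <-irrefl refl c<j } }

  -- Every bumping advances by one column, and only the first `w` columns contain anything to bump.
  -- The argument `d` of `go` counts down the columns still available.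
  grow-exists : ∀ {e c a} → Valid e → Narrow e → Particle e c a → Σ ℕ λ i → Σ ℕ λ j → Σ Enc λ e' → Grow e c i j e'
  grow-exists {c = c} V (w , big) P = go w V big P (m≤n⇒m≤o+n c (n≤1+n w))
    where
    go : ∀ d {e c a} → Valid e → (∀ i j → w ≤ j → B ≤ H e i j) → Particle e c a → w ≤ c + suc d →
         Σ ℕ λ i → Σ ℕ λ j → Σ Enc λ e' → Grow e c i j e'
    go d {e} {c} V big P le with step-exists V P
    go d {e} {c} V big P le | inj₁ (i , e₁ , S) with H e i (suc c) <? B
    ... | no k≮B = _ , _ , _ , exits (exit S (≮⇒≥ k≮B))
    go zero {e} {c} V big P le | inj₁ (i , e₁ , S) | yes k<B = ⊥-elim (<⇒≱ k<B (big _ _ (subst (w ≤_) (+-comm c 1) le)))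
    go (suc d) {e} {c} V big P le | inj₁ (i , e₁ , S) | yes k<B
      with go d (HStep-valid V S) (λ i' j' w≤j' → subst (B ≤_) (sym (HStep.off S i' j' λ { (refl , refl) → <⇒≱ k<B (big _ _ w≤j') })) (big i' j' w≤j'))
              (follow P (HStep.mvA S) k<B) (subst (w ≤_) (+-suc c (suc d)) le)
    ... | _ , _ , _ , G = _ , _ , _ , slides (bump-hook S k<B) G
    -- Bumping a leg also requires a filled cell: the hook under that leg is `◀ a` and thus below
    -- `B`.
    go zero {e} {c} V big P le | inj₂ (i , k , e₁ , S) =
      ⊥-elim (<⇒≱ (proj₂ (Particle.arm∈ P)) (≤-trans (big _ _ (subst (w ≤_) (+-comm c 1) le)) (◀⇒≤ (GStep.under S))))
    go (suc d) {e} {c} V big P le | inj₂ (i , k , e₁ , S)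
      with go d (GStep-valid V S) (λ i' j' w≤j' → subst (B ≤_) (sym (GStep.sameH S i' j')) (big i' j' w≤j'))
              (follow P (GStep.mvA S) (proj₂ (GStep.leg∈ S))) (subst (w ≤_) (+-suc c (suc d)) le)
    ... | _ , _ , _ , G = _ , _ , _ , slides (bump-leg S) G

  grows-exist : ∀ n {e} → Valid e → Narrow e → Listed (A e) n →
                Σ (List (ℕ × ℕ × ℕ)) λ ps → Σ Enc λ e' → Grows e ps e' × length ps ≡ n × Listed (A e') 0
  grows-exist zero V nar ls = [] , _ , [] , refl , ls
  grows-exist (suc n) V nar ls with particle-exists ls
  ... | c , a , P with grow-exists V nar P
  ...   | i , j , e₁ , G with grow-arms G
  ...     | a' , P' , m with grows-exist n (Grow-valid V G) (Adds-narrow (Grow-adds G) nar)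
                               (listed-drop (proj₁ (Particle.arm∈ P')) (proj₂ (Particle.arm∈ P')) m ls)
  ...       | ps , e' , Gs , len , ls' = _ , e' , G ∷ Gs , cong suc len , ls'

  grow-right : ∀ {e c i j e'} → Grow e c i j e' → c < j
  grow-right (exits _) = ≤-refl
  grow-right (slides _ G) = <-trans ≤-refl (grow-right G)

  -- Bumping paths of successive growths

  InColumn : Enc → ℕ → ℕ → Set
  InColumn e j y = (Σ ℕ λ i → y ≡ H e i j) ⊎ (Σ ℕ λ i → Leg e i y × (H e i j ◀ y) × (y ◁ H e i (suc j)))

  -- `Slide` and `Exit` hide the moving and the bumped value. Here they are indices, so that
  -- statements about them cover every kind of step.
  Slide⊎Exit : Enc → (c a k : ℕ) → Enc → Set
  Slide⊎Exit e c a k e' = (Σ ℕ λ i → HStep e c a i e' × k ≡ H e i (suc c)) ⊎ (Σ ℕ λ i → GStep e c a i k e')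

  -- Entries in rows below the target are `◀ a`: in the row just under a bumped hook this is `free`,
  -- elsewhere the next hook of the column settles it. Within the row of a bumped leg, `min`
  -- decides; rows above only have larger entries.
  bumps-least : ∀ {e c a k e' z} → Valid e → Slide⊎Exit e c a k e' → InColumn e (suc c) z → a ◁ z → k ≤ z
  bumps-least {e} {c} {a} V (inj₁ (i , S , refl)) (inj₁ (i' , refl)) a◁z = H-col V (suc c) (≮⇒≥ (low i refl))
    where
    low : ∀ i₀ → i₀ ≡ i → ¬ i' < i₀
    low (suc i₀) eq (s≤s le) = excl a◁z (≤◀ (H-col V (suc c) le) (HStep.under S i₀ eq))
  bumps-least {e} {c} {a} {z = z} V (inj₁ (i , S , refl)) (inj₂ (i' , z∈ , p , q)) a◁z = ≤-trans (H-col V (suc c) (≮⇒≥ (low i refl))) (◀⇒≤ p)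
    where
    low : ∀ i₀ → i₀ ≡ i → ¬ i' < i₀
    low (suc i₀) eq (s≤s le) with m≤n⇒m<n∨m≡n le
    ... | inj₂ refl = excl a◁z (HStep.free S i' eq z z∈ q)
    ... | inj₁ lt = excl a◁z (≤◀ (≤-trans (◀⇒≤ (leg-above V z∈ p q)) (H-col V (suc c) lt)) (HStep.under S i₀ eq))
  bumps-least {e} {c} V (inj₂ (i , S)) (inj₁ (i' , refl)) a◁z =
    ≤-trans (◀⇒≤ (OfGStep.k-above V S)) (H-col V (suc c) (≰⇒> λ i'≤i → excl a◁z (≤◀ (H-col V (suc c) i'≤i) (GStep.under S))))
  bumps-least {e} {c} V (inj₂ (i , S)) (inj₂ (i' , z∈ , p , q)) a◁z with <-cmp i' i
  ... | tri< lt _ _ = ⊥-elim (excl a◁z (≤◀ (≤-trans (◀⇒≤ (leg-above V z∈ p q)) (H-col V (suc c) lt)) (GStep.under S)))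
  ... | tri≈ _ refl _ = GStep.min S _ z∈ a◁z
  ... | tri> _ _ gt = ≤-trans (◀⇒≤ (OfGStep.k-above V S)) (≤-trans (H-col V (suc c) gt) (◀⇒≤ p))

  -- The assumption `y ◁ a` excludes the legs that pass to the next column when a hook is lowered to
  -- `a`.
  stays-left : ∀ {e c a k e' j y} → Valid e → Slide⊎Exit e c a k e' → j ≤ c → y ◁ a → InColumn e j y → InColumn e' j y
  stays-left V (inj₁ (i , S , _)) j≤c y◁a (inj₁ (i' , eq)) = inj₁ (i' , trans eq (sym (HStep.off S _ _ λ { (_ , refl) → <⇒≱ ≤-refl j≤c })))
  stays-left {e} {c} {a} {e' = e'} {j} {y} V (inj₁ (i , S , _)) j≤c y◁a (inj₂ (i' , (p , y<B) , q , r)) =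
    inj₂ (i' , (subst (0 <_) (sym (HStep.sameL S i' y y<B)) p , y<B) , ≤◀ (OfHStep.H'≤ V S i' j) q , r')
    where
    r' : y ◁ H e' i' (suc j)
    r' with pos≟ i (suc c) i' (suc j)
    ... | yes (refl , refl) = subst (y ◁_) (sym (HStep.at S)) y◁a
    ... | no ¬p = subst (y ◁_) (sym (HStep.off S i' (suc j) ¬p)) r
  stays-left V (inj₂ (i , S)) j≤c y◁a (inj₁ (i' , eq)) = inj₁ (i' , trans eq (sym (GStep.sameH S i' _)))
  stays-left V (inj₂ (i , S)) j≤c y◁a (inj₂ (i' , (p , y<B) , q , r)) =
    inj₂ (i' , (move-keep (GStep.mvL S) y<B p (λ { (refl , refl) → excl (◁≤ r (H-row V i (s≤s j≤c))) (◀≤ (GStep.under S) (OfGStep.a≤k V S)) }) , y<B)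
         , subst (_◀ _) (sym (GStep.sameH S _ _)) q , subst (_ ◁_) (sym (GStep.sameH S _ _)) r)

  stays-right : ∀ {e c a k e' j y} → Valid e → Slide⊎Exit e c a k e' → suc c < j → InColumn e j y → InColumn e' j y
  stays-right V (inj₁ (i , S , _)) c<j (inj₁ (i' , eq)) = inj₁ (i' , trans eq (sym (HStep.off S _ _ λ { (_ , refl) → <-irrefl refl c<j })))
  stays-right V (inj₁ (i , S , _)) c<j (inj₂ (i' , (p , y<B) , q , r)) =
    inj₂ (i' , (subst (0 <_) (sym (HStep.sameL S i' _ y<B)) p , y<B)
         , subst (_◀ _) (sym (HStep.off S _ _ λ { (_ , refl) → <-irrefl refl c<j })) q
         , subst (_ ◁_) (sym (HStep.off S _ _ λ { (_ , refl) → <⇒≱ c<j (n≤1+n _) })) r)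
  stays-right V (inj₂ (i , S)) c<j (inj₁ (i' , eq)) = inj₁ (i' , trans eq (sym (GStep.sameH S i' _)))
  stays-right V (inj₂ (i , S)) c<j (inj₂ (i' , (p , y<B) , q , r)) =
    inj₂ (i' , (move-keep (GStep.mvL S) y<B p (λ { (refl , refl) → excl (◁≤ (GStep.right S) (H-row V i c<j)) q }) , y<B)
         , subst (_◀ _) (sym (GStep.sameH S _ _)) q , subst (_ ◁_) (sym (GStep.sameH S _ _)) r)

  arrives : ∀ {e c a k e'} → Valid e → Slide⊎Exit e c a k e' → InColumn e' (suc c) a
  arrives V (inj₁ (i , S , _)) = inj₁ (i , sym (HStep.at S))
  arrives V (inj₂ (i , S)) = inj₂ (i , (move-new⁺ (GStep.mvL S) a<B (proj₁ (GStep.leg∈ S)) , a<B)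
         , subst (_◀ _) (sym (GStep.sameH S _ _)) (GStep.under S)
         , subst (_ ◁_) (sym (GStep.sameH S _ _)) (≤◁ (OfGStep.a≤k V S) (GStep.right S)))
    where a<B = proj₂ (Particle.arm∈ (GStep.part S))

  pushes : ∀ {e c a k e'} → Slide⊎Exit e c a k e' → Particle e c a × a ◁ k × Move (A e) (A e') c a (suc c) k
  pushes (inj₁ (i , S , refl)) = HStep.part S , HStep.over S , HStep.mvA S
  pushes (inj₂ (i , S)) = GStep.part S , GStep.over S , GStep.mvA S

  split-slide : ∀ {e c e'} → Slide e c e' → Σ ℕ λ a → Σ ℕ λ k → Slide⊎Exit e c a k e' × k < B
  split-slide (bump-hook S k<B) = _ , _ , inj₁ (_ , S , refl) , k<B
  split-slide (bump-leg S) = _ , _ , inj₂ (_ , S) , proj₂ (GStep.leg∈ S)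

  -- The moving value never decreases along the path, so `y ◁ a` persists.
  grow-stays : ∀ {e c i j e' a j' y} → Valid e → Grow e c i j e' → Particle e c a → j' ≤ c → y ◁ a → InColumn e j' y → InColumn e' j' y
  grow-stays V (exits (exit S _)) P j'≤c y◁a y∈ with particle-unique P (HStep.part S)
  ... | refl = stays-left V (inj₁ (_ , S , refl)) j'≤c y◁a y∈
  grow-stays V (slides S G) P j'≤c y◁a y∈ with split-slide S
  ... | a , k , X , k<B with pushes X
  ...   | P' , a◁k , m with particle-unique P P'
  ...     | refl = grow-stays (Slide-valid V S) G (follow P m k<B) (m≤n⇒m≤1+n j'≤c) (◁≤ y◁a (◁⇒≤ a◁k)) (stays-left V X j'≤c y◁a y∈)

  -- The trace of an arm bumped through the columns c + 1, …, n, starting with z.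
  data Wall (e : Enc) : ℕ → ℕ → ℕ → Set where
    end : ∀ {c z} → InColumn e (suc c) z → z < B → Wall e c z (suc c)
    _◂_ : ∀ {c z z' n} → InColumn e (suc c) z × z < B × z ◁ z' → Wall e (suc c) z' n → Wall e c z n

  -- Each value that arrives is `◁` the value it bumps, hence is not carried along by the rest of
  -- the path.
  leaves-wall : ∀ {e c i j e' a} → Valid e → Grow e c i j e' → Particle e c a → Wall e' c a j
  leaves-wall V (exits (exit S _)) P with particle-unique P (HStep.part S)
  ... | refl = end (arrives V (inj₁ (_ , S , refl))) (proj₂ (Particle.arm∈ P))
  leaves-wall V (slides S G) P with split-slide S
  ... | a , k , X , k<B with pushes X
  ...   | P' , a◁k , m with particle-unique P P'
  ...     | refl = (grow-stays V₁ G P₁ ≤-refl a◁k (arrives V X) , proj₂ (Particle.arm∈ P) , a◁k) ◂ leaves-wall V₁ G P₁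
    where
    V₁ = Slide-valid V S
    P₁ = follow P m k<B

  wall-kept : ∀ {e c a k e' c' z n} → Valid e → Slide⊎Exit e c a k e' → c < c' → Wall e c' z n → Wall e' c' z n
  wall-kept V X c<c' (end z∈ z<B) = end (stays-right V X (s≤s c<c') z∈) z<B
  wall-kept V X c<c' ((z∈ , z<B , lt) ◂ w) = (stays-right V X (s≤s c<c') z∈ , z<B , lt) ◂ wall-kept V X (m≤n⇒m≤1+n c<c') w

  wall-front : ∀ {e c z n} → Wall e c z n → InColumn e (suc c) z × z < B
  wall-front (end z∈ z<B) = z∈ , z<B
  wall-front ((z∈ , z<B , _) ◂ _) = z∈ , z<B

  -- In each column the new path bumps something no larger than the wall entry there. So it cannot
  -- exit while the wall lasts, and its next value is again `◁` the next wall entry. This is the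
  -- analogue of the row bumping lemma for Schensted insertion.
  passes-wall : ∀ {e c i j e' a z n} → Valid e → Wall e c z n → Particle e c a → a ◁ z → Grow e c i j e' → n < j
  passes-wall V w P a◁z (exits (exit S big)) with particle-unique P (HStep.part S) | wall-front w
  ... | refl | z∈ , z<B = ⊥-elim (<⇒≱ z<B (≤-trans big (bumps-least V (inj₁ (_ , S , refl)) z∈ a◁z)))
  passes-wall V w P a◁z (slides S G) with split-slide S
  ... | a , k , X , k<B with pushes X
  ...   | P' , a◁k , m with particle-unique P P'
  passes-wall V (end z∈ _) P a◁z (slides S G) | a , k , X , k<B | P' , a◁k , m | refl = grow-right G
  passes-wall V ((z∈ , z<B , z◁z') ◂ w) P a◁z (slides S G) | a , k , X , k<B | P' , a◁k , m | refl =
    passes-wall (Slide-valid V S) (wall-kept V X ≤-refl w) (follow P m k<B) (≤◁ (bumps-least V X z∈ a◁z) z◁z') G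

  -- Smaller label, or equal label and further right: the later of two α is the one that the shuffle
  -- prefers.
  Later : ℕ × ℕ × ℕ → ℕ × ℕ × ℕ → Set
  Later (c₁ , _ , j₁) (c₂ , _ , j₂) = c₂ < c₁ ⊎ (c₂ ≡ c₁ × j₁ < j₂)

  Later-trans : ∀ {p q r} → Later p q → Later q r → Later p r
  Later-trans (inj₁ x) (inj₁ y) = inj₁ (<-trans y x)
  Later-trans (inj₁ x) (inj₂ (refl , _)) = inj₁ x
  Later-trans (inj₂ (refl , _)) (inj₁ y) = inj₁ y
  Later-trans (inj₂ (refl , x)) (inj₂ (refl , y)) = inj₂ (refl , <-trans x y)

  -- From the same column, the second arm is one that the first left behind, hence `◁` it, and its
  -- path passes the wall of the first. A column further right has no arms to start from, since the
  -- first growth adds only the invisible `B` there.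
  grow-later : ∀ {e c₁ i₁ j₁ e₁ c₂ i₂ j₂ e₂} → Valid e → Grow e c₁ i₁ j₁ e₁ → Grow e₁ c₂ i₂ j₂ e₂ → Later (c₁ , i₁ , j₁) (c₂ , i₂ , j₂)
  grow-later {c₁ = c₁} {c₂ = c₂} V G₁ G₂ with grow-arms G₁ | grow-arms G₂
  ... | a₁ , P₁ , m₁ | a₂ , P₂ , _ with <-cmp c₂ c₁
  ...   | tri< lt _ _ = inj₁ lt
  ...   | tri≈ _ refl _ = inj₂ (refl , passes-wall (Grow-valid V G₁) (leaves-wall V G₁ P₁) P₂
            (rest≤ V P₁ m₁ (λ { (() , _) }) (proj₂ (Particle.arm∈ P₂)) (proj₁ (Particle.arm∈ P₂)) (λ ())) G₂)
  ...   | tri> _ _ gt with move-gain m₁ (proj₂ (Particle.arm∈ P₂)) (proj₁ (Particle.arm∈ P₂))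
  ...     | inj₁ p = ⊥-elim (Particle.last P₁ _ _ gt (p , proj₂ (Particle.arm∈ P₂)))
  ...     | inj₂ (_ , refl) = ⊥-elim (<-irrefl refl (proj₂ (Particle.arm∈ P₂)))

  grows-later : ∀ {e c i j e₁ ps e'} → Valid e → Grow e c i j e₁ → Grows e₁ ps e' → All (Later (c , i , j)) ps
  grows-later V G [] = []
  grows-later {c = c} {i} {j} V G (_∷_ {c = c'} {i'} {j'} G' Gs) =
    grow-later V G G' ∷ All.map (λ {p} → Later-trans {c , i , j} {c' , i' , j'} {p} (grow-later V G G')) (grows-later (Grow-valid V G) G' Gs)

-- The growth diagram of 𝒜 and ℒ

Pos : Set
Pos = ℕ × ℕ

data Adjacent : Pos → Pos → Set where
  above   : ∀ {i j} → Adjacent (i , j) (suc i , j)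
  beside  : ∀ {i j} → Adjacent (i , j) (i , suc j)

-- If x then y are added to a shape, y₀ then x' are the cells added in the other order.
data Switch : (x y y₀ x' : Pos) → Set where
  apart : ∀ {x y} → x ≢ y → ¬ Adjacent x y → Switch x y y x
  slide : ∀ {x y} → Adjacent x y → Switch x y x y

module Grid (B : ℕ) (_◁_ _◀_ : ℕ → ℕ → Set) (orders : Orders _◁_ _◀_) where
  open Bounded B
  open Orders orders
  open Half B _◁_ _◀_ orders
  open Growth B _◁_ _◀_ orders
  open Tile B _◁_ _◀_ orders
  module D = Half B _◀_ _◁_ (transposed orders)
  module DG = Growth B _◀_ _◁_ (transposed orders)
  module DT = Tile B _◀_ _◁_ (transposed orders)

  LegGrow : Enc → (r i j : ℕ) → Enc → Set
  LegGrow e r i j e' = D.Grow (e ᵗ) r j i (e' ᵗ)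

  slide-grow : ∀ {e c e₁ r j i f} → Valid e → Slide e c e₁ → D.Grow (e ᵗ) r j i f →
               Σ Enc λ e₃ → Slide (f ᵗ) c e₃ × D.Grow (e₁ ᵗ) r j i (e₃ ᵗ)
  slide-grow {e} {e₁ = e₁} V S (D.exits X) with DT.exit-slide {e₂ = e₁ ᵗ} (Valid-ᵗ V) X S
  ... | e₃ , X' , S' = e₃ ᵗ , S' , D.exits X'
  slide-grow V S (D.slides {e₁ = g} R G) with slide-slide {e₂ = g ᵗ} V S R
  ... | e₃ , S' , R' with slide-grow {e = g ᵗ} (Valid-ᵗ (DG.Slide-valid (Valid-ᵗ V) R)) S' G
  ...   | e₄ , S'' , G' = e₄ , S'' , D.slides R' G'

  -- Slides of the leg path leave the exit of the arm where it is, so only the two exits can meet.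
  exit-grow : ∀ {e c i e₁ r j₀ i₀ f} → Valid e → Exit e c i e₁ → D.Grow (e ᵗ) r j₀ i₀ f →
              Σ Enc λ e₃ → Σ Pos λ y → Σ Pos λ x' →
              D.Grow (e₁ ᵗ) r (proj₂ y) (proj₁ y) (e₃ ᵗ) × Grow (f ᵗ) c (proj₁ x') (proj₂ x') e₃ ×
              ((i , suc c) ≢ (i₀ , j₀) × y ≡ (i₀ , j₀) × x' ≡ (i , suc c) ⊎ (i , suc c) ≡ (i₀ , j₀) × x' ≡ y × Adjacent (i , suc c) y)
  exit-grow {e} {f = f} V X (D.exits R) with exit-exit {e₂ = f ᵗ} V X R
  ... | e₃ , apart ¬p X' R' = e₃ , _ , _ , D.exits R' , exits X' , inj₁ ((λ { refl → ¬p (refl , refl) }) , refl , refl)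
  ... | e₃ , up g refl refl X' S R' = e₃ , _ , _ , D.slides S (D.exits R') , exits X' , inj₂ (refl , refl , above)
  ... | e₃ , right g refl refl R' S X' = e₃ , _ , _ , D.exits R' , slides S (exits X') , inj₂ (refl , refl , beside)
  exit-grow V X (D.slides {e₁ = g} R G) with exit-slide {e₂ = g ᵗ} V X R
  ... | e₃ , X' , R' with exit-grow {e = g ᵗ} (Valid-ᵗ (DG.Slide-valid (Valid-ᵗ V) R)) X' G
  ...   | e₄ , y , x' , G' , K , rel = e₄ , y , x' , D.slides R' G' , K , rel

  grow-grow : ∀ {e c i j e₁ r i₀ j₀ e₂} → Valid e → Grow e c i j e₁ → LegGrow e r i₀ j₀ e₂ →
              Σ Enc λ e₃ → Σ Pos λ y → Σ Pos λ x' →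
              LegGrow e₁ r (proj₁ y) (proj₂ y) e₃ × Grow e₂ c (proj₁ x') (proj₂ x') e₃ ×
              ((i , j) ≢ (i₀ , j₀) × y ≡ (i₀ , j₀) × x' ≡ (i , j) ⊎ (i , j) ≡ (i₀ , j₀) × x' ≡ y × Adjacent (i , j) y)
  grow-grow V (exits X) R = exit-grow V X R
  grow-grow V (slides S G) R with slide-grow V S R
  ... | e₃ , S' , R' with grow-grow (Slide-valid V S) G R'
  ...   | e₄ , y , x' , R'' , G' , rel = e₄ , y , x' , R'' , slides S' G' , rel

  -- If the growths keep their cells, these are not adjacent: `y` can be added before `x`, and were
  -- `x` directly below or left of `y`, the shape after adding `y` would have to contain `x`.
  switch : ∀ {e c i j e₁ r i₀ j₀ e₂} → Valid e → Grow e c i j e₁ → LegGrow e r i₀ j₀ e₂ →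
           Σ Enc λ e₃ → Σ Pos λ y → Σ Pos λ x' →
           LegGrow e₁ r (proj₁ y) (proj₂ y) e₃ × Grow e₂ c (proj₁ x') (proj₂ x') e₃ × Switch (i , j) y (i₀ , j₀) x'
  switch {e} {i = i} {j} {i₀ = i₀} {j₀} {e₂} V G R with grow-grow V G R
  ... | e₃ , y , x' , R' , G' , inj₂ (refl , refl , adj) = e₃ , y , x' , R' , G' , slide adj
  ... | e₃ , y , x' , R' , G' , inj₁ (x≢y , refl , refl) = e₃ , y , x' , R' , G' , apart x≢y ¬adj
    where
    V₂ : Valid e₂
    V₂ = Valid-ᵗ (DG.Grow-valid (Valid-ᵗ V) R)
    below : i ≤ i₀ → j ≤ j₀ → ⊥
    below p q with Adds.fresh (DG.Grow-adds R) j i (≤-<-trans (H-mono V₂ p q) (Adds.after (DG.Grow-adds R)))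
    ... | inj₁ fin = <⇒≱ fin (Adds.before (Grow-adds G))
    ... | inj₂ (refl , refl) = x≢y refl
    ¬adj : ¬ Adjacent (i , j) (i₀ , j₀)
    ¬adj above = below (n≤1+n i) ≤-refl
    ¬adj beside = below ≤-refl (n≤1+n j)

-- Lists of rows

-- On fillings, `nth` with default `nothing` cannot tell an empty entry from a missing cell.
nth? : {X : Set} → List X → ℕ → Maybe X
nth? [] _ = nothing
nth? (x ∷ xs) zero = just x
nth? (x ∷ xs) (suc i) = nth? xs i

at : {X : Set} → List (List X) → ℕ → ℕ → Maybe X
at T i j = nth? (nth [] T i) j

module _ {X : Set} where

  nth?-end : (xs : List X) → nth? xs (length xs) ≡ nothing
  nth?-end [] = refl
  nth?-end (x ∷ xs) = nth?-end xs

  nth?-< : ∀ (xs : List X) {i x} → nth? xs i ≡ just x → i < length xs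
  nth?-< (y ∷ xs) {zero} eq = s≤s z≤n
  nth?-< (y ∷ xs) {suc i} eq = s≤s (nth?-< xs eq)

  <-nth? : ∀ (xs : List X) {i} → i < length xs → Σ X λ x → nth? xs i ≡ just x
  <-nth? (y ∷ xs) {zero} lt = y , refl
  <-nth? (y ∷ xs) {suc i} (s≤s lt) = <-nth? xs lt

  nth?-ext : ∀ (xs ys : List X) → (∀ i → nth? xs i ≡ nth? ys i) → xs ≡ ys
  nth?-ext [] [] eq = refl
  nth?-ext [] (y ∷ ys) eq = case eq 0 of λ ()
  nth?-ext (x ∷ xs) [] eq = case eq 0 of λ ()
  nth?-ext (x ∷ xs) (y ∷ ys) eq = cong₂ _∷_ (just-injective (eq 0)) (nth?-ext xs ys (eq ∘ suc))

  NonEmpty : List (List X) → Set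
  NonEmpty = All (λ row → row ≢ [])

  -- Positions do not see trailing empty rows, which therefore have to be excluded.
  at-ext : ∀ {T T' : List (List X)} → NonEmpty T → NonEmpty T' → (∀ i j → at T i j ≡ at T' i j) → T ≡ T'
  at-ext [] [] eq = refl
  at-ext [] (_∷_ {[]} ne _) eq = ⊥-elim (ne refl)
  at-ext [] (_∷_ {x ∷ _} ne _) eq = case eq 0 0 of λ ()
  at-ext (_∷_ {[]} ne _) [] eq = ⊥-elim (ne refl)
  at-ext (_∷_ {x ∷ _} ne _) [] eq = case eq 0 0 of λ ()
  at-ext (_∷_ {xs} _ ne) (_∷_ {ys} _ ne') eq = cong₂ _∷_ (nth?-ext xs ys (eq 0)) (at-ext ne ne' (eq ∘ suc))

  nth?-modify-same : ∀ (f : X → X) xs {j x} → nth? xs j ≡ just x → nth? (modifyAt j f xs) j ≡ just (f x)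
  nth?-modify-same f (y ∷ xs) {zero} refl = refl
  nth?-modify-same f (y ∷ xs) {suc j} eq = nth?-modify-same f xs eq

  nth?-modify-other : ∀ (f : X → X) xs {j j'} → j ≢ j' → nth? (modifyAt j f xs) j' ≡ nth? xs j'
  nth?-modify-other f [] ne = refl
  nth?-modify-other f (y ∷ xs) {zero} {zero} ne = ⊥-elim (ne refl)
  nth?-modify-other f (y ∷ xs) {zero} {suc j'} ne = refl
  nth?-modify-other f (y ∷ xs) {suc j} {zero} ne = refl
  nth?-modify-other f (y ∷ xs) {suc j} {suc j'} ne = nth?-modify-other f xs (ne ∘ cong suc)

  at-modify-same : ∀ (f : X → X) T {i j x} → at T i j ≡ just x → at (modifyAt i (modifyAt j f) T) i j ≡ just (f x)
  at-modify-same f (row ∷ T) {zero} eq = nth?-modify-same f row eq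
  at-modify-same f (row ∷ T) {suc i} eq = at-modify-same f T eq

  at-modify-other : ∀ (f : X → X) T {i j i' j'} → ¬ (i ≡ i' × j ≡ j') → at (modifyAt i (modifyAt j f) T) i' j' ≡ at T i' j'
  at-modify-other f [] ne = refl
  at-modify-other f (row ∷ T) {zero} {i' = zero} ne = nth?-modify-other f row (λ eq → ne (refl , eq))
  at-modify-other f (row ∷ T) {zero} {i' = suc i'} ne = refl
  at-modify-other f (row ∷ T) {suc i} {i' = zero} ne = refl
  at-modify-other f (row ∷ T) {suc i} {i' = suc i'} ne = at-modify-other f T (λ (p , q) → ne (cong suc p , q))

  length-modify : ∀ (f : X → X) j xs → length (modifyAt j f xs) ≡ length xs
  length-modify f j [] = refl
  length-modify f zero (x ∷ xs) = refl
  length-modify f (suc j) (x ∷ xs) = cong suc (length-modify f j xs)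

  lengths-modify : ∀ (f : X → X) i j T → map length (modifyAt i (modifyAt j f) T) ≡ map length T
  lengths-modify f i j [] = refl
  lengths-modify f zero j (row ∷ T) = cong (_∷ _) (length-modify f j row)
  lengths-modify f (suc i) j (row ∷ T) = cong (_ ∷_) (lengths-modify f i j T)

  nth?-snoc : ∀ xs (x : X) → nth? (xs ++ x ∷ []) (length xs) ≡ just x
  nth?-snoc [] x = refl
  nth?-snoc (y ∷ xs) x = nth?-snoc xs x

  nth?-snoc-other : ∀ xs (x : X) {j} → length xs ≢ j → nth? (xs ++ x ∷ []) j ≡ nth? xs j
  nth?-snoc-other [] x {zero} ne = ⊥-elim (ne refl)
  nth?-snoc-other [] x {suc j} ne = refl
  nth?-snoc-other (y ∷ xs) x {zero} ne = refl
  nth?-snoc-other (y ∷ xs) x {suc j} ne = nth?-snoc-other xs x (ne ∘ cong suc)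

  at-append-same : ∀ T {i} (x : X) → i ≤ length T → at (appendAt T i x) i (length (nth [] T i)) ≡ just x
  at-append-same [] x z≤n = refl
  at-append-same (row ∷ T) {zero} x _ = nth?-snoc row x
  at-append-same (row ∷ T) {suc i} x (s≤s le) = at-append-same T x le

  at-append-other : ∀ T {i} (x : X) {i' j'} → i ≤ length T → ¬ (i ≡ i' × length (nth [] T i) ≡ j') → at (appendAt T i x) i' j' ≡ at T i' j'
  at-append-other [] x {zero} {zero} z≤n ne = ⊥-elim (ne (refl , refl))
  at-append-other [] x {zero} {suc j'} z≤n ne = refl
  at-append-other [] x {suc i'} z≤n ne = refl
  at-append-other (row ∷ T) {zero} x {zero} _ ne = nth?-snoc-other row x (λ eq → ne (refl , eq))
  at-append-other (row ∷ T) {zero} x {suc i'} _ ne = refl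
  at-append-other (row ∷ T) {suc i} x {zero} _ ne = refl
  at-append-other (row ∷ T) {suc i} x {suc i'} (s≤s le) ne = at-append-other T x le (λ (p , q) → ne (cong suc p , q))

  modify-nonEmpty : ∀ (f : X → X) i j {T} → NonEmpty T → NonEmpty (modifyAt i (modifyAt j f) T)
  modify-nonEmpty f i j [] = []
  modify-nonEmpty f zero j (_∷_ {xs} ne nes) = (λ eq → ne (length⁰ xs (trans (sym (length-modify f j xs)) (cong length eq)))) ∷ nes
    where
    length⁰ : ∀ xs → length xs ≡ 0 → xs ≡ []
    length⁰ [] _ = refl
  modify-nonEmpty f (suc i) j (ne ∷ nes) = ne ∷ modify-nonEmpty f i j nes

  append-nonEmpty : ∀ i (x : X) {T} → NonEmpty T → NonEmpty (appendAt T i x)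
  append-nonEmpty i x [] = (λ ()) ∷ []
  append-nonEmpty zero x (_∷_ {xs} ne nes) = snoc≢[] xs ∷ nes
    where
    snoc≢[] : ∀ xs → xs ++ x ∷ [] ≢ []
    snoc≢[] [] ()
    snoc≢[] (_ ∷ _) ()
  append-nonEmpty (suc i) x (ne ∷ nes) = ne ∷ append-nonEmpty i x nes

growAt : ℕ → List ℕ → List ℕ
growAt _ [] = 1 ∷ []
growAt zero (n ∷ ns) = suc n ∷ ns
growAt (suc i) (n ∷ ns) = n ∷ growAt i ns

lengths-append : ∀ {X : Set} (T : List (List X)) i x → map length (appendAt T i x) ≡ growAt i (map length T)
lengths-append [] i x = refl
lengths-append (row ∷ T) zero x = cong (_∷ _) (trans (length-++ row) (+-comm _ 1))
lengths-append (row ∷ T) (suc i) x = cong (_ ∷_) (lengths-append T i x)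

n≡ᵇn : ∀ n → (n ≡ᵇ n) ≡ true
n≡ᵇn zero = refl
n≡ᵇn (suc n) = n≡ᵇn n

≢⇒≡ᵇ : ∀ {m n} → m ≢ n → (m ≡ᵇ n) ≡ false
≢⇒≡ᵇ {zero} {zero} ne = ⊥-elim (ne refl)
≢⇒≡ᵇ {zero} {suc n} ne = refl
≢⇒≡ᵇ {suc m} {zero} ne = refl
≢⇒≡ᵇ {suc m} {suc n} ne = ≢⇒≡ᵇ (ne ∘ cong suc)

<⇒<ᵇ≡ : ∀ {m n} → m < n → (m <ᵇ n) ≡ true
<⇒<ᵇ≡ p = Equivalence.to T-≡ (<⇒<ᵇ p)

≮⇒<ᵇ≡ : ∀ {m n} → ¬ m < n → (m <ᵇ n) ≡ false
≮⇒<ᵇ≡ {m} {n} p with m <ᵇ n in eq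
... | false = refl
... | true = ⊥-elim (p (<ᵇ⇒< m n (subst T (sym eq) tt)))

<ᵇ≡⇒< : ∀ {m n} → (m <ᵇ n) ≡ true → m < n
<ᵇ≡⇒< {m} {n} eq = <ᵇ⇒< m n (subst T (sym eq) tt)

≤⇒≤ᵇ≡ : ∀ {m n} → m ≤ n → (m ≤ᵇ n) ≡ true
≤⇒≤ᵇ≡ p = Equivalence.to T-≡ (≤⇒≤ᵇ p)

≰⇒≤ᵇ≡ : ∀ {m n} → ¬ m ≤ n → (m ≤ᵇ n) ≡ false
≰⇒≤ᵇ≡ {m} {n} p with m ≤ᵇ n in eq
... | false = refl
... | true = ⊥-elim (p (≤ᵇ⇒≤ m n (subst T (sym eq) tt)))

≡ᵇ≡⇒≡ : ∀ {m n} → (m ≡ᵇ n) ≡ true → m ≡ n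
≡ᵇ≡⇒≡ {m} {n} eq = ≡ᵇ⇒≡ m n (subst T (sym eq) tt)

firstDiff-grow : ∀ i ns → i ≤ length ns → firstDiff ns (growAt i ns) ≡ i
firstDiff-grow zero [] _ = refl
firstDiff-grow zero (n ∷ ns) _ rewrite ≢⇒≡ᵇ (<⇒≢ (n<1+n n)) = refl
firstDiff-grow (suc i) (n ∷ ns) (s≤s le) rewrite n≡ᵇn n = cong suc (firstDiff-grow i ns le)

sum-grow : ∀ i ns → sum (growAt i ns) ≡ suc (sum ns)
sum-grow i [] = refl
sum-grow zero (n ∷ ns) = refl
sum-grow (suc i) (n ∷ ns) = trans (cong (n +_) (sum-grow i ns)) (+-suc n _)

-- Enumeration of the cells

module _ {X : Set} where

  rowCells : ℕ → ℕ → List X → List (ℕ × ℕ × X)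
  rowCells i j [] = []
  rowCells i j (x ∷ xs) = (i , j , x) ∷ rowCells i (suc j) xs

  cells : ℕ → List (List X) → List (ℕ × ℕ × X)
  cells i [] = []
  cells i (row ∷ T) = rowCells i 0 row ++ cells (suc i) T

  -- The functions inside `cellsOf` are anonymous pattern lambdas. The auxiliary statements hold for
  -- any functions with the same values, and unification supplies the actual ones.
  cellsOf-cells : ∀ (T : List (List X)) → cellsOf T ≡ cells 0 T
  cellsOf-cells T = outer _ (λ i row → inner _ i (λ _ _ → refl) 0 row) 0 T
    where
    inner : ∀ (g : ℕ × X → ℕ × ℕ × X) i → (∀ j x → g (j , x) ≡ (i , j , x)) → ∀ j row → map g (indexed j row) ≡ rowCells i j row
    inner g i eq j [] = refl
    inner g i eq j (x ∷ row) = cong₂ _∷_ (eq j x) (inner g i eq (suc j) row)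
    outer : ∀ (f : ℕ × List X → List (ℕ × ℕ × X)) → (∀ i row → f (i , row) ≡ rowCells i 0 row) → ∀ i T → concatMap f (indexed i T) ≡ cells i T
    outer f eq i [] = refl
    outer f eq i (row ∷ T) = cong₂ _++_ (eq i row) (outer f eq (suc i) T)

  ∈-row⁻ : ∀ {i i' j j' x} row → (i' , j' , x) ∈ rowCells i j row → i' ≡ i × Σ ℕ λ d → j' ≡ d + j × nth? row d ≡ just x
  ∈-row⁻ (y ∷ row) (here refl) = refl , 0 , refl , refl
  ∈-row⁻ {j = j} (y ∷ row) (there p) with ∈-row⁻ row p
  ... | eq , d , eq' , eq'' = eq , suc d , trans eq' (+-suc d j) , eq''

  ∈-row⁺ : ∀ {i j d x} row → nth? row d ≡ just x → (i , d + j , x) ∈ rowCells i j row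
  ∈-row⁺ {d = zero} (y ∷ row) refl = here refl
  ∈-row⁺ {i} {j} {suc d} {x} (y ∷ row) eq = there (subst (λ k → (i , k , x) ∈ rowCells i (suc j) row) (+-suc d j) (∈-row⁺ row eq))

  ∈-cells⁻ : ∀ {i i' j' x} T → (i' , j' , x) ∈ cells i T → Σ ℕ λ d → i' ≡ d + i × at T d j' ≡ just x
  ∈-cells⁻ {i} (row ∷ T) p with ∈-++⁻ (rowCells i 0 row) p
  ... | inj₁ q with ∈-row⁻ row q
  ...   | eq , d , eq' , eq'' = 0 , eq , subst (λ k → nth? row k ≡ _) (sym (trans eq' (+-identityʳ d))) eq''
  ∈-cells⁻ {i} (row ∷ T) p | inj₂ q with ∈-cells⁻ T q
  ...   | d , eq , eq' = suc d , trans eq (+-suc d i) , eq'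

  ∈-cells⁺ : ∀ {i d j x} T → at T d j ≡ just x → (d + i , j , x) ∈ cells i T
  ∈-cells⁺ {i} {zero} {j} (row ∷ T) eq = ∈-++⁺ˡ (subst (λ k → (i , k , _) ∈ rowCells i 0 row) (+-identityʳ j) (∈-row⁺ row eq))
  ∈-cells⁺ {i} {suc d} {j} {x} (row ∷ T) eq = ∈-++⁺ʳ (rowCells i 0 row) (subst (λ k → (k , j , x) ∈ cells (suc i) T) (+-suc d i) (∈-cells⁺ T eq))

  ∈-cellsOf⁻ : ∀ {i j x} T → (i , j , x) ∈ cellsOf T → at T i j ≡ just x
  ∈-cellsOf⁻ T p with ∈-cells⁻ T (subst (_ ∈_) (cellsOf-cells T) p)
  ... | d , eq , eq' = subst (λ k → at T k _ ≡ _) (sym (trans eq (+-identityʳ d))) eq'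

  ∈-cellsOf⁺ : ∀ {i j x} T → at T i j ≡ just x → (i , j , x) ∈ cellsOf T
  ∈-cellsOf⁺ {i} {j} {x} T eq = subst (_ ∈_) (sym (cellsOf-cells T)) (subst (λ k → (k , j , x) ∈ cells 0 T) (+-identityʳ i) (∈-cells⁺ T eq))

  Before : ℕ × ℕ × X → ℕ × ℕ × X → Set
  Before (i , j , _) (i' , j' , _) = i < i' ⊎ (i ≡ i' × j < j')

  cells-ordered : ∀ i T → AllPairs Before (cells i T)
  cells-ordered i [] = []
  cells-ordered i (row ∷ T) = AllPairsₚ.++⁺ (row-ordered 0 row) (cells-ordered (suc i) T)
    (All.tabulate λ p → All.tabulate λ q → inj₁ (lower p q))
    where
    row-ordered : ∀ j row → AllPairs Before (rowCells i j row)
    row-ordered j [] = []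
    row-ordered j (x ∷ row) = All.tabulate (λ {z} p → case ∈-row⁻ row p of λ
      (eq , d , eq' , _) → inj₂ (sym eq , subst (j <_) (sym eq') (m≤n+m (suc j) d))) ∷ row-ordered (suc j) row
    lower : ∀ {z z'} → z ∈ rowCells i 0 row → z' ∈ cells (suc i) T → proj₁ z < proj₁ z'
    lower p q with ∈-row⁻ row p | ∈-cells⁻ T q
    ... | eq , _ | d , eq' , _ = subst₂ _<_ (sym eq) (sym eq') (m≤n+m (suc i) d)

  ordered : ∀ T {pre x post} → pre ++ x ∷ post ≡ cellsOf T → ∀ {z} → z ∈ pre → Before z x
  ordered T {pre} {x} {post} eq = go pre (subst (AllPairs Before) (trans (sym (cellsOf-cells T)) (sym eq)) (cells-ordered 0 T))
    where
    go : ∀ pre → AllPairs Before (pre ++ x ∷ post) → ∀ {z} → z ∈ pre → Before z x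
    go (y ∷ pre) (b ∷ bs) (here refl) = All.lookup b (∈-++⁺ʳ pre (here refl))
    go (y ∷ pre) (b ∷ bs) (there p) = go pre bs p

foldl-rule : ∀ {X Y : Set} (I : List X → Y → Set) (s : Y → X → Y) y xs → I [] y →
             (∀ pre x post y → pre ++ x ∷ post ≡ xs → I pre y → I (pre ++ x ∷ []) (s y x)) → I xs (foldl s y xs)
foldl-rule I s y xs base step = go [] y xs refl base
  where
  go : ∀ pre y post → pre ++ post ≡ xs → I pre y → I xs (foldl s y post)
  go pre y [] eq i = subst (λ zs → I zs y) (trans (sym (++-identityʳ pre)) eq) i
  go pre y (x ∷ post) eq i = go (pre ++ x ∷ []) (s y x) post (trans (++-assoc pre (x ∷ []) post) eq) (step pre x post y eq i)

∈-snoc⁻ : ∀ {X : Set} {xs : List X} {z w} → z ∈ xs ++ w ∷ [] → z ∈ xs ⊎ z ≡ w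
∈-snoc⁻ {xs = xs} p with ∈-++⁻ xs p
... | inj₁ q = inj₁ q
... | inj₂ (here eq) = inj₂ eq

-- The shuffle

-- The motive G stands for a statement about a left fold that keeps the best
-- candidate seen so far: G (z ∷ xs) with a candidate z is the statement with
-- z already stored.
best-fold : ∀ {X : Set} (G : List X → Set) (C W : X → Set) (t : X) → (∀ x → Dec (C x)) → (∀ x → C x → W x → x ≡ t ⊎ x ≢ t) → C t →
            G (t ∷ []) →
            (∀ x xs → ¬ C x → G xs → G (x ∷ xs)) →
            (∀ z x xs → C z → ¬ C x → G (z ∷ xs) → G (z ∷ x ∷ xs)) →
            (∀ x xs → C x → W x → G (t ∷ xs) → G (t ∷ x ∷ xs)) →
            (∀ z xs → C z → W z → z ≢ t → G (t ∷ xs) → G (z ∷ t ∷ xs)) →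
            (∀ z x xs → C z → C x → G (z ∷ xs) → G (x ∷ xs) → G (z ∷ x ∷ xs)) →
            ∀ xs → (∀ {x} → x ∈ xs → W x) → t ∈ xs → G xs
best-fold G C W t C? t? Ct single skip skip₂ drop take choose = outer
  where
  stored : ∀ xs → (∀ {x} → x ∈ xs → W x) → G (t ∷ xs)
  stored [] w = single
  stored (x ∷ xs) w with C? x
  ... | yes Cx = drop x xs Cx (w (here refl)) (stored xs (w ∘ there))
  ... | no ¬Cx = skip₂ t x xs Ct ¬Cx (stored xs (w ∘ there))
  inner : ∀ z xs → C z → W z → z ≢ t → (∀ {x} → x ∈ xs → W x) → t ∈ xs → G (z ∷ xs)
  inner z (x ∷ xs) Cz Wz z≢t w (here refl) = take z xs Cz Wz z≢t (stored xs (w ∘ there))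
  inner z (x ∷ xs) Cz Wz z≢t w (there p) with C? x
  ... | no ¬Cx = skip₂ z x xs Cz ¬Cx (inner z xs Cz Wz z≢t (w ∘ there) p)
  ... | yes Cx with t? x Cx (w (here refl))
  ...   | inj₁ refl = take z xs Cz Wz z≢t (stored xs (w ∘ there))
  ...   | inj₂ x≢t = choose z x xs Cz Cx (inner z xs Cz Wz z≢t (w ∘ there) p) (inner x xs Cx (w (here refl)) x≢t (w ∘ there) p)
  outer : ∀ xs → (∀ {x} → x ∈ xs → W x) → t ∈ xs → G xs
  outer (x ∷ xs) w (here refl) = stored xs (w ∘ there)
  outer (x ∷ xs) w (there p) with C? x
  ... | no ¬Cx = skip x xs ¬Cx (outer xs (w ∘ there) p)
  ... | yes Cx with t? x Cx (w (here refl))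
  ...   | inj₁ refl = stored xs (w ∘ there)
  ...   | inj₂ x≢t = inner x xs Cx (w (here refl)) x≢t (w ∘ there) p

getQ-at : ∀ F {i j m} → at F i j ≡ just m → getQ F i j ≡ m
getQ-at F {i} = go (nth [] F i)
  where
  go : ∀ row {j m} → nth? row j ≡ just m → nth nothing row j ≡ m
  go (m ∷ row) {zero} refl = refl
  go (m ∷ row) {suc j} eq = go row eq

at-getQ : ∀ F {i j s} → getQ F i j ≡ just s → at F i j ≡ just (just s)
at-getQ F {i} = go (nth [] F i)
  where
  go : ∀ row {j s} → nth nothing row j ≡ just s → nth? row j ≡ just (just s)
  go (m ∷ row) {zero} refl = refl
  go (m ∷ row) {suc j} eq = go row eq

betaAt-β : ∀ F {i j k} → getQ F i j ≡ just (β k) → betaAt F i j ≡ just k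
betaAt-β F eq rewrite eq = refl

betaAt-inv : ∀ F {i j k} → betaAt F i j ≡ just k → getQ F i j ≡ just (β k)
betaAt-inv F {i} {j} eq with getQ F i j
betaAt-inv F refl | just (β k) = refl

mutual
  -- The fold inside findCand, whose step function is local to it; the body is
  -- inferred from the next equation.
  candFold : Filling → List (ℕ × ℕ × Maybe Sym) → Maybe (ℕ × ℕ)
  candFold F xs = _

  findCand-candFold : ∀ F → findCand F ≡ candFold F (cellsOf F)
  findCand-candFold F with cellsOf F
  ... | xs = refl

movable : Filling → ℕ → ℕ → Bool
movable F i j = isJust (betaAt F (suc i) j) ∨ isJust (betaAt F i (suc j))

module _ (F : Filling) where

  Candidate : ℕ × ℕ × Maybe Sym → Set
  Candidate (i , j , s) = Σ ℕ λ k → s ≡ just (α k) × movable F i j ≡ true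

  candidate? : ∀ x → Dec (Candidate x)
  candidate? (i , j , nothing) = no λ ()
  candidate? (i , j , just (β k)) = no λ ()
  candidate? (i , j , just (α k)) with movable F i j
  ... | true = yes (k , refl , refl)
  ... | false = no λ { (_ , refl , ()) }

  immovable : ∀ {i j k} → ¬ Candidate (i , j , just (α k)) → movable F i j ≡ false
  immovable {i} {j} ¬c with movable F i j
  ... | true = ⊥-elim (¬c (_ , refl , refl))
  ... | false = refl

  -- Both alternatives are strict, so the outcome of the fold does not depend on how it treats ties.
  Loses : (i j k : ℕ) → ℕ × ℕ × Maybe Sym → Set
  Loses i j k (i' , j' , s) = ∀ k' → s ≡ just (α k') → movable F i' j' ≡ true → k < k' ⊎ (k ≡ k' × j' < j)

  findCand-just : ∀ {i j k} → getQ F i j ≡ just (α k) → movable F i j ≡ true →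
                  (∀ i' j' s → ¬ (i ≡ i' × j ≡ j') → getQ F i' j' ≡ s → Loses i j k (i' , j' , s)) → findCand F ≡ just (i , j)
  findCand-just {i} {j} {k} eq mov loses = trans (findCand-candFold F)
    (best-fold G Candidate Wins t candidate? t? (k , refl , mov) single skip skip₂ drop take choose (cellsOf F) wins (∈-cellsOf⁺ F (at-getQ F {i} {j} eq)))
    where
    t : ℕ × ℕ × Maybe Sym
    t = i , j , just (α k)
    Wins : ℕ × ℕ × Maybe Sym → Set
    Wins x = x ≡ t ⊎ x ≢ t × Loses i j k x
    t? : ∀ x → Candidate x → Wins x → x ≡ t ⊎ x ≢ t
    t? x _ = Sum.map₂ proj₁
    wins : ∀ {x} → x ∈ cellsOf F → Wins x
    wins {i' , j' , s} x∈ with pos≟ i j i' j' | getQ-at F {i'} {j'} (∈-cellsOf⁻ {i = i'} {j'} F x∈)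
    ... | yes (refl , refl) | eq' = inj₁ (cong (λ s → i , j , s) (trans (sym eq') eq))
    ... | no ¬p | eq' = inj₂ ((λ { refl → ¬p (refl , refl) }) , loses i' j' s ¬p eq')
    G : List (ℕ × ℕ × Maybe Sym) → Set
    G xs = candFold F xs ≡ just (i , j)
    single : G (t ∷ [])
    single rewrite mov = refl
    skip : ∀ x xs → ¬ Candidate x → G xs → G (x ∷ xs)
    skip (i , j , nothing) xs ¬c g = g
    skip (i , j , just (β _)) xs ¬c g = g
    skip (i , j , just (α _)) xs ¬c g rewrite immovable ¬c = g
    skip₂ : ∀ z x xs → Candidate z → ¬ Candidate x → G (z ∷ xs) → G (z ∷ x ∷ xs)
    skip₂ z (i , j , nothing) xs _ ¬c g = g
    skip₂ z (i , j , just (β _)) xs _ ¬c g = g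
    skip₂ z (i , j , just (α _)) xs _ ¬c g rewrite immovable ¬c = g
    drop : ∀ x xs → Candidate x → Wins x → G (t ∷ xs) → G (t ∷ x ∷ xs)
    drop _ xs (_ , refl , m) (inj₁ refl) g rewrite mov | ≮⇒<ᵇ≡ (<-irrefl {k} refl) | n≡ᵇn k | ≮⇒<ᵇ≡ (<-irrefl {j} refl) = g
    drop (i' , j' , _) xs (k' , refl , m) (inj₂ (ne , l)) g with l k' refl m
    ... | inj₁ k<k' rewrite mov | m | ≮⇒<ᵇ≡ (<-asym k<k') | ≢⇒≡ᵇ (>⇒≢ k<k') = g
    ... | inj₂ (refl , j'<j) rewrite mov | m | ≮⇒<ᵇ≡ (<-irrefl {k} refl) | n≡ᵇn k | ≮⇒<ᵇ≡ (<-asym j'<j) = g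
    take : ∀ z xs → Candidate z → Wins z → z ≢ t → G (t ∷ xs) → G (z ∷ t ∷ xs)
    take _ xs _ (inj₁ refl) ne g = ⊥-elim (ne refl)
    take (i' , j' , _) xs (k' , refl , m) (inj₂ (ne , l)) _ g with l k' refl m
    ... | inj₁ k<k' rewrite mov | m | <⇒<ᵇ≡ k<k' = g
    ... | inj₂ (refl , j'<j) rewrite mov | m | ≮⇒<ᵇ≡ (<-irrefl {k} refl) | n≡ᵇn k | <⇒<ᵇ≡ j'<j = g
    choose : ∀ z x xs → Candidate z → Candidate x → G (z ∷ xs) → G (x ∷ xs) → G (z ∷ x ∷ xs)
    choose (i' , j' , _) (i'' , j'' , _) xs (k' , refl , m) (k'' , refl , m') g g' rewrite m | m'
      with (k'' <ᵇ k') ∨ ((k'' ≡ᵇ k') ∧ (j' <ᵇ j''))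
    ... | true = g'
    ... | false = g

  findCand-nothing : (∀ i j k → getQ F i j ≡ just (α k) → movable F i j ≡ false) → findCand F ≡ nothing
  findCand-nothing none = trans (findCand-candFold F) (all (cellsOf F) λ i j k p → none i j k (getQ-at F (∈-cellsOf⁻ {i = i} {j} F p)))
    where
    all : ∀ xs → (∀ i j k → (i , j , just (α k)) ∈ xs → movable F i j ≡ false) → candFold F xs ≡ nothing
    all [] _ = refl
    all ((i , j , nothing) ∷ xs) no-cand = all xs λ i j k → no-cand i j k ∘ there
    all ((i , j , just (β _)) ∷ xs) no-cand = all xs λ i j k → no-cand i j k ∘ there
    all ((i , j , just (α k)) ∷ xs) no-cand rewrite no-cand i j k (here refl) = all xs λ i j k → no-cand i j k ∘ there

  shuff-start : ∀ {p} → findCand F ≡ just p → shuffStep (F , nothing) ≡ (F , just p)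
  shuff-start eq = cong (F ,_) eq

  shuff-stop : ∀ {i j} → betaAt F (suc i) j ≡ nothing → betaAt F i (suc j) ≡ nothing → shuffStep (F , just (i , j)) ≡ (F , nothing)
  shuff-stop eq eq' rewrite eq | eq' = refl

  shuff-up : ∀ {i j k} → betaAt F (suc i) j ≡ just k → (∀ k' → betaAt F i (suc j) ≡ just k' → k' < k) →
             shuffStep (F , just (i , j)) ≡ (swapQ (i , j) (suc i , j) F , just (suc i , j))
  shuff-up {i} {j} eq lt rewrite eq with betaAt F i (suc j)
  ... | nothing = refl
  ... | just k' rewrite <⇒<ᵇ≡ (lt k' refl) = refl

  shuff-right : ∀ {i j k'} → betaAt F i (suc j) ≡ just k' → (∀ k → betaAt F (suc i) j ≡ just k → k ≤ k') →
                shuffStep (F , just (i , j)) ≡ (swapQ (i , j) (i , suc j) F , just (i , suc j))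
  shuff-right {i} {j} eq le rewrite eq with betaAt F (suc i) j
  ... | nothing = refl
  ... | just k rewrite ≮⇒<ᵇ≡ (≤⇒≯ (le k refl)) = refl

iter-+ : ∀ {X : Set} (f : X → X) m n x → iter f m (iter f n x) ≡ iter f (m + n) x
iter-+ f zero n x = refl
iter-+ f (suc m) n x = cong f (iter-+ f m n x)

Reach : ShuffState → ShuffState → Set
Reach s s' = Σ ℕ λ n → iter shuffStep n s ≡ s'

reach-refl : ∀ {s} → Reach s s
reach-refl = 0 , refl

reach-step : ∀ {s s' s''} → shuffStep s ≡ s' → Reach s' s'' → Reach s s''
reach-step {s} refl (n , eq) = n + 1 , trans (sym (iter-+ shuffStep n 1 s)) eq

reach-trans : ∀ {s s' s''} → Reach s s' → Reach s' s'' → Reach s s''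
reach-trans {s} (m , refl) (n , eq) = n + m , trans (sym (iter-+ shuffStep n m s)) eq

-- Fillings as lists of labelled cells

_≟ᵖ_ : (p q : Pos) → Dec (p ≡ q)
(i , j) ≟ᵖ (i' , j') with pos≟ i j i' j'
... | yes (refl , refl) = yes refl
... | no ¬p = no λ { refl → ¬p (refl , refl) }

-- Labels in order of creation. A filling forgets this order, but the invariants of the shuffle need
-- it.
Entries : Set
Entries = List (Pos × Sym)

look : Entries → Pos → Maybe Sym
look [] p = nothing
look ((q , s) ∷ ch) p with q ≟ᵖ p
... | yes _ = just s
... | no _ = look ch p

look-here : ∀ p s ch → look ((p , s) ∷ ch) p ≡ just s
look-here p s ch with p ≟ᵖ p
... | yes _ = refl
... | no ¬p = ⊥-elim (¬p refl)

look-there : ∀ {q p} s ch → q ≢ p → look ((q , s) ∷ ch) p ≡ look ch p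
look-there {q} {p} s ch ne with q ≟ᵖ p
... | yes eq = ⊥-elim (ne eq)
... | no _ = refl

look-∈ : ∀ ch {p s} → look ch p ≡ just s → (p , s) ∈ ch
look-∈ ((q , s) ∷ ch) {p} eq with q ≟ᵖ p
look-∈ ((q , s) ∷ ch) refl | yes refl = here refl
... | no _ = there (look-∈ ch eq)

look-++ˡ : ∀ ch ch' {p s} → look ch p ≡ just s → look (ch ++ ch') p ≡ just s
look-++ˡ ((q , s) ∷ ch) ch' {p} eq with q ≟ᵖ p
... | yes _ = eq
... | no _ = look-++ˡ ch ch' eq

look-++ʳ : ∀ ch ch' {p} → look ch p ≡ nothing → look (ch ++ ch') p ≡ look ch' p
look-++ʳ [] ch' eq = refl
look-++ʳ ((q , s) ∷ ch) ch' {p} eq with q ≟ᵖ p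
... | no _ = look-++ʳ ch ch' eq

look-cases : ∀ ch ch' {p s} → look (ch ++ ch') p ≡ just s → look ch p ≡ just s ⊎ (look ch p ≡ nothing × look ch' p ≡ just s)
look-cases ch ch' {p} eq with look ch p in eq'
... | just s = inj₁ (trans (sym (look-++ˡ ch ch' eq')) eq)
... | nothing = inj₂ (refl , trans (sym (look-++ʳ ch ch' eq')) eq)

look-cong : ∀ ch {ch' ch'' p} → look ch' p ≡ look ch'' p → look (ch ++ ch') p ≡ look (ch ++ ch'') p
look-cong [] eq = eq
look-cong ((q , s) ∷ ch) {p = p} eq with q ≟ᵖ p
... | yes _ = refl
... | no _ = look-cong ch eq

look-swap : ∀ {x y} s t ch p → x ≢ y → look ((x , s) ∷ (y , t) ∷ ch) p ≡ look ((y , t) ∷ (x , s) ∷ ch) p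
look-swap {x} {y} s t ch p ne with x ≟ᵖ p | y ≟ᵖ p
... | yes refl | yes refl = ⊥-elim (ne refl)
... | yes refl | no _ = sym (look-here x s ch)
... | no _ | yes refl = look-here y t ch
... | no ¬p | no ¬q = trans (look-there t ch ¬q) (sym (look-there s ch ¬p))

Shows : Filling → Entries → Set
Shows F ch = ∀ i j → getQ F i j ≡ look ch (i , j)

shows-cast : ∀ {F ch ch'} → (∀ p → look ch p ≡ look ch' p) → Shows F ch → Shows F ch'
shows-cast eq sh i j = trans (sh i j) (eq (i , j))

getQ-set : ∀ F {i j m} v → at F i j ≡ just m → getQ (setQ i j v F) i j ≡ v
getQ-set F {i} {j} v eq = getQ-at (setQ i j v F) {i} {j} (at-modify-same (λ _ → v) F {i} {j} eq)

getQ-nth? : ∀ F i j → getQ F i j ≡ Maybe.maybe′ id nothing (at F i j)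
getQ-nth? F i j = go (nth [] F i) j
  where
  go : ∀ (row : List (Maybe Sym)) j → nth nothing row j ≡ Maybe.maybe′ id nothing (nth? row j)
  go [] j = refl
  go (x ∷ row) zero = refl
  go (x ∷ row) (suc j) = go row j

getQ-set-other : ∀ F {i j i' j'} v → (i , j) ≢ (i' , j') → getQ (setQ i j v F) i' j' ≡ getQ F i' j'
getQ-set-other F {i} {j} {i'} {j'} v ne = trans (getQ-nth? (setQ i j v F) i' j')
  (trans (cong (Maybe.maybe′ id nothing) (at-modify-other (λ _ → v) F {i} {j} {i'} {j'} λ { (refl , refl) → ne refl })) (sym (getQ-nth? F i' j')))

at-set-other : ∀ F {i j i' j'} v → (i , j) ≢ (i' , j') → at (setQ i j v F) i' j' ≡ at F i' j'
at-set-other F {i} {j} {i'} {j'} v ne = at-modify-other (λ _ → v) F {i} {j} {i'} {j'} λ { (refl , refl) → ne refl }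

shows-swap : ∀ {F} pre {x y} s t ch → Shows F (pre ++ (x , s) ∷ (y , t) ∷ ch) → look pre x ≡ nothing → look pre y ≡ nothing → x ≢ y →
             Shows (swapQ x y F) (pre ++ (x , t) ∷ (y , s) ∷ ch)
shows-swap {F} pre {x@(i , j)} {y@(i' , j')} s t ch sh pre-x pre-y ne i'' j'' = result
  where
  F-x : getQ F i j ≡ just s
  F-x = trans (sh i j) (trans (look-++ʳ pre _ pre-x) (look-here x s _))
  F-y : getQ F i' j' ≡ just t
  F-y = trans (sh i' j') (trans (look-++ʳ pre _ pre-y) (trans (look-there s _ ne) (look-here y t ch)))
  F₁ = setQ i j (getQ F i' j') F
  result : getQ (swapQ x y F) i'' j'' ≡ look (pre ++ (x , t) ∷ (y , s) ∷ ch) (i'' , j'')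
  result with y ≟ᵖ (i'' , j'') | x ≟ᵖ (i'' , j'')
  ... | yes refl | _ = trans (getQ-set F₁ {i'} {j'} _ (trans (at-set-other F {i} {j} _ ne) (at-getQ F F-y)))
                         (trans F-x (sym (trans (look-++ʳ pre _ pre-y) (trans (look-there t _ ne) (look-here y s ch)))))
  ... | no ¬y | yes refl = trans (getQ-set-other F₁ {i'} {j'} _ ¬y) (trans (getQ-set F {i} {j} _ (at-getQ F F-x))
                         (trans F-y (sym (trans (look-++ʳ pre _ pre-x) (look-here x t _)))))
  ... | no ¬y | no ¬x = trans (getQ-set-other F₁ {i'} {j'} _ ¬y) (trans (getQ-set-other F {i} {j} _ ¬x) (trans (sh i'' j'')
                         (look-cong pre (trans (trans (look-there s _ ¬x) (look-there t _ ¬y)) (sym (trans (look-there t _ ¬x) (look-there s _ ¬y)))))))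

lengths-swap : ∀ x y F → map length (swapQ x y F) ≡ map length F
lengths-swap (i , j) (i' , j') F = trans (lengths-modify _ i' j' (setQ i j _ F)) (lengths-modify _ i j F)

-- The shuffle along the growth diagram

arm-entries leg-entries : List (ℕ × Pos) → Entries
arm-entries = map λ (c , x) → x , α (suc c)
leg-entries = map λ (r , y) → y , β (suc r)

∈-arm-entries : ∀ ps {p s} → (p , s) ∈ arm-entries ps → Σ ℕ λ c → s ≡ α (suc c) × (c , p) ∈ ps
∈-arm-entries ((c , x) ∷ ps) (here refl) = c , refl , here refl
∈-arm-entries (_ ∷ ps) (there p) with ∈-arm-entries ps p
... | c , eq , q = c , eq , there q

∈-leg-entries : ∀ qs {p s} → (p , s) ∈ leg-entries qs → Σ ℕ λ r → s ≡ β (suc r) × (r , p) ∈ qs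
∈-leg-entries ((r , y) ∷ qs) (here refl) = r , refl , here refl
∈-leg-entries (_ ∷ qs) (there p) with ∈-leg-entries qs p
... | r , eq , q = r , eq , there q

-- The transpose of `Later`, for positions still written as row and column.
LaterLeg : ℕ × Pos → ℕ × Pos → Set
LaterLeg (r₁ , i₁ , _) (r₂ , i₂ , _) = r₂ < r₁ ⊎ (r₂ ≡ r₁ × i₁ < i₂)

module Shuffling (B : ℕ) (_◁_ _◀_ : ℕ → ℕ → Set) (orders : Orders _◁_ _◀_) where
  open Bounded B
  open Half B _◁_ _◀_ orders
  open Growth B _◁_ _◀_ orders
  open Grid B _◁_ _◀_ orders

  infixr 5 _∷_
  data LegGrows : Enc → List (ℕ × Pos) → Enc → Set where
    []  : ∀ {e} → LegGrows e [] e
    _∷_ : ∀ {e r i j e₁ qs e'} → LegGrow e r i j e₁ → LegGrows e₁ qs e' → LegGrows e ((r , i , j) ∷ qs) e'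

  -- The columns of the growth diagram: one arm growth carried across a sequence
  -- of leg growths ...
  data Strip (c : ℕ) : (e e₁ : Enc) → Pos → (qs qs₀ : List (ℕ × Pos)) → Pos → (e₂ e₃ : Enc) → Set where
    []   : ∀ {e e₁ x} → Strip c e e₁ x [] [] x e e₁
    cons : ∀ {e e₁ f f₁ e₂ e₃ x r y₀ y x₁ x' qs qs₀} →
           LegGrow e r (proj₁ y₀) (proj₂ y₀) f → LegGrow e₁ r (proj₁ y) (proj₂ y) f₁ → Grow f c (proj₁ x₁) (proj₂ x₁) f₁ →
           Switch x y y₀ x₁ → Strip c f f₁ x₁ qs qs₀ x' e₂ e₃ → Strip c e e₁ x ((r , y) ∷ qs) ((r , y₀) ∷ qs₀) x' e₂ e₃

  -- ... and a sequence of arm growths carried across it.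
  data Weave : (e : Enc) (ps : List (ℕ × Pos)) (e₁ : Enc) (qs qs₀ ps' : List (ℕ × Pos)) (e₂ e₃ : Enc) → Set where
    []   : ∀ {e qs e₂} → LegGrows e qs e₂ → Weave e [] e qs qs [] e₂ e₂
    cons : ∀ {e c x e' ps e₁ qs qs₁ qs₀ x' ps' e₂ e₂' e₃} → Grow e c (proj₁ x) (proj₂ x) e' → Strip c e e' x qs₁ qs₀ x' e₂ e₂' →
           Grow e₂ c (proj₁ x') (proj₂ x') e₂' → Weave e' ps e₁ qs qs₁ ps' e₂' e₃ → Weave e ((c , x) ∷ ps) e₁ qs qs₀ ((c , x') ∷ ps') e₂ e₃

  legGrow-valid : ∀ {e r i j e'} → Valid e → LegGrow e r i j e' → Valid e'
  legGrow-valid V G = Valid-ᵗ (DG.Grow-valid (Valid-ᵗ V) G)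

  strip-exists : ∀ {e c x e₁ qs₀ e₂} → Valid e → Grow e c (proj₁ x) (proj₂ x) e₁ → LegGrows e qs₀ e₂ →
                 Σ (List (ℕ × Pos)) λ qs → Σ Pos λ x' → Σ Enc λ e₃ →
                 Strip c e e₁ x qs qs₀ x' e₂ e₃ × LegGrows e₁ qs e₃ × Grow e₂ c (proj₁ x') (proj₂ x') e₃
  strip-exists {x = x} V G [] = [] , x , _ , [] , [] , G
  strip-exists {x = x} V G (R ∷ Rs) with switch V G R
  ... | f₁ , y , x₁ , R' , G' , sw with strip-exists {x = x₁} (legGrow-valid V R) G' Rs
  ...   | qs , x' , e₃ , st , Rs' , G'' = _ , x' , e₃ , cons R R' G' sw st , R' ∷ Rs' , G''

  weave-exists : ∀ {e ps e₁ qs₀ e₂} → Valid e → Grows e ps e₁ → LegGrows e qs₀ e₂ →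
                 Σ (List (ℕ × Pos)) λ qs → Σ (List (ℕ × Pos)) λ ps' → Σ Enc λ e₃ →
                 Weave e ps e₁ qs qs₀ ps' e₂ e₃ × LegGrows e₁ qs e₃ × Grows e₂ ps' e₃
  weave-exists V [] Rs = _ , _ , _ , [] Rs , Rs , []
  weave-exists V (_∷_ {i = i} {j} G Gs) Rs with strip-exists {x = i , j} V G Rs
  ... | qs₁ , x' , e₂' , st , Rs₁ , G' with weave-exists (Grow-valid V G) Gs Rs₁
  ...   | qs , ps' , e₃ , w , Rs' , Gs' = qs , _ , e₃ , cons G st G' w , Rs' , G' ∷ Gs'

  strip-legs : ∀ {c e e₁ x qs qs₀ x' e₂ e₃} → Strip c e e₁ x qs qs₀ x' e₂ e₃ → LegGrows e₁ qs e₃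
  strip-legs [] = []
  strip-legs (cons _ R' _ _ st) = R' ∷ strip-legs st

  weave-arms : ∀ {e ps e₁ qs qs₀ ps' e₂ e₃} → Weave e ps e₁ qs qs₀ ps' e₂ e₃ → Grows e ps e₁
  weave-arms ([] _) = []
  weave-arms (cons G _ _ w) = G ∷ weave-arms w

  weave-arms' : ∀ {e ps e₁ qs qs₀ ps' e₂ e₃} → Weave e ps e₁ qs qs₀ ps' e₂ e₃ → Grows e₂ ps' e₃
  weave-arms' ([] _) = []
  weave-arms' (cons _ _ G w) = G ∷ weave-arms' w

  Filled : Enc → Pos → Set
  Filled e (i , j) = H e i j < B

  leg-kept : ∀ {e r i j e'} → LegGrow e r i j e' → ∀ p → Filled e p → Filled e' p
  leg-kept R (i , j) = Adds.kept (DG.Grow-adds R) j i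

  legs-kept : ∀ {e qs e'} → LegGrows e qs e' → ∀ p → Filled e p → Filled e' p
  legs-kept [] p fin = fin
  legs-kept (R ∷ Rs) p fin = legs-kept Rs p (leg-kept R p fin)

  legs-filled : ∀ {e qs e'} → LegGrows e qs e' → ∀ {r p} → (r , p) ∈ qs → Filled e' p
  legs-filled (R ∷ Rs) (here refl) = legs-kept Rs _ (Adds.after (DG.Grow-adds R))
  legs-filled (R ∷ Rs) (there q) = legs-filled Rs q

  arms-unfilled : ∀ {e ps e'} → Grows e ps e' → ∀ {c p} → (c , p) ∈ ps → ¬ Filled e p
  arms-unfilled (G ∷ Gs) (here refl) fin = <⇒≱ fin (Adds.before (Grow-adds G))
  arms-unfilled (G ∷ Gs) {p = i , j} (there q) fin = arms-unfilled Gs q (Adds.kept (Grow-adds G) i j fin)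

  legs-later : ∀ {e r i j e₁ qs e'} → Valid e → LegGrow e r i j e₁ → LegGrows e₁ qs e' → All (LaterLeg (r , i , j)) qs
  legs-later V R [] = []
  legs-later {r = r} {i} {j} V R (_∷_ {r = r'} {i'} {j'} R' Rs) =
    DG.grow-later (Valid-ᵗ V) R R' ∷ All.map (λ {p} → later-trans {p} (DG.grow-later (Valid-ᵗ V) R R')) (legs-later (legGrow-valid V R) R' Rs)
    where
    later-trans : ∀ {q} → LaterLeg (r , i , j) (r' , i' , j') → LaterLeg (r' , i' , j') q → LaterLeg (r , i , j) q
    later-trans {r'' , i'' , j''} = DG.Later-trans {r , j , i} {r' , j' , i'} {r'' , j'' , i''}

  below : ∀ {e x y} → Valid e → Adjacent x y → Filled e y → Filled e x
  below V above fin = ≤-<-trans (H-mono V (n≤1+n _) ≤-refl) fin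
  below V beside fin = ≤-<-trans (H-mono V ≤-refl (n≤1+n _)) fin

  adjacent-≢ : ∀ {x y} → Adjacent x y → x ≢ y
  adjacent-≢ above ()
  adjacent-≢ beside ()

  Within : Entries → Enc → Set
  Within ch e = ∀ {p s} → look ch p ≡ just s → Filled e p

  Arms : Entries → Set
  Arms ch = ∀ {p s} → look ch p ≡ just s → Σ ℕ λ k → s ≡ α k

  outside : ∀ {ch e p} → Within ch e → ¬ Filled e p → look ch p ≡ nothing
  outside {ch} {p = p} w ¬fin with look ch p in eq
  ... | nothing = refl
  ... | just s = ⊥-elim (¬fin (w eq))

  within-leg : ∀ {ch e r i j e'} → Within ch e → LegGrow e r i j e' → ∀ s → Within (ch ++ ((i , j) , s) ∷ []) e'
  within-leg {ch} {i = i} {j} w R s {p} eq with look-cases ch _ eq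
  ... | inj₁ eq' = leg-kept R _ (w eq')
  ... | inj₂ (_ , eq') with look-∈ (((i , j) , s) ∷ []) eq'
  ...   | here refl = Adds.after (DG.Grow-adds R)

  -- The situation while the α at `x` is in transit: `pre` consists of cells filled in `e`, `qs` of
  -- the β still to be passed, and `post` of α only.
  module State {pre post : Entries} {c : ℕ} {x : Pos} {e e₁ : Enc} {qs : List (ℕ × Pos)} {F : Filling} (V : Valid e) (G : Grow e c (proj₁ x) (proj₂ x) e₁)
               (within : Within pre e) (arms : Arms post) (shows : Shows F (pre ++ (x , α (suc c)) ∷ leg-entries qs ++ post)) where

    x-empty : ¬ Filled e x
    x-empty fin = <⇒≱ fin (Adds.before (Grow-adds G))

    -- A neighbour recorded in `pre` would be filled in `e`, and with it the cell `x` below or left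
    -- of it, which is still empty there.
    leg-next : ∀ {p k} → Adjacent x p → getQ F (proj₁ p) (proj₂ p) ≡ just (β k) → Σ ℕ λ r → k ≡ suc r × (r , p) ∈ qs
    leg-next {p} adj eq with look-cases pre _ (trans (sym (shows (proj₁ p) (proj₂ p))) eq)
    ... | inj₁ eq' = ⊥-elim (x-empty (below V adj (within eq')))
    ... | inj₂ (_ , eq') with look-cases (leg-entries qs) post (trans (sym (look-there {x} {p} (α (suc c)) (leg-entries qs ++ post) (adjacent-≢ adj))) eq')
    ...   | inj₂ (_ , eq'') = case arms eq'' of λ { (_ , ()) }
    ...   | inj₁ eq'' with ∈-leg-entries qs (look-∈ (leg-entries qs) eq'')
    ...     | r , refl , r∈ = r , refl , r∈

    no-beta : ∀ {i j} → qs ≡ [] → Adjacent x (i , j) → betaAt F i j ≡ nothing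
    no-beta {i} {j} refl adj with betaAt F i j in eq
    ... | nothing = refl
    ... | just k = case leg-next adj (betaAt-inv F {i} {j} eq) of λ { (_ , _ , ()) }

  first-leg : ∀ {pre post c x e e₁ r y f₁ qs F} → Within pre e → Grow e c (proj₁ x) (proj₂ x) e₁ → LegGrow e₁ r (proj₁ y) (proj₂ y) f₁ → x ≢ y →
              Shows F (pre ++ (x , α (suc c)) ∷ leg-entries ((r , y) ∷ qs) ++ post) → look pre y ≡ nothing × getQ F (proj₁ y) (proj₂ y) ≡ just (β (suc r))
  first-leg {pre} {post} {c} {x} {e} {r = r} {y@(i , j)} w G R ne sh = pre-y ,
    trans (sh i j) (trans (look-++ʳ pre _ pre-y) (trans (look-there _ _ ne) (look-here y _ _)))
    where
    pre-y : look pre y ≡ nothing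
    pre-y = outside {pre} {e} {y} w λ fin → <⇒≱ (Adds.kept (Grow-adds G) i j fin) (Adds.before (DG.Grow-adds R))

  shift : ∀ (pre : Entries) z ch → (pre ++ z ∷ []) ++ ch ≡ pre ++ z ∷ ch
  shift pre z ch = ++-assoc pre (z ∷ []) ch

  -- Of the leg entries above and beside the moving arm, the rule of the shuffle
  -- selects the one added first: labels decrease weakly, and of two leg entries
  -- with the same label the later one lies in a higher row.
  swaps-next : ∀ {pre post c x e e₁ r y f₁ qs e₃ F} → Valid e → Grow e c (proj₁ x) (proj₂ x) e₁ → LegGrow e₁ r (proj₁ y) (proj₂ y) f₁ → LegGrows f₁ qs e₃ →
               Within pre e → Arms post → Shows F (pre ++ (x , α (suc c)) ∷ leg-entries ((r , y) ∷ qs) ++ post) → Adjacent x y →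
               shuffStep (F , just x) ≡ (swapQ x y F , just y)
  swaps-next {pre} {post} {x = x@(i , j)} {r = r} {y} {qs = qs} {F = F} V G R Rs w ar sh adj = go adj
    where
    open State {pre} {post} {x = x} {qs = (r , y) ∷ qs} {F} V G w ar sh
    rest : ∀ {p k} → Adjacent x p → p ≢ y → betaAt F (proj₁ p) (proj₂ p) ≡ just k → Σ ℕ λ r' → k ≡ suc r' × LaterLeg (r , y) (r' , p)
    rest {p} adj' ne eq with leg-next adj' (betaAt-inv F {proj₁ p} {proj₂ p} eq)
    ... | _ , _ , here refl = ⊥-elim (ne refl)
    ... | r' , eq' , there r∈ = r' , eq' , All.lookup (legs-later (Grow-valid V G) R Rs) r∈
    label-y : betaAt F (proj₁ y) (proj₂ y) ≡ just (suc r)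
    label-y = betaAt-β F {proj₁ y} {proj₂ y} (proj₂ (first-leg {pre} {post} {F = F} w G R (adjacent-≢ adj) sh))
    go : Adjacent x y → shuffStep (F , just x) ≡ (swapQ x y F , just y)
    go above = shuff-up F {i} {j} label-y λ k' eq → case rest beside (λ ()) eq of λ
      { (_ , refl , inj₁ lt) → s≤s lt ; (_ , _ , inj₂ (_ , lt)) → ⊥-elim (<-asym lt ≤-refl) }
    go beside = shuff-right F {i} {j} label-y λ k eq → case rest above (λ ()) eq of λ
      { (_ , refl , inj₁ lt) → <⇒≤ (s≤s lt) ; (_ , refl , inj₂ (refl , _)) → ≤-refl }

  -- If the next β was created apart from `x`, only the order in the list changes and no shuffle
  -- step is made. If it is adjacent, the shuffle performs the swap. When no β remains to be passed,
  -- neither neighbour is a β and the transit ends.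
  moving : ∀ {pre post c x e e₁ qs qs₀ x' e₂ e₃ F} → Valid e → Grow e c (proj₁ x) (proj₂ x) e₁ → Strip c e e₁ x qs qs₀ x' e₂ e₃ →
           Within pre e → Arms post → Shows F (pre ++ (x , α (suc c)) ∷ leg-entries qs ++ post) →
           Σ Filling λ F' → Reach (F , just x) (F' , nothing) × Shows F' (pre ++ leg-entries qs₀ ++ (x' , α (suc c)) ∷ post) ×
           map length F' ≡ map length F
  moving {pre} {post} {x = x@(i , j)} {F = F} V G [] w ar sh =
    F , reach-step (shuff-stop F {i} {j} (no-beta refl above) (no-beta refl beside)) reach-refl , sh , refl
    where open State {pre} {post} {x = x} {qs = []} {F} V G w ar sh
  moving {pre} {post} {c} {x} {e} {F = F} V G (cons {r = r} {y = y} {qs = qs} {qs₀ = qs₀} R R' G' (apart ne _) st) w ar sh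
    with moving {pre ++ (y , β (suc r)) ∷ []} {post} {c} {x} {F = F} (legGrow-valid V R) G' st (within-leg {pre} w R _) ar
           (shows-cast {F} {pre ++ (x , α (suc c)) ∷ leg-entries ((r , y) ∷ qs) ++ post} {(pre ++ (y , β (suc r)) ∷ []) ++ (x , α (suc c)) ∷ leg-entries qs ++ post}
             (λ p → trans (look-cong pre (look-swap (α (suc c)) (β (suc r)) (leg-entries qs ++ post) p ne)) (cong (λ ch → look ch p) (sym (shift pre _ _)))) sh)
  ... | F' , reach , sh' , len = F' , reach , subst (Shows F') (shift pre _ _) sh' , len
  moving {pre} {post} {c} {x} {e} {F = F} V G (cons {r = r} {y = y} {qs = qs} {qs₀ = qs₀} R R' G' (slide adj) st) w ar sh
    with moving {pre ++ (x , β (suc r)) ∷ []} {post} {c} {y} {F = swapQ x y F} (legGrow-valid V R) G' st (within-leg {pre} w R _) ar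
           (subst (Shows (swapQ x y F)) (sym (shift pre _ _))
             (shows-swap {F} pre {x} {y} _ _ (leg-entries qs ++ post) sh (outside {pre} {e} {x} w λ fin → <⇒≱ fin (Adds.before (Grow-adds G)))
               (proj₁ (first-leg {pre} {post} {F = F} w G R' (adjacent-≢ adj) sh)) (adjacent-≢ adj)))
  ... | F' , reach , sh' , len = F' , reach-step (swaps-next {pre} {post} {F = F} V G R' (strip-legs st) w ar sh adj) reach ,
        subst (Shows F') (shift pre _ _) sh' , trans len (lengths-swap x y F)

  FirstPick : Filling → Pos → ℕ → Set
  FirstPick F (i , j) k = ∀ i' j' s → ¬ (i ≡ i' × j ≡ j') → getQ F i' j' ≡ s → Loses F i j k (i' , j' , s)

  movable-beta : ∀ F {i j p k} → Adjacent (i , j) p → getQ F (proj₁ p) (proj₂ p) ≡ just (β k) → movable F i j ≡ true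
  movable-beta F {i} {j} above eq rewrite betaAt-β F {suc i} {j} eq = refl
  movable-beta F {i} {j} beside eq rewrite betaAt-β F {i} {suc j} eq with betaAt F (suc i) j
  ... | just _ = refl
  ... | nothing = refl

  movable-inv : ∀ F {i j} → movable F i j ≡ true → Σ Pos λ p → Adjacent (i , j) p × Σ ℕ λ k → getQ F (proj₁ p) (proj₂ p) ≡ just (β k)
  movable-inv F {i} {j} eq with betaAt F (suc i) j in eq' | betaAt F i (suc j) in eq''
  ... | just k | _ = (suc i , j) , above , k , betaAt-inv F {suc i} {j} eq'
  ... | nothing | just k = (i , suc j) , beside , k , betaAt-inv F {i} {suc j} eq''

  -- Before the first adjacent β only the list is reordered, so the α is selected in the unchanged
  -- filling `F`. From then on `moving` applies. If no adjacent β ever comes, the α is never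
  -- selected, which agrees with the shuffle.
  waiting : ∀ {pre post c x e e₁ qs qs₀ x' e₂ e₃ F} → Valid e → Grow e c (proj₁ x) (proj₂ x) e₁ → Strip c e e₁ x qs qs₀ x' e₂ e₃ →
            Within pre e → Arms post → Shows F (pre ++ (x , α (suc c)) ∷ leg-entries qs ++ post) → FirstPick F x (suc c) →
            Σ Filling λ F' → Reach (F , nothing) (F' , nothing) × Shows F' (pre ++ leg-entries qs₀ ++ (x' , α (suc c)) ∷ post) ×
            map length F' ≡ map length F
  waiting {F = F} V G [] w ar sh pick = F , reach-refl , sh , refl
  waiting {pre} {post} {c} {x} {F = F} V G (cons {r = r} {y = y} {qs = qs} {qs₀ = qs₀} R R' G' (apart ne _) st) w ar sh pick
    with waiting {pre ++ (y , β (suc r)) ∷ []} {post} {c} {x} {F = F} (legGrow-valid V R) G' st (within-leg {pre} w R _) ar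
           (shows-cast {F} {pre ++ (x , α (suc c)) ∷ leg-entries ((r , y) ∷ qs) ++ post} {(pre ++ (y , β (suc r)) ∷ []) ++ (x , α (suc c)) ∷ leg-entries qs ++ post}
             (λ p → trans (look-cong pre (look-swap (α (suc c)) (β (suc r)) (leg-entries qs ++ post) p ne)) (cong (λ ch → look ch p) (sym (shift pre _ _)))) sh)
           pick
  ... | F' , reach , sh' , len = F' , reach , subst (Shows F') (shift pre _ _) sh' , len
  waiting {pre} {post} {c} {x@(i , j)} {e} {F = F} V G st@(cons {r = r} R R' G' (slide adj) _) w ar sh pick with moving {pre} {post} {F = F} V G st w ar sh
  ... | F' , reach , sh' , len = F' , reach-step (shuff-start F (findCand-just F {i} {j} {suc c} x-label (movable-beta F adj y-label) pick)) reach , sh' , len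
    where
    x-label : getQ F i j ≡ just (α (suc c))
    x-label = trans (sh i j) (trans (look-++ʳ pre _ (outside {pre} {e} {x} w λ fin → <⇒≱ fin (Adds.before (Grow-adds G)))) (look-here x _ _))
    y-label = proj₂ (first-leg {pre} {post} {F = F} w G R' (adjacent-≢ adj) sh)

  Earlier : Entries → ℕ × Pos → Set
  Earlier pre (c , x) = ∀ {p s} → look pre p ≡ just s → Σ ℕ λ k → s ≡ α (suc k) × Later (k , p) (c , x)

  arm-entries-arms : ∀ ps → Arms (arm-entries ps)
  arm-entries-arms ps eq with ∈-arm-entries ps (look-∈ (arm-entries ps) eq)
  ... | c , eq' , _ = suc c , eq'

  -- The α in `pre` lose by label or by column. Those after `x` are not movable: a β above or beside
  -- such an α would lie in a cell filled before that α was added, and then the cell of the α would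
  -- have been filled as well.
  first-pick : ∀ {pre c x e e₁ qs e₂ ps e₃ F} → Valid e → Grow e c (proj₁ x) (proj₂ x) e₁ → LegGrows e₁ qs e₂ → Grows e₂ ps e₃ →
               Within pre e → Earlier pre (c , x) → Shows F (pre ++ (x , α (suc c)) ∷ leg-entries qs ++ arm-entries ps) → FirstPick F x (suc c)
  first-pick {pre} {c} {x} {e} {e₁} {qs} {e₂} {ps} {e₃} {F} V G Rs Gs w earlier sh i' j' s ¬p eq k' refl mov with look-cases pre _ (trans (sym (sh i' j')) eq)
  ... | inj₁ eq₁ = case earlier eq₁ of λ { (k , refl , lt) → Sum.map s≤s (λ (e , l) → cong suc e , l) lt }
  ... | inj₂ (_ , eq₁) with look-cases (leg-entries qs) (arm-entries ps) (trans (sym (look-there {x} {i' , j'} (α (suc c)) (leg-entries qs ++ arm-entries ps) λ { refl → ¬p (refl , refl) })) eq₁)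
  ...   | inj₁ eq₂ = case ∈-leg-entries qs (look-∈ (leg-entries qs) eq₂) of λ { (_ , () , _) }
  ...   | inj₂ (_ , eq₂) with ∈-arm-entries ps (look-∈ (arm-entries ps) eq₂) | movable-inv F {i'} {j'} mov
  ...     | _ , _ , p∈ | y , adj , k , y-label = ⊥-elim (arms-unfilled Gs p∈ (below V₂ adj y-filled))
    where
    legs-valid : ∀ {e qs e'} → Valid e → LegGrows e qs e' → Valid e'
    legs-valid V [] = V
    legs-valid V (R ∷ Rs) = legs-valid (legGrow-valid V R) Rs
    V₂ : Valid e₂
    V₂ = legs-valid (Grow-valid V G) Rs
    y-filled : Filled e₂ y
    y-filled with look-cases pre _ (trans (sym (sh (proj₁ y) (proj₂ y))) y-label)
    ... | inj₁ eq₃ = legs-kept Rs y (Adds.kept (Grow-adds G) _ _ (w eq₃))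
    ... | inj₂ (_ , eq₃) with x ≟ᵖ y
    ...   | no _ with look-cases (leg-entries qs) (arm-entries ps) eq₃
    ...     | inj₁ eq₄ = legs-filled Rs (proj₂ (proj₂ (∈-leg-entries qs (look-∈ (leg-entries qs) eq₄))))
    ...     | inj₂ (_ , eq₄) = case arm-entries-arms ps eq₄ of λ { (_ , ()) }

  within-arm : ∀ {pre c e e₁} {x : Pos} → Within pre e → Grow e c (proj₁ x) (proj₂ x) e₁ → ∀ s → Within (pre ++ (x , s) ∷ []) e₁
  within-arm {pre} {x = x} w G s eq with look-cases pre _ eq
  ... | inj₁ eq' = Adds.kept (Grow-adds G) _ _ (w eq')
  ... | inj₂ (_ , eq') with look-∈ ((x , s) ∷ []) eq'
  ...   | here refl = Adds.after (Grow-adds G)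

  -- The recursive call comes first and carries all later α across the β, with the current α counted
  -- among the earlier ones; only then does the current α travel. Its β are by then `qs₁`, the
  -- intermediate row of the diagram.
  weaving : ∀ {pre e ps e₁ qs qs₀ ps' e₂ e₃ F} → Valid e → Weave e ps e₁ qs qs₀ ps' e₂ e₃ → Within pre e → All (Earlier pre) ps →
            Shows F (pre ++ arm-entries ps ++ leg-entries qs) →
            Σ Filling λ F' → Reach (F , nothing) (F' , nothing) × Shows F' (pre ++ leg-entries qs₀ ++ arm-entries ps') × map length F' ≡ map length F
  weaving {pre} {qs = qs} {F = F} V ([] _) w earlier sh =
    F , reach-refl , subst (λ ch → Shows F (pre ++ ch)) (sym (++-identityʳ (leg-entries qs))) sh , refl
  weaving {pre} {F = F} V (cons {c = c} {x} {ps = ps} {ps' = ps'} G st G' we) w (ea ∷ earlier) sh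
    with weaving {pre ++ (x , α (suc c)) ∷ []} {F = F} (Grow-valid V G) we (within-arm {pre} w G _) (extend-all earlier (grows-later V G (weave-arms we)))
           (subst (Shows F) (sym (shift pre _ _)) sh)
    where
    extend : ∀ {q} → Earlier pre q → Later (c , x) q → Earlier (pre ++ (x , α (suc c)) ∷ []) q
    extend ea lt eq with look-cases pre _ eq
    ... | inj₁ eq' = ea eq'
    ... | inj₂ (_ , eq') with look-∈ ((x , α (suc c)) ∷ []) eq'
    ...   | here refl = c , refl , lt
    extend-all : ∀ {qs} → All (Earlier pre) qs → All (Later (c , x)) qs → All (Earlier (pre ++ (x , α (suc c)) ∷ [])) qs
    extend-all [] [] = []
    extend-all (_∷_ {q} ea eas) (lt ∷ lts) = extend {q} ea lt ∷ extend-all eas lts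
  ... | F₁ , reach₁ , sh₁ , len₁
    with waiting {pre} {arm-entries ps'} {F = F₁} V G st w (arm-entries-arms ps') (subst (Shows F₁) (shift pre _ _) sh₁)
           (first-pick {pre} {F = F₁} V G (strip-legs st) (weave-arms' we) w ea (subst (Shows F₁) (shift pre _ _) sh₁))
  ... | F₂ , reach₂ , sh₂ , len₂ = F₂ , reach-trans reach₁ reach₂ , sh₂ , trans len₂ len₁

  -- In the final list all β precede all α. A β above or beside an α would force the cell of the α
  -- to be filled before it was added.
  settled : ∀ {e qs e₂ ps e₃ F} → Valid e → LegGrows e qs e₂ → Valid e₂ → Grows e₂ ps e₃ → Shows F (leg-entries qs ++ arm-entries ps) → findCand F ≡ nothing
  settled {qs = qs} {ps = ps} {F = F} V Rs V₂ Gs sh = findCand-nothing F none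
    where
    none : ∀ i j k → getQ F i j ≡ just (α k) → movable F i j ≡ false
    none i j k eq with movable F i j in mov
    ... | false = refl
    ... | true with movable-inv F {i} {j} mov | look-cases (leg-entries qs) _ (trans (sym (sh i j)) eq)
    ...   | _ | inj₁ eq₁ = case ∈-leg-entries qs (look-∈ (leg-entries qs) eq₁) of λ { (_ , () , _) }
    ...   | y , adj , k' , y-label | inj₂ (_ , eq₁) with look-cases (leg-entries qs) _ (trans (sym (sh (proj₁ y) (proj₂ y))) y-label)
    ...     | inj₂ (_ , eq₂) = case arm-entries-arms ps eq₂ of λ { (_ , ()) }
    ...     | inj₁ eq₂ = ⊥-elim (arms-unfilled Gs (proj₂ (proj₂ (∈-arm-entries ps (look-∈ (arm-entries ps) eq₁))))
                (below V₂ adj (legs-filled Rs (proj₂ (proj₂ (∈-leg-entries qs (look-∈ (leg-entries qs) eq₂)))))))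

-- From encodings to cells

one : ℕ → ℕ → ℕ
one a v = δ 0 a 0 v

δ-one : ∀ c a v → δ c a c v ≡ one a v
δ-one c a v with pos≟ c a c v | pos≟ 0 a 0 v
... | yes _ | yes _ = refl
... | no _ | no _ = refl
... | yes (_ , eq) | no ¬p = ⊥-elim (¬p (refl , eq))
... | no ¬p | yes (_ , eq) = ⊥-elim (¬p (refl , eq))

one-hit : ∀ a → one a a ≡ 1
one-hit a = δ-hit 0 a

one-miss : ∀ {a v} → a ≢ v → one a v ≡ 0
one-miss ne = δ-miss (ne ∘ proj₂)

occ : ℕ → List ℕ → ℕ
occ v [] = 0
occ v (x ∷ xs) = one x v + occ v xs

¬0<⇒≡0 : ∀ {n} → ¬ 0 < n → n ≡ 0
¬0<⇒≡0 p = n≤0⇒n≡0 (≮⇒≥ p)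

module Localisation (B : ℕ) (_◁_ _◀_ : ℕ → ℕ → Set) (orders : Orders _◁_ _◀_) where
  open Bounded B
  open Half B _◁_ _◀_ orders
  open Orders orders

  -- The numbers lc i j v and ac i j v of legs and arms v in the cell (i , j).
  record Local (lc ac : ℕ → ℕ → ℕ → ℕ) (e : Enc) : Set where
    field
      legIn  : ∀ i j v → H e i j ◀ v → v ◁ H e i (suc j) → v < B → lc i j v ≡ L e i v
      legOut : ∀ i j v → 0 < lc i j v → (H e i j ◀ v) × (v ◁ H e i (suc j)) × v < B
      armIn  : ∀ i j v → H e i j ◁ v → v ◀ H e (suc i) j → v < B → ac i j v ≡ A e j v
      armOut : ∀ i j v → 0 < ac i j v → (H e i j ◁ v) × (v ◀ H e (suc i) j) × v < B

    leg∈ : ∀ {i j v} → 0 < lc i j v → Leg e i v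
    leg∈ p with legOut _ _ _ p
    ... | q , r , s = subst (0 <_) (legIn _ _ _ q r s) p , s

    arm∈ : ∀ {i j v} → 0 < ac i j v → Arm e j v
    arm∈ p with armOut _ _ _ p
    ... | q , r , s = subst (0 <_) (armIn _ _ _ q r s) p , s

    leg-absent : ∀ {i j v} → ¬ (H e i j ◀ v × v ◁ H e i (suc j)) → lc i j v ≡ 0
    leg-absent ¬p = ¬0<⇒≡0 λ q → case legOut _ _ _ q of λ (r , s , _) → ¬p (r , s)

  -- Serves both kinds of step. Column `suc c` had no arms, so afterwards it contains at most `k`,
  -- in the row singled out by `k-low` and `k-high`. In column `c` one copy of `a` leaves its unique
  -- row.
  module Arms {lc ac ac' : ℕ → ℕ → ℕ → ℕ} {e e' : Enc} {c a k ρ i : ℕ} (V : Valid e) (V' : Valid e') (P : Particle e c a) (loc : Local lc ac e)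
              (mvA : Move (A e) (A e') c a (suc c) k) (off : ∀ i' j → j ≢ suc c → H e' i' j ≡ H e i' j)
              (k-low : H e' i (suc c) ◁ k) (k-high : k ◀ H e' (suc i) (suc c))
              (at-ρ : 0 < ac ρ c a)
              (ac-source : ∀ v → ac' ρ c v + one a v ≡ ac ρ c v)
              (ac-target : ∀ v → v < B → ac' i (suc c) v ≡ one k v)
              (ac-target-big : ∀ v → B ≤ v → ac' i (suc c) v ≡ 0)
              (ac-other : ∀ i' j' v → ¬ (ρ ≡ i' × c ≡ j') → ¬ (i ≡ i' × suc c ≡ j') → ac' i' j' v ≡ ac i' j' v) where
    open Local loc
    open Particle P renaming (arm∈ to a∈; last to clear)

    same-column : ∀ {i' j' v} → j' ≢ suc c → (H e i' j' ◁ v) × (v ◀ H e (suc i') j') × v < B → (H e' i' j' ◁ v) × (v ◀ H e' (suc i') j') × v < B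
    same-column ne (p , q , r) = subst (_◁ _) (sym (off _ _ ne)) p , subst (_ ◀_) (sym (off _ _ ne)) q , r

    armOut' : ∀ i' j' v → 0 < ac' i' j' v → (H e' i' j' ◁ v) × (v ◀ H e' (suc i') j') × v < B
    armOut' i' j' v p with pos≟ ρ c i' j' | pos≟ i (suc c) i' j'
    ... | yes (refl , refl) | _ = same-column (λ ()) (armOut ρ c v (subst (0 <_) (ac-source v) (m≤n⇒m≤n+o _ p)))
    ... | no ¬p | no ¬q = same-column (λ { refl → clear _ _ ≤-refl (arm∈ p₀) }) (armOut i' j' v p₀)
      where p₀ = subst (0 <_) (ac-other i' j' v ¬p ¬q) p
    ... | no _ | yes (refl , refl) with v <? B
    ...   | no v≮B = ⊥-elim (<⇒≢ p (sym (ac-target-big v (≮⇒≥ v≮B))))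
    ...   | yes v<B with k ≟ v
    ...     | yes refl = k-low , k-high , v<B
    ...     | no ne = ⊥-elim (<⇒≢ p (sym (trans (ac-target v v<B) (one-miss ne))))

    armIn' : ∀ i' j' v → H e' i' j' ◁ v → v ◀ H e' (suc i') j' → v < B → ac' i' j' v ≡ A e' j' v
    armIn' i' j' v p q v<B with pos≟ ρ c i' j' | pos≟ i (suc c) i' j' | j' ≟ suc c
    ... | yes (refl , refl) | _ | _ = +-cancelʳ-≡ (one a v) _ _ (trans (ac-source v)
          (trans (armIn ρ c v (subst (_◁ v) (off _ _ λ ()) p) (subst (v ◀_) (off _ _ λ ()) q) v<B)
          (trans (sym (+-identityʳ _)) (trans (cong (A e c v +_) (sym (δ-miss {suc c} {k} {c} {v} λ { (() , _) })))
          (trans (sym (balance mvA c v v<B)) (cong (A e' c v +_) (δ-one c a v)))))))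
    ... | no _ | yes (refl , refl) | _ = trans (ac-target v v<B) (sym (trans (sym (+-identityʳ _)) (trans (cong (A e' (suc c) v +_) (sym (δ-miss {c} {a} {suc c} {v} λ { (() , _) })))
          (trans (balance mvA (suc c) v v<B) (trans (cong (_+ _) (¬0<⇒≡0 λ r → clear (suc c) v ≤-refl (r , v<B))) (δ-one (suc c) k v))))))
    ... | no ¬ρ | no ¬i | yes refl = trans (ac-other _ _ v ¬ρ ¬i) (trans (¬0<⇒≡0 λ r → clear _ _ ≤-refl (arm∈ r)) (sym (¬0<⇒≡0 empty)))
      where
      empty : ¬ 0 < A e' (suc c) v
      empty r with move-gain mvA v<B r
      ... | inj₁ r₀ = clear _ _ ≤-refl (r₀ , v<B)
      ... | inj₂ (_ , refl) = ¬i (arm-row-unique V' k-low k-high p q , refl)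
    ... | no ¬ρ | no ¬i | no ne = trans (ac-other _ _ v ¬ρ ¬i)
          (trans (armIn i' j' v p₀ q₀ v<B) (sym (trans (sym (+-identityʳ _)) (trans (cong (A e' j' v +_) (sym (δ-miss ¬a))) (trans (balance mvA j' v v<B)
            (trans (cong (A e j' v +_) (δ-miss λ { (refl , _) → ne refl })) (+-identityʳ _)))))))
      where
      p₀ = subst (_◁ v) (off _ _ ne) p
      q₀ = subst (v ◀_) (off _ _ ne) q
      ¬a : ¬ (c ≡ j' × a ≡ v)
      ¬a (refl , refl) with armOut _ _ _ at-ρ
      ... | p₁ , q₁ , _ = ¬ρ (arm-row-unique V p₁ q₁ p₀ q₀ , refl)

  module OfH {lc ac lc' : ℕ → ℕ → ℕ → ℕ} {e e' : Enc} {c a ρ i : ℕ} (V : Valid e) (S : HStep e c a i e') (loc : Local lc ac e) (at-ρ : 0 < ac ρ c a) where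
    open Local loc
    open HStep S renaming (at to at-target)
    open OfHStep V S hiding (ρ; i≤ρ)

    i≤ρ : i ≤ ρ
    i≤ρ with armOut _ _ _ at-ρ
    ... | p , q , _ with place in eq | OfHStep.i≤ρ V S
    ...   | ρ' , p' , q' , _ | le = subst (i ≤_) (arm-row-unique V p' q' p q) le

    Hρ◁a : H e ρ c ◁ a
    Hρ◁a = proj₁ (armOut _ _ _ at-ρ)

    -- A leg of `(i , c)` is bounded by the hook above it, which is not higher than the row of the
    -- arm and so is at most a hook `◁ a`. This is why legs change cell only if arm and target share
    -- a row.
    legs-below : ∀ {v} → i ≢ ρ → Leg e i v → H e i c ◀ v → v ◁ k → v < a
    legs-below ne v∈ p q = <-≤-trans (◀◁⇒< (leg-above V v∈ p q) (≤◁ (H-col V c (≤∧≢⇒< i≤ρ ne)) Hρ◁a)) ≤-refl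

    apart-legIn : i ≢ ρ → (∀ i' j' v → lc' i' j' v ≡ lc i' j' v) → ∀ i' j' v → H e' i' j' ◀ v → v ◁ H e' i' (suc j') → v < B → lc' i' j' v ≡ L e' i' v
    apart-legIn ne same i' j' v p q v<B = trans (same i' j' v) (trans main (sym (sameL i' v v<B)))
      where
      q₀ : v ◁ H e i' (suc j')
      q₀ = ◁≤ q (H'≤ i' (suc j'))
      main : lc i' j' v ≡ L e i' v
      main with pos≟ i (suc c) i' j'
      ... | no ¬p = legIn i' j' v (subst (_◀ v) (off i' j' ¬p) p) q₀ v<B
      ... | yes (refl , refl) with dich v k
      ...   | inj₂ k◀v = legIn i (suc c) v k◀v q₀ v<B
      -- The range gained by the target cell contains no legs of the row.
      ...   | inj₁ v◁k = trans (leg-absent λ (r , _) → excl v◁k r) (sym (¬0<⇒≡0 λ v∈ →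
                excl (<⇒◁ (legs-below ne (v∈ , v<B) (<⇒◀ (◁◀⇒< left a◀v)) v◁k)) a◀v))
        where a◀v = subst (_◀ v) at-target p

    apart-legOut : i ≢ ρ → (∀ i' j' v → lc' i' j' v ≡ lc i' j' v) → ∀ i' j' v → 0 < lc' i' j' v → (H e' i' j' ◀ v) × (v ◁ H e' i' (suc j')) × v < B
    apart-legOut ne same i' j' v p with subst (0 <_) (same i' j' v) p
    ... | p₀ with legOut i' j' v p₀
    ...   | q , r , s = ≤◀ (H'≤ i' j') q , r' , s
      where
      r' : v ◁ H e' i' (suc j')
      r' with pos≟ i (suc c) i' (suc j')
      ... | no ¬p = subst (v ◁_) (sym (off _ _ ¬p)) r
      ... | yes (refl , refl) = subst (v ◁_) (sym at-target) (<⇒◁ (legs-below ne (leg∈ p₀) q r))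

    module Same (i≡ρ : i ≡ ρ)
                (keep : ∀ v → v ◁ a → lc' i c v ≡ lc i c v) (drop : ∀ v → a ◀ v → lc' i c v ≡ 0)
                (low : ∀ v → v ◁ a → lc' i (suc c) v ≡ lc i (suc c) v) (high : ∀ v → a ◀ v → lc' i (suc c) v ≡ lc i (suc c) v + lc i c v)
                (other : ∀ i' j' v → ¬ (i ≡ i' × c ≡ j') → ¬ (i ≡ i' × suc c ≡ j') → lc' i' j' v ≡ lc i' j' v) where

      legIn' : ∀ i' j' v → H e' i' j' ◀ v → v ◁ H e' i' (suc j') → v < B → lc' i' j' v ≡ L e' i' v
      legIn' i' j' v p q v<B with pos≟ i c i' j' | pos≟ i (suc c) i' j'
      ... | yes (refl , refl) | _ = trans (keep v v◁a) (trans (legIn i c v (subst (_◀ v) (off _ _ λ ()) p) (◁≤ v◁a a≤k) v<B) (sym (sameL i v v<B)))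
        where v◁a = subst (v ◁_) at-target q
      ... | no ¬p | no ¬q = trans (other _ _ v ¬p ¬q) (trans (legIn i' j' v (subst (_◀ v) (off _ _ ¬q) p)
              (subst (v ◁_) (off _ _ λ { (eq , refl) → ¬p (eq , refl) }) q) v<B) (sym (sameL i' v v<B)))
      ... | no _ | yes (refl , refl) = trans (high v a◀v) (trans main (sym (sameL i v v<B)))
        where
        a◀v = subst (_◀ v) at-target p
        q₀ : v ◁ H e i (suc (suc c))
        q₀ = subst (v ◁_) (off _ _ λ { (_ , ()) }) q
        -- The new range of the target is cut at the old hook `k`: beyond it lie former legs of the
        -- target, before it legs of the source cell.
        main : lc i (suc c) v + lc i c v ≡ L e i v
        main with dich v k
        ... | inj₂ k◀v = trans (cong (lc i (suc c) v +_) (leg-absent λ (_ , r) → excl r k◀v)) (trans (+-identityʳ _) (legIn i (suc c) v k◀v q₀ v<B))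
        ... | inj₁ v◁k = trans (cong (_+ lc i c v) (leg-absent λ (r , _) → excl v◁k r)) (legIn i c v (<⇒◀ (◁◀⇒< left a◀v)) v◁k v<B)

      legOut' : ∀ i' j' v → 0 < lc' i' j' v → (H e' i' j' ◀ v) × (v ◁ H e' i' (suc j')) × v < B
      legOut' i' j' v p with pos≟ i c i' j' | pos≟ i (suc c) i' j'
      legOut' i' j' v p | no ¬p | no ¬q with legOut i' j' v (subst (0 <_) (other _ _ v ¬p ¬q) p)
      ... | q , r , s = subst (_◀ v) (sym (off _ _ ¬q)) q , subst (v ◁_) (sym (off _ _ λ { (eq , refl) → ¬p (eq , refl) })) r , s
      legOut' i' j' v p | yes (refl , refl) | _ with dich v a
      ... | inj₂ a◀v = ⊥-elim (<⇒≢ p (sym (drop v a◀v)))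
      ... | inj₁ v◁a with legOut i c v (subst (0 <_) (keep v v◁a) p)
      ...   | q , r , s = subst (_◀ v) (sym (off _ _ λ ())) q , subst (v ◁_) (sym at-target) v◁a , s
      legOut' i' j' v p | no _ | yes (refl , refl) = target
        where
        from-target : 0 < lc i (suc c) v → (H e' i (suc c) ◀ v) × (v ◁ H e' i (suc (suc c))) × v < B
        from-target p₀ with legOut i (suc c) v p₀
        ... | q , r , s = ≤◀ (H'≤ i (suc c)) q , subst (v ◁_) (sym (off _ _ λ { (_ , ()) })) r , s
        target : (H e' i (suc c) ◀ v) × (v ◁ H e' i (suc (suc c))) × v < B
        target with dich v a
        ... | inj₁ v◁a = from-target (subst (0 <_) (low v v◁a) p)
        ... | inj₂ a◀v with 0 <? lc i (suc c) v
        ...   | yes p₀ = from-target p₀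
        ...   | no ¬p₀ with legOut i c v (subst (0 <_) (trans (high v a◀v) (cong (_+ lc i c v) (¬0<⇒≡0 ¬p₀))) p)
        ...     | q , r , s = subst (_◀ v) (sym at-target) a◀v , subst (v ◁_) (sym (off _ _ λ { (_ , ()) })) (◁≤ r (H-row V i (n≤1+n _))) , s

  module OfG {lc ac lc' : ℕ → ℕ → ℕ → ℕ} {e e' : Enc} {c a i k : ℕ} (V : Valid e) (S : GStep e c a i k e') (loc : Local lc ac e)
             (target : ∀ v → lc' i (suc c) v + one k v ≡ lc i (suc c) v + one a v)
             (other : ∀ i' j' v → ¬ (i ≡ i' × suc c ≡ j') → lc' i' j' v ≡ lc i' j' v) where
    open Local loc
    open GStep S renaming (leg∈ to k∈)
    open OfGStep V S

    legIn' : ∀ i' j' v → H e' i' j' ◀ v → v ◁ H e' i' (suc j') → v < B → lc' i' j' v ≡ L e' i' v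
    legIn' i' j' v p q v<B with subst (_◀ v) (sameH i' j') p | subst (v ◁_) (sameH i' (suc j')) q | pos≟ i (suc c) i' j'
    ... | p₀ | q₀ | yes (refl , refl) = +-cancelʳ-≡ (one k v) _ _ (trans (target v) (trans (cong (_+ one a v) (legIn i (suc c) v p₀ q₀ v<B))
          (trans (cong (L e i v +_) (sym (δ-one i a v))) (trans (sym (balance mvL i v v<B)) (cong (L e' i v +_) (δ-one i k v))))))
    ... | p₀ | q₀ | no ¬p = trans (other i' j' v ¬p) (trans (legIn i' j' v p₀ q₀ v<B) (sym (trans (sym (+-identityʳ _))
          (trans (cong (L e' i' v +_) (sym (δ-miss ¬k))) (trans (balance mvL i' v v<B) (trans (cong (L e i' v +_) (δ-miss ¬a)) (+-identityʳ _)))))))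
      where
      ¬k : ¬ (i ≡ i' × k ≡ v)
      ¬k (refl , refl) = ¬p (refl , leg-col-unique V (◀≤ under a≤k) right p₀ q₀)
      ¬a : ¬ (i ≡ i' × a ≡ v)
      ¬a (refl , refl) = ¬p (refl , leg-col-unique V under (≤◁ a≤k right) p₀ q₀)

    legOut' : ∀ i' j' v → 0 < lc' i' j' v → (H e' i' j' ◀ v) × (v ◁ H e' i' (suc j')) × v < B
    legOut' i' j' v p with pos≟ i (suc c) i' j'
    ... | no ¬p = case legOut i' j' v (subst (0 <_) (other i' j' v ¬p) p) of λ
          (q , r , s) → subst (_◀ v) (sym (sameH _ _)) q , subst (v ◁_) (sym (sameH _ _)) r , s
    ... | yes (refl , refl) with a ≟ v
    ...   | yes refl = subst (_◀ a) (sym (sameH _ _)) under , subst (a ◁_) (sym (sameH _ _)) (≤◁ a≤k right) , proj₂ (Particle.arm∈ part)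
    ...   | no ne = case legOut i (suc c) v (subst (0 <_) (trans (target v) (trans (cong (lc i (suc c) v +_) (one-miss ne)) (+-identityʳ _))) (m≤n⇒m≤n+o _ p)) of λ
          (q , r , s) → subst (_◀ v) (sym (sameH _ _)) q , subst (v ◁_) (sym (sameH _ _)) r , s

-- Sorted lists as multisets

Sorted : List ℕ → Set
Sorted = AllPairs _≤_

occ-All : ∀ {P : ℕ → Set} {v} xs → All P xs → 0 < occ v xs → P v
occ-All {v = v} (x ∷ xs) (px ∷ pxs) p with x ≟ v
... | yes refl = px
... | no ne = occ-All xs pxs p

occ-head : ∀ x xs → 0 < occ x (x ∷ xs)
occ-head x xs = subst (λ z → 0 < z + occ x xs) (sym (one-hit x)) (s≤s z≤n)

occ-nonempty : ∀ {v xs} → 0 < occ v xs → xs ≢ []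
occ-nonempty p refl = case p of λ ()

occ-empty : ∀ xs → (∀ v → ¬ 0 < occ v xs) → xs ≡ []
occ-empty [] _ = refl
occ-empty (x ∷ xs) none = ⊥-elim (none x (occ-head x xs))

-- Each head occurs in the other list and is therefore bounded below by the other head.
sorted-ext : ∀ {xs ys} → Sorted xs → Sorted ys → (∀ v → occ v xs ≡ occ v ys) → xs ≡ ys
sorted-ext {[]} {[]} _ _ _ = refl
sorted-ext {[]} {y ∷ ys} _ _ eq = ⊥-elim (<⇒≢ (occ-head y ys) (eq y))
sorted-ext {x ∷ xs} {[]} _ _ eq = ⊥-elim (<⇒≢ (occ-head x xs) (sym (eq x)))
sorted-ext {x ∷ xs} {y ∷ ys} (x≤ ∷ sx) (y≤ ∷ sy) eq
  with ≤-antisym (occ-All (x ∷ xs) (≤-refl ∷ x≤) (subst (0 <_) (sym (eq y)) (occ-head y ys))) (occ-All (y ∷ ys) (≤-refl ∷ y≤) (subst (0 <_) (eq x) (occ-head x xs)))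
... | refl = cong (x ∷_) (sorted-ext sx sy λ v → +-cancelˡ-≡ (one x v) _ _ (eq v))

occ-ins : ∀ k xs v → occ v (ins k xs) ≡ one k v + occ v xs
occ-ins k [] v = refl
occ-ins k (x ∷ xs) v with k ≤ᵇ x
... | true = refl
... | false = trans (cong (one x v +_) (occ-ins k xs v))
  (trans (sym (+-assoc (one x v) _ _)) (trans (cong (_+ occ v xs) (+-comm (one x v) (one k v))) (+-assoc (one k v) _ _)))

All-ins : ∀ {P : ℕ → Set} k xs → P k → All P xs → All P (ins k xs)
All-ins k [] pk [] = pk ∷ []
All-ins k (x ∷ xs) pk (px ∷ pxs) with k ≤ᵇ x
... | true = pk ∷ px ∷ pxs
... | false = px ∷ All-ins k xs pk pxs

sorted-ins : ∀ k {xs} → Sorted xs → Sorted (ins k xs)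
sorted-ins k [] = [] ∷ []
sorted-ins k {x ∷ xs} (x≤ ∷ s) with k ≤ᵇ x in eq
... | true = (k≤x ∷ All.map (≤-trans k≤x) x≤) ∷ x≤ ∷ s
  where k≤x = ≤ᵇ⇒≤ k x (subst T (sym eq) tt)
... | false = All-ins k xs (<⇒≤ (≰⇒> λ k≤x → case trans (sym eq) (≤⇒≤ᵇ≡ k≤x) of λ ())) x≤ ∷ sorted-ins k s

occ-insAll : ∀ ks xs v → occ v (insAll ks xs) ≡ occ v ks + occ v xs
occ-insAll [] xs v = refl
occ-insAll (k ∷ ks) xs v = trans (occ-ins k (insAll ks xs) v) (trans (cong (one k v +_) (occ-insAll ks xs v)) (sym (+-assoc (one k v) _ _)))

sorted-insAll : ∀ ks {xs} → Sorted xs → Sorted (insAll ks xs)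
sorted-insAll [] s = s
sorted-insAll (k ∷ ks) s = sorted-ins k (sorted-insAll ks s)

occ-remove : ∀ k xs v → 0 < occ k xs → occ v (removeOne k xs) + one k v ≡ occ v xs
occ-remove k (x ∷ xs) v p with k ≡ᵇ x in eq
... | true = trans (+-comm (occ v xs) (one k v)) (cong (λ z → one z v + occ v xs) (≡ᵇ≡⇒≡ eq))
... | false = trans (+-assoc (one x v) _ _) (cong (one x v +_) (occ-remove k xs v (subst (λ z → 0 < z + occ k xs) (one-miss x≢k) p)))
  where
  x≢k : x ≢ k
  x≢k refl = case trans (sym eq) (n≡ᵇn x) of λ ()

All-remove : ∀ {P : ℕ → Set} k {xs} → All P xs → All P (removeOne k xs)
All-remove k [] = []
All-remove k {x ∷ xs} (px ∷ pxs) with k ≡ᵇ x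
... | true = pxs
... | false = px ∷ All-remove k pxs

sorted-remove : ∀ k {xs} → Sorted xs → Sorted (removeOne k xs)
sorted-remove k [] = []
sorted-remove k {x ∷ xs} (x≤ ∷ s) with k ≡ᵇ x
... | true = s
... | false = All-remove k x≤ ∷ sorted-remove k s

occ-filter-true : ∀ p xs {v} → p v ≡ true → occ v (filterB p xs) ≡ occ v xs
occ-filter-true p [] pv = refl
occ-filter-true p (x ∷ xs) {v} pv with p x in eq
... | true = cong (one x v +_) (occ-filter-true p xs pv)
... | false = trans (occ-filter-true p xs pv) (sym (cong (_+ occ v xs) (one-miss λ { refl → case trans (sym eq) pv of λ () })))

occ-filter-false : ∀ p xs {v} → p v ≡ false → occ v (filterB p xs) ≡ 0
occ-filter-false p [] pv = refl
occ-filter-false p (x ∷ xs) {v} pv with p x in eq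
... | true = cong₂ _+_ (one-miss λ { refl → case trans (sym eq) pv of λ () }) (occ-filter-false p xs pv)
... | false = occ-filter-false p xs pv

All-filter : ∀ {P : ℕ → Set} p {xs} → All P xs → All P (filterB p xs)
All-filter p [] = []
All-filter p {x ∷ xs} (px ∷ pxs) with p x
... | true = px ∷ All-filter p pxs
... | false = All-filter p pxs

sorted-filter : ∀ p {xs} → Sorted xs → Sorted (filterB p xs)
sorted-filter p [] = []
sorted-filter p {x ∷ xs} (x≤ ∷ s) with p x
... | true = All-filter p x≤ ∷ sorted-filter p s
... | false = sorted-filter p s

elemB-occ : ∀ {k} xs → 0 < occ k xs → elemB k xs ≡ true
elemB-occ {k} (x ∷ xs) p with k ≡ᵇ x in eq
... | true = refl
... | false = elemB-occ xs (subst (λ z → 0 < z + occ k xs) (one-miss λ { refl → case trans (sym eq) (n≡ᵇn x) of λ () }) p)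

maxList-≤ : ∀ {v} xs → 0 < occ v xs → v ≤ maxList xs
maxList-≤ {v} (x ∷ xs) p with x ≟ v
... | yes refl = m≤m⊔n x _
... | no ne = ≤-trans (maxList-≤ xs p) (m≤n⊔m x _)

occ-max : ∀ {xs} → xs ≢ [] → 0 < occ (maxList xs) xs
occ-max {[]} ne = ⊥-elim (ne refl)
occ-max {x ∷ xs} _ = go x xs
  where
  go : ∀ x xs → 0 < occ (x ⊔ maxList xs) (x ∷ xs)
  go x [] = subst (λ z → 0 < occ z (x ∷ [])) (sym (⊔-identityʳ x)) (occ-head x [])
  go x (y ∷ xs) with ⊔-sel x (y ⊔ maxList xs)
  ... | inj₁ eq = subst (λ z → 0 < occ z (x ∷ y ∷ xs)) (sym eq) (occ-head x (y ∷ xs))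
  ... | inj₂ eq = subst (λ z → 0 < occ z (x ∷ y ∷ xs)) (sym eq) (m≤n⇒m≤o+n (one x (y ⊔ maxList xs)) (go y xs))

occ-++ : ∀ xs ys v → occ v (xs ++ ys) ≡ occ v xs + occ v ys
occ-++ [] ys v = refl
occ-++ (x ∷ xs) ys v = trans (cong (one x v +_) (occ-++ xs ys v)) (sym (+-assoc (one x v) _ _))

-- With the projections as parameters, the transposed development exchanges legs and arms without
-- changing the cell.
EntryOf : (lg ar : Cell → List ℕ) → Cell → ℕ → Set
EntryOf lg ar x v = hook x ≡ v ⊎ 0 < occ v (lg x) ⊎ 0 < occ v (ar x)

entry-cases : ∀ x {v} → 0 < occ v (entries x) → EntryOf legs arms x v
entry-cases x {v} p with hook x ≟ v
... | yes eq = inj₁ eq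
... | no ne with subst (0 <_) (occ-++ (legs x) (arms x) v) p | 0 <? occ v (legs x)
...   | _ | yes q = inj₂ (inj₁ q)
...   | p' | no ¬q = inj₂ (inj₂ (subst (λ z → 0 < z + occ v (arms x)) (¬0<⇒≡0 ¬q) p'))

entry-occ : ∀ x {v} → EntryOf legs arms x v → 0 < occ v (entries x)
entry-occ x (inj₁ refl) = occ-head (hook x) (legs x ++ arms x)
entry-occ x {v} (inj₂ (inj₁ p)) = m≤n⇒m≤o+n (one (hook x) v) (subst (0 <_) (sym (occ-++ (legs x) (arms x) v)) (m≤n⇒m≤n+o _ p))
entry-occ x {v} (inj₂ (inj₂ p)) = m≤n⇒m≤o+n (one (hook x) v) (subst (0 <_) (sym (occ-++ (legs x) (arms x) v)) (m≤n⇒m≤o+n (occ v (legs x)) p))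

-- The searches for the moving and the bumped entry

Best : Set
Best = Maybe (ℕ × ℕ × ℕ × Cell)

-- The step functions of the searches are local and cannot be named. Their bodies are recovered by
-- unification from the `refl` of the accompanying equation, here and in the two similar blocks that
-- follow.
mutual
  armStep : Tableau → Best → ℕ × ℕ × Cell → Best
  armStep T b z = _
  findArm-fold : ∀ T → findArm T ≡ foldl (armStep T) nothing (cellsOf T)
  findArm-fold T = refl

mutual
  legStep : Tableau → Best → ℕ × ℕ × Cell → Best
  legStep T b z = _
  findLeg-fold : ∀ T → findLeg T ≡ foldl (legStep T) nothing (cellsOf T)
  findLeg-fold T = refl

mutual
  minStep : (ℕ → ℕ → Bool) → (ℕ → Bool) → Tableau → Maybe (ℕ × ℕ × ℕ) → ℕ × ℕ × Cell → Maybe (ℕ × ℕ × ℕ)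
  minStep q p T b z = _
  findMin-fold : ∀ q p T → findMin q p T ≡ foldl (minStep q p T) nothing (cellsOf T)
  findMin-fold q p T = refl

-- Both searches at once: `key` is the column for arms and the row for legs.
module _ (sel : Cell → List ℕ) (key : ℕ → ℕ → ℕ) where

  Picked : (ℕ → ℕ → Cell → Set) → Best → Set
  Picked P nothing = ∀ i j x → P i j x → sel x ≡ []
  Picked P (just (i , j , a , x)) = P i j x × sel x ≢ [] × a ≡ maxList (sel x) ×
    (∀ i' j' x' → P i' j' x' → sel x' ≢ [] → key i' j' < key i j ⊎ (key i' j' ≡ key i j × maxList (sel x') ≤ a))

  record PickStep (s : Best → ℕ × ℕ × Cell → Best) : Set where
    field
      skip  : ∀ b i j x → sel x ≡ [] → s b (i , j , x) ≡ b
      first : ∀ i j x → sel x ≢ [] → s nothing (i , j , x) ≡ just (i , j , maxList (sel x) , x)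
      other : ∀ i' j' a' x' i j x → sel x ≢ [] → s (just (i' , j' , a' , x')) (i , j , x) ≡
              (if (key i' j' <ᵇ key i j) ∨ ((key i' j' ≡ᵇ key i j) ∧ (a' <ᵇ maxList (sel x)))
               then just (i , j , maxList (sel x) , x) else just (i' , j' , a' , x'))

  picks : ∀ {s} → PickStep s → ∀ xs → Picked (λ i j x → (i , j , x) ∈ xs) (foldl s nothing xs)
  picks {s} st xs = foldl-rule (λ pre → Picked (λ i j x → (i , j , x) ∈ pre)) s nothing xs (λ _ _ _ ()) λ pre x _ b _ → step pre x b
    where
    open PickStep st
    step : ∀ pre x b → Picked (λ i j x → (i , j , x) ∈ pre) b → Picked (λ i j y → (i , j , y) ∈ pre ++ x ∷ []) (s b x)
    step pre (i , j , x) b pk with empty? (sel x)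
      where
      empty? : (xs : List ℕ) → Dec (xs ≡ [])
      empty? [] = yes refl
      empty? (_ ∷ _) = no λ ()
    step pre (i , j , x) nothing pk | yes eq rewrite skip nothing i j x eq = λ i' j' x' p → case ∈-snoc⁻ p of λ
      { (inj₁ q) → pk i' j' x' q ; (inj₂ refl) → eq }
    step pre (i , j , x) (just (i₀ , j₀ , a₀ , x₀)) (p₀ , ne , eq₀ , top) | yes eq rewrite skip (just (i₀ , j₀ , a₀ , x₀)) i j x eq =
      ∈-++⁺ˡ p₀ , ne , eq₀ , λ i' j' x' p ne' → case ∈-snoc⁻ p of λ { (inj₁ q) → top i' j' x' q ne' ; (inj₂ refl) → ⊥-elim (ne' eq) }
    step pre (i , j , x) nothing pk | no ne rewrite first i j x ne = ∈-++⁺ʳ pre (here refl) , ne , refl , λ i' j' x' p ne' → case ∈-snoc⁻ p of λ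
      { (inj₁ q) → ⊥-elim (ne' (pk i' j' x' q)) ; (inj₂ refl) → inj₂ (refl , ≤-refl) }
    step pre (i , j , x) (just (i₀ , j₀ , a₀ , x₀)) (p₀ , ne₀ , refl , top) | no ne rewrite other i₀ j₀ (maxList (sel x₀)) x₀ i j x ne
      with <-cmp (key i₀ j₀) (key i j) | maxList (sel x₀) <? maxList (sel x)
    ... | tri< lt _ _ | _ rewrite <⇒<ᵇ≡ lt = ∈-++⁺ʳ pre (here refl) , ne , refl , λ i' j' x' p ne' → case ∈-snoc⁻ p of λ
      { (inj₁ q) → inj₁ (case top i' j' x' q ne' of λ { (inj₁ lt') → <-trans lt' lt ; (inj₂ (eq , _)) → subst (_< key i j) (sym eq) lt })
      ; (inj₂ refl) → inj₂ (refl , ≤-refl) }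
    ... | tri≈ ¬lt eq _ | yes lt rewrite ≮⇒<ᵇ≡ ¬lt | eq | n≡ᵇn (key i j) | <⇒<ᵇ≡ lt = ∈-++⁺ʳ pre (here refl) , ne , refl , λ i' j' x' p ne' → case ∈-snoc⁻ p of λ
      { (inj₁ q) → Sum.map₂ (λ (e , le) → e , ≤-trans le (<⇒≤ lt)) (top i' j' x' q ne') ; (inj₂ refl) → inj₂ (refl , ≤-refl) }
    ... | tri≈ ¬lt eq _ | no ¬lt' rewrite ≮⇒<ᵇ≡ ¬lt | ≮⇒<ᵇ≡ ¬lt' | ∧-zeroʳ (key i₀ j₀ ≡ᵇ key i j) = ∈-++⁺ˡ p₀ , ne₀ , refl , λ i' j' x' p ne' → case ∈-snoc⁻ p of λ
      { (inj₁ q) → top i' j' x' q ne' ; (inj₂ refl) → inj₂ (sym eq , ≮⇒≥ ¬lt') }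
    ... | tri> ¬lt ¬eq gt | _ rewrite ≮⇒<ᵇ≡ ¬lt | ≢⇒≡ᵇ ¬eq = ∈-++⁺ˡ p₀ , ne₀ , refl , λ i' j' x' p ne' → case ∈-snoc⁻ p of λ
      { (inj₁ q) → top i' j' x' q ne' ; (inj₂ refl) → inj₁ gt }

  picked-at : ∀ T b → Picked (λ i j x → (i , j , x) ∈ cellsOf T) b → Picked (λ i j x → at T i j ≡ just x) b
  picked-at T nothing pk i j x eq = pk i j x (∈-cellsOf⁺ T eq)
  picked-at T (just (i , j , a , x)) (p , ne , eq , top) = ∈-cellsOf⁻ {i = i} {j} T p , ne , eq , λ i' j' x' q → top i' j' x' (∈-cellsOf⁺ T q)

findArm-picks : ∀ T → Picked arms (λ i j → j) (λ i j x → at T i j ≡ just x) (findArm T)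
findArm-picks T = picked-at arms _ T _ (picks arms _ {armStep T} record { skip = skip ; first = first ; other = other } (cellsOf T))
  where
  skip : ∀ b i j x → arms x ≡ [] → armStep T b (i , j , x) ≡ b
  skip b i j (cell h ls []) refl = refl
  first : ∀ i j x → arms x ≢ [] → armStep T nothing (i , j , x) ≡ just (i , j , maxList (arms x) , x)
  first i j (cell h ls []) ne = ⊥-elim (ne refl)
  first i j (cell h ls (a ∷ as)) ne = refl
  other : ∀ i' j' a' x' i j x → arms x ≢ [] → armStep T (just (i' , j' , a' , x')) (i , j , x) ≡
          (if (j' <ᵇ j) ∨ ((j' ≡ᵇ j) ∧ (a' <ᵇ maxList (arms x))) then just (i , j , maxList (arms x) , x) else just (i' , j' , a' , x'))
  other i' j' a' x' i j (cell h ls []) ne = ⊥-elim (ne refl)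
  other i' j' a' x' i j (cell h ls (a ∷ as)) ne = refl

findLeg-picks : ∀ T → Picked legs (λ i j → i) (λ i j x → at T i j ≡ just x) (findLeg T)
findLeg-picks T = picked-at legs _ T _ (picks legs _ {legStep T} record { skip = skip ; first = first ; other = other } (cellsOf T))
  where
  skip : ∀ b i j x → legs x ≡ [] → legStep T b (i , j , x) ≡ b
  skip b i j (cell h [] as) refl = refl
  first : ∀ i j x → legs x ≢ [] → legStep T nothing (i , j , x) ≡ just (i , j , maxList (legs x) , x)
  first i j (cell h [] as) ne = ⊥-elim (ne refl)
  first i j (cell h (l ∷ ls) as) ne = refl
  other : ∀ i' j' a' x' i j x → legs x ≢ [] → legStep T (just (i' , j' , a' , x')) (i , j , x) ≡
          (if (i' <ᵇ i) ∨ ((i' ≡ᵇ i) ∧ (a' <ᵇ maxList (legs x))) then just (i , j , maxList (legs x) , x) else just (i' , j' , a' , x'))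
  other i' j' a' x' i j (cell h [] as) ne = ⊥-elim (ne refl)
  other i' j' a' x' i j (cell h (l ∷ ls) as) ne = refl

MinSpec : (ℕ → Bool) → List ℕ → Maybe ℕ → Set
MinSpec p xs nothing = ∀ v → 0 < occ v xs → p v ≡ false
MinSpec p xs (just k) = 0 < occ k xs × p k ≡ true × (∀ v → 0 < occ v xs → p v ≡ true → k ≤ v)

minWith-spec : ∀ p xs → MinSpec p xs (minWith p xs)
minWith-spec p [] v ()
minWith-spec p (x ∷ xs) with minWith p xs | minWith-spec p xs
... | nothing | none with p x in eq
...   | true = occ-head x xs , eq , λ v q pv → case x ≟ v of λ
        { (yes refl) → ≤-refl ; (no ne) → case trans (sym (none v (subst (λ z → 0 < z + occ v xs) (one-miss ne) q))) pv of λ () }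
...   | false = λ v q → case x ≟ v of λ { (yes refl) → eq ; (no ne) → none v (subst (λ z → 0 < z + occ v xs) (one-miss ne) q) }
minWith-spec p (x ∷ xs) | just y | y∈ , py , least' with p x in eq | x <? y
... | false | _ = m≤n⇒m≤o+n (one x y) y∈ , py , λ v q pv → case x ≟ v of λ
      { (yes refl) → case trans (sym eq) pv of λ () ; (no ne) → least' v (subst (λ z → 0 < z + occ v xs) (one-miss ne) q) pv }
... | true | yes lt rewrite <⇒<ᵇ≡ lt = occ-head x xs , eq , λ v q pv → case x ≟ v of λ
      { (yes refl) → ≤-refl ; (no ne) → ≤-trans (<⇒≤ lt) (least' v (subst (λ z → 0 < z + occ v xs) (one-miss ne) q) pv) }
... | true | no ¬lt rewrite ≮⇒<ᵇ≡ ¬lt = m≤n⇒m≤o+n (one x y) y∈ , py , λ v q pv → case x ≟ v of λ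
      { (yes refl) → ≮⇒≥ ¬lt ; (no ne) → least' v (subst (λ z → 0 < z + occ v xs) (one-miss ne) q) pv }

-- The final conjunct records that the first cell wins a tie. This matters for leg bumping, where
-- rows increase only weakly and the leftmost copy is the one that the encoded step bumps.
Smallest : (ℕ → ℕ → Bool) → (ℕ → Bool) → (ℕ → ℕ → Cell → Set) → Maybe (ℕ × ℕ × ℕ) → Set
Smallest q p P nothing = ∀ i j x → P i j x → q i j ≡ true → ∀ v → 0 < occ v (entries x) → p v ≡ false
Smallest q p P (just (i , j , k)) = (Σ Cell λ x → P i j x × 0 < occ k (entries x)) × q i j ≡ true × p k ≡ true ×
  (∀ i' j' x' → P i' j' x' → q i' j' ≡ true → ∀ v → 0 < occ v (entries x') → p v ≡ true →
     k ≤ v × ((i' < i ⊎ (i' ≡ i × j' < j)) → k < v))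

findMin-smallest : ∀ q p T → Smallest q p (λ i j x → at T i j ≡ just x) (findMin q p T)
findMin-smallest q p T = to-at (findMin q p T) (foldl-rule (λ pre → Smallest q p (λ i j x → (i , j , x) ∈ pre)) (minStep q p T) nothing (cellsOf T)
    (λ _ _ _ ()) λ pre x post b eq → step pre x b (ordered T eq))
  where
  to-at : ∀ b → Smallest q p (λ i j x → (i , j , x) ∈ cellsOf T) b → Smallest q p (λ i j x → at T i j ≡ just x) b
  to-at nothing sm i j x eq = sm i j x (∈-cellsOf⁺ T eq)
  to-at (just (i , j , k)) ((x , p , k∈) , qij , pk , le) = (x , ∈-cellsOf⁻ {i = i} {j} T p , k∈) , qij , pk , λ i' j' x' eq → le i' j' x' (∈-cellsOf⁺ T eq)
  absurd : ∀ {b} → b ≡ false → b ≡ true → ⊥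
  absurd refl ()
  step : ∀ pre x b → (∀ {z} → z ∈ pre → Before z x) → Smallest q p (λ i j x → (i , j , x) ∈ pre) b → Smallest q p (λ i j y → (i , j , y) ∈ pre ++ x ∷ []) (minStep q p T b x)
  step pre (i , j , x) b before sm with q i j in qeq | minWith p (entries x) | minWith-spec p (entries x)
  step pre (i , j , x) nothing before sm | false | _ | _ = λ i' j' x' z∈ q' → case ∈-snoc⁻ z∈ of λ
    { (inj₁ z∈') → sm i' j' x' z∈' q' ; (inj₂ refl) → ⊥-elim (absurd qeq q') }
  step pre (i , j , x) (just (i₀ , j₀ , k₀)) before ((x₀ , p₀ , k∈) , q₀ , pk , le) | false | _ | _ =
    (x₀ , ∈-++⁺ˡ p₀ , k∈) , q₀ , pk , λ i' j' x' z∈ q' → case ∈-snoc⁻ z∈ of λ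
      { (inj₁ z∈') → le i' j' x' z∈' q' ; (inj₂ refl) → ⊥-elim (absurd qeq q') }
  step pre (i , j , x) nothing before sm | true | nothing | none = λ i' j' x' z∈ q' → case ∈-snoc⁻ z∈ of λ
    { (inj₁ z∈') → sm i' j' x' z∈' q' ; (inj₂ refl) → none }
  step pre (i , j , x) (just (i₀ , j₀ , k₀)) before ((x₀ , p₀ , k∈) , q₀ , pk , le) | true | nothing | none =
    (x₀ , ∈-++⁺ˡ p₀ , k∈) , q₀ , pk , λ i' j' x' z∈ q' v v∈ pv → case ∈-snoc⁻ z∈ of λ
      { (inj₁ z∈') → le i' j' x' z∈' q' v v∈ pv ; (inj₂ refl) → ⊥-elim (absurd (none v v∈) pv) }
  step pre (i , j , x) nothing before sm | true | just k | k∈ , pk , least' =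
    (x , ∈-++⁺ʳ pre (here refl) , k∈) , qeq , pk , λ i' j' x' z∈ q' v v∈ pv → case ∈-snoc⁻ z∈ of λ
      { (inj₁ z∈') → ⊥-elim (absurd (sm i' j' x' z∈' q' v v∈) pv)
      ; (inj₂ refl) → least' v v∈ pv , λ { (inj₁ lt) → ⊥-elim (<-irrefl refl lt) ; (inj₂ (_ , lt)) → ⊥-elim (<-irrefl refl lt) } }
  step pre (i , j , x) (just (i₀ , j₀ , k₀)) before ((x₀ , p₀ , k₀∈) , q₀ , pk₀ , le) | true | just k | k∈ , pk , least' with k <? k₀
  ... | yes lt rewrite <⇒<ᵇ≡ lt = (x , ∈-++⁺ʳ pre (here refl) , k∈) , qeq , pk , λ i' j' x' z∈ q' v v∈ pv → case ∈-snoc⁻ z∈ of λ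
      { (inj₁ z∈') → <⇒≤ (<-≤-trans lt (proj₁ (le i' j' x' z∈' q' v v∈ pv))) , λ _ → <-≤-trans lt (proj₁ (le i' j' x' z∈' q' v v∈ pv))
      ; (inj₂ refl) → least' v v∈ pv , λ { (inj₁ lt) → ⊥-elim (<-irrefl refl lt) ; (inj₂ (_ , lt)) → ⊥-elim (<-irrefl refl lt) } }
  ... | no ¬lt rewrite ≮⇒<ᵇ≡ ¬lt = (x₀ , ∈-++⁺ˡ p₀ , k₀∈) , q₀ , pk₀ , λ i' j' x' z∈ q' v v∈ pv → case ∈-snoc⁻ z∈ of λ
      { (inj₁ z∈') → le i' j' x' z∈' q' v v∈ pv
      ; (inj₂ refl) → ≤-trans (≮⇒≥ ¬lt) (least' v v∈ pv) , λ b → ⊥-elim (not-before (before p₀) b) }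
    where
    not-before : ∀ {i j i' j'} → i < i' ⊎ (i ≡ i' × j < j') → i' < i ⊎ (i' ≡ i × j' < j) → ⊥
    not-before (inj₁ lt) (inj₁ lt') = <-asym lt lt'
    not-before (inj₁ lt) (inj₂ (refl , _)) = <-irrefl refl lt
    not-before (inj₂ (refl , _)) (inj₁ lt') = <-irrefl refl lt'
    not-before (inj₂ (refl , lt)) (inj₂ (_ , lt')) = <-asym lt lt'

-- Tableaux representing an encoding

module Representation (B : ℕ) (_◁_ _◀_ : ℕ → ℕ → Set) (orders : Orders _◁_ _◀_) (lg ar : Cell → List ℕ) where
  open Bounded B
  open Half B _◁_ _◀_ orders
  open Growth B _◁_ _◀_ orders
  open Orders orders
  open Localisation B _◁_ _◀_ orders

  Cells : Set
  Cells = ℕ → ℕ → Maybe Cell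

  num : (Cell → List ℕ) → Cells → ℕ → ℕ → ℕ → ℕ
  num sel C i j v = Maybe.maybe′ (λ x → occ v (sel x)) 0 (C i j)

  num-just : ∀ sel C {i j x} v → C i j ≡ just x → num sel C i j v ≡ occ v (sel x)
  num-just sel C v eq rewrite eq = refl

  num-cong : ∀ sel C C' {i j} v → C' i j ≡ C i j → num sel C' i j v ≡ num sel C i j v
  num-cong sel C C' v eq rewrite eq = refl

  record Rep (C : Cells) (e : Enc) : Set where
    field
      hooks  : ∀ i j x → C i j ≡ just x → hook x ≡ H e i j × H e i j < B
      absent : ∀ i j → C i j ≡ nothing → B ≤ H e i j
      sorted : ∀ i j x → C i j ≡ just x → Sorted (lg x) × Sorted (ar x)
      local  : Local (num lg C) (num ar C) e

    open Local local public

    present : ∀ i j → H e i j < B → Σ Cell λ x → C i j ≡ just x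
    present i j fin with C i j in eq
    ... | just x = x , refl
    ... | nothing = ⊥-elim (<⇒≱ fin (absent i j eq))

    cell-arm : ∀ {i j x v} → C i j ≡ just x → 0 < occ v (ar x) → Arm e j v
    cell-arm {v = v} eq p = arm∈ (subst (0 <_) (sym (num-just ar C v eq)) p)

    find-arm : ∀ {j v} → Valid e → Arm e j v → Σ ℕ λ i → Σ Cell λ x → C i j ≡ just x × 0 < occ v (ar x)
    find-arm {j} {v} V (p , v<B) with Valid.arm V j v (p , v<B)
    ... | i , q , r , _ with present i j (≤-<-trans (◁⇒≤ q) v<B)
    ...   | x , eq = i , x , eq , subst (0 <_) (trans (sym (armIn i j v q r v<B)) (num-just ar C v eq)) p

  open Rep public

  -- Whatever occurs in a cell of either tableau lies in the range where `Local` prescribes its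
  -- count, so the counts agree; sortedness then determines the lists.
  rep-unique : ∀ {C C' e} → (∀ x y → hook x ≡ hook y → lg x ≡ lg y → ar x ≡ ar y → x ≡ y) → Rep C e → Rep C' e → ∀ i j → C i j ≡ C' i j
  rep-unique {C} {C'} {e} ext R R' i j with C i j in eq | C' i j in eq'
  ... | nothing | nothing = refl
  ... | nothing | just y = ⊥-elim (<⇒≱ (proj₂ (hooks R' i j y eq')) (absent R i j eq))
  ... | just x | nothing = ⊥-elim (<⇒≱ (proj₂ (hooks R i j x eq)) (absent R' i j eq'))
  ... | just x | just y = cong just (ext x y (trans (proj₁ (hooks R i j x eq)) (sym (proj₁ (hooks R' i j y eq'))))
      (sorted-ext (proj₁ (sorted R i j x eq)) (proj₁ (sorted R' i j y eq')) λ v → trans (sym (num-just lg C v eq)) (trans (same-legs v) (num-just lg C' v eq')))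
      (sorted-ext (proj₂ (sorted R i j x eq)) (proj₂ (sorted R' i j y eq')) λ v → trans (sym (num-just ar C v eq)) (trans (same-arms v) (num-just ar C' v eq'))))
    where
    same-legs : ∀ v → num lg C i j v ≡ num lg C' i j v
    same-legs v with 0 <? num lg C i j v | 0 <? num lg C' i j v
    ... | no p | no p' = trans (¬0<⇒≡0 p) (sym (¬0<⇒≡0 p'))
    ... | yes p | _ = let (q , r , s) = legOut R i j v p in trans (legIn R i j v q r s) (sym (legIn R' i j v q r s))
    ... | _ | yes p = let (q , r , s) = legOut R' i j v p in trans (legIn R i j v q r s) (sym (legIn R' i j v q r s))
    same-arms : ∀ v → num ar C i j v ≡ num ar C' i j v
    same-arms v with 0 <? num ar C i j v | 0 <? num ar C' i j v
    ... | no p | no p' = trans (¬0<⇒≡0 p) (sym (¬0<⇒≡0 p'))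
    ... | yes p | _ = let (q , r , s) = armOut R i j v p in trans (armIn R i j v q r s) (sym (armIn R' i j v q r s))
    ... | _ | yes p = let (q , r , s) = armOut R' i j v p in trans (armIn R i j v q r s) (sym (armIn R' i j v q r s))

  module OfParticle {C e c a} (V : Valid e) (R : Rep C e) (P : Particle e c a) where
    open Particle P renaming (arm∈ to a∈; last to clear)

    particle-found : ∀ {i j a' x} → C i j ≡ just x → ar x ≢ [] → a' ≡ maxList (ar x) →
                     (∀ i' j' x' → C i' j' ≡ just x' → ar x' ≢ [] → j' < j ⊎ (j' ≡ j × maxList (ar x') ≤ a')) →
                     j ≡ c × a' ≡ a × 0 < occ a (ar x)
    particle-found {i} {j} {a'} {x} eq ne refl top with find-arm R V a∈
    ... | i₀ , x₀ , eq₀ , p₀ with top i₀ c x₀ eq₀ (occ-nonempty p₀)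
    ...   | inj₁ c<j = ⊥-elim (clear j _ c<j (cell-arm R eq (occ-max ne)))
    ...   | inj₂ (refl , le) with ≤-antisym (max _ (cell-arm R eq (occ-max ne))) (≤-trans (maxList-≤ (ar x₀) p₀) le)
    ...     | eq' = refl , eq' , subst (λ z → 0 < occ z (ar x)) eq' (occ-max ne)

    some-arm : ¬ (∀ i j x → C i j ≡ just x → ar x ≡ [])
    some-arm none with find-arm R V a∈
    ... | i₀ , x₀ , eq₀ , p₀ = occ-nonempty p₀ (none i₀ c x₀ eq₀)

    no-arms : ∀ {i x} → C i (suc c) ≡ just x → ar x ≡ []
    no-arms {x = x} eq = occ-empty (ar x) λ v p → clear (suc c) v ≤-refl (cell-arm R eq p)

    Entry : Cell → ℕ → Set
    Entry = EntryOf lg ar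

    entry-column : ∀ {i x v} → C i (suc c) ≡ just x → Entry x v → InColumn e (suc c) v × v < B
    entry-column {i} {x} eq (inj₁ refl) with hooks R i (suc c) x eq
    ... | h≡ , h<B = inj₁ (i , h≡) , subst (_< B) (sym h≡) h<B
    entry-column {i} {x} {v} eq (inj₂ (inj₁ p)) with subst (0 <_) (sym (num-just lg C v eq)) p
    ... | p' with legOut R i (suc c) v p'
    ...   | q , r , v<B = inj₂ (i , leg∈ R p' , q , r) , v<B
    entry-column {i} {x} {v} eq (inj₂ (inj₂ p)) = ⊥-elim (clear (suc c) v ≤-refl (cell-arm R eq p))

    entry-above : ∀ {i x v} → C i (suc c) ≡ just x → Entry x v → v ◀ H e (suc i) (suc c)
    entry-above {i} {x} eq (inj₁ refl) = subst (_◀ _) (sym (proj₁ (hooks R i (suc c) x eq))) (Valid.col V i (suc c))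
    entry-above {i} {x} {v} eq (inj₂ (inj₁ p)) with subst (0 <_) (sym (num-just lg C v eq)) p
    ... | p' with legOut R i (suc c) v p'
    ...   | q , r , _ = leg-above V (leg∈ R p') q r
    entry-above {i} {x} {v} eq (inj₂ (inj₂ p)) = ⊥-elim (clear (suc c) v ≤-refl (cell-arm R eq p))

    row : ∀ {k e'} → Slide⊎Exit e c a k e' → ℕ
    row (inj₁ (i , _)) = i
    row (inj₂ (i , _)) = i

    a◁bumped : ∀ {k e'} → Slide⊎Exit e c a k e' → a ◁ k
    a◁bumped (inj₁ (_ , S , refl)) = HStep.over S
    a◁bumped (inj₂ (_ , S)) = GStep.over S

    bumped-entry : ∀ {k e'} (X : Slide⊎Exit e c a k e') → k < B → Σ Cell λ y → C (row X) (suc c) ≡ just y × Entry y k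
    bumped-entry (inj₁ (i , S , refl)) k<B with present R i (suc c) k<B
    ... | y , eq = y , eq , inj₁ (proj₁ (hooks R i (suc c) y eq))
    bumped-entry {k} (inj₂ (i , S)) k<B with present R i (suc c) (≤-<-trans (◀⇒≤ (GStep.under S)) (proj₂ a∈))
    ... | y , eq = y , eq , inj₂ (inj₁ (subst (0 <_) (trans (sym (legIn R i (suc c) k (◀≤ (GStep.under S) (◁⇒≤ (GStep.over S))) (GStep.right S) k<B))
                              (num-just lg C k eq)) (proj₁ (GStep.leg∈ S))))

    below-row : ∀ {k e' i x v} (X : Slide⊎Exit e c a k e') → i < row X → C i (suc c) ≡ just x → Entry x v → ¬ (a ◁ v)
    below-row {i = i} (inj₂ (i' , S)) i≤i' eq v∈ a◁v =
      excl a◁v (≤◀ (≤-trans (◀⇒≤ (entry-above eq v∈)) (H-col V (suc c) i≤i')) (GStep.under S))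
    below-row {i = i} {x} {v} (inj₁ (suc i' , S , refl)) (s≤s i≤i') eq v∈ a◁v with m≤n⇒m<n∨m≡n i≤i'
    ... | inj₁ i<i' = excl a◁v (≤◀ (≤-trans (◀⇒≤ (entry-above eq v∈)) (H-col V (suc c) i<i')) (HStep.under S i' refl))
    ... | inj₂ refl with v∈
    ...   | inj₁ refl = excl a◁v (subst (_◀ a) (sym (proj₁ (hooks R i (suc c) x eq))) (HStep.under S i refl))
    ...   | inj₂ (inj₂ p) = clear (suc c) v ≤-refl (cell-arm R eq p)
    ...   | inj₂ (inj₁ p) with subst (0 <_) (sym (num-just lg C v eq)) p
    ...     | p' = excl a◁v (HStep.free S i refl v (leg∈ R p') (proj₁ (proj₂ (legOut R i (suc c) v p'))))

    found-exists : ∀ {k e'} → Slide⊎Exit e c a k e' → k < B → ¬ (∀ i y v → C i (suc c) ≡ just y → Entry y v → ¬ (a ◁ v))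
    found-exists X k<B none with bumped-entry X k<B
    ... | y , eq , k∈ = none (row X) y _ eq k∈ (a◁bumped X)

    found-fin : ∀ {k e' i y v} → Slide⊎Exit e c a k e' → C i (suc c) ≡ just y → Entry y v → a ◁ v → k < B
    found-fin X eq v∈ a◁v with entry-column eq v∈
    ... | in-col , v<B = ≤-<-trans (bumps-least V X in-col a◁v) v<B

    -- The values agree because both are minimal. As for the row, lower rows contain no candidate,
    -- and a higher one is ruled out because the first cell wins ties.
    found-bumped : ∀ {k e' i y k'} (X : Slide⊎Exit e c a k e') → C i (suc c) ≡ just y → Entry y k' → a ◁ k' →
                   (∀ i' y' v → C i' (suc c) ≡ just y' → Entry y' v → a ◁ v → k' ≤ v × (i' < i → k' < v)) → i ≡ row X × k' ≡ k
    found-bumped {k} {i = i} {y} {k'} X eq k'∈ a◁k' least' with bumped-entry X (found-fin X eq k'∈ a◁k')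
    ... | y₀ , eq₀ , k∈ with ≤-antisym (proj₁ (least' (row X) y₀ k eq₀ k∈ (a◁bumped X))) (bumps-least V X (proj₁ (entry-column eq k'∈)) a◁k')
    ...   | refl with <-cmp i (row X)
    ...     | tri< lt _ _ = ⊥-elim (below-row X lt eq k'∈ a◁k')
    ...     | tri≈ _ eq' _ = eq' , refl
    ...     | tri> _ _ gt = ⊥-elim (<-irrefl refl (proj₂ (least' (row X) y₀ k eq₀ k∈ (a◁bumped X)) gt))

  record Changed (C C' : Cells) (ρ c : ℕ) (x' : Cell) (i : ℕ) (z : Cell) : Set where
    field
      source  : C' ρ c ≡ just x'
      target  : C' i (suc c) ≡ just z
      others  : ∀ i' j' → ¬ (ρ ≡ i' × c ≡ j') → ¬ (i ≡ i' × suc c ≡ j') → C' i' j' ≡ C i' j'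
      sortedˣ : Sorted (lg x') × Sorted (ar x')
      sortedᶻ : Sorted (lg z) × Sorted (ar z)

  module _ {C C' ρ c x' i z e e'} (R : Rep C e) (U : Changed C C' ρ c x' i z) (V' : Valid e')
           (hx : hook x' ≡ H e' ρ c) (hx<B : H e' ρ c < B) (hz : hook z ≡ H e' i (suc c)) (hz<B : H e' i (suc c) < B)
           (off : ∀ i' j' → ¬ (ρ ≡ i' × c ≡ j') → ¬ (i ≡ i' × suc c ≡ j') → H e' i' j' ≡ H e i' j') where
    open Changed U

    changed-rep : Local (num lg C') (num ar C') e' → Rep C' e'
    changed-rep loc = record { hooks = hooks' ; absent = absent' ; sorted = sorted' ; local = loc }
      where
      hooks' : ∀ i' j' y → C' i' j' ≡ just y → hook y ≡ H e' i' j' × H e' i' j' < B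
      hooks' i' j' y eq with pos≟ ρ c i' j' | pos≟ i (suc c) i' j'
      ... | yes (refl , refl) | _ with trans (sym source) eq
      ...   | refl = hx , hx<B
      hooks' i' j' y eq | no _ | yes (refl , refl) with trans (sym target) eq
      ...   | refl = hz , hz<B
      hooks' i' j' y eq | no ¬p | no ¬q = subst (λ h → hook y ≡ h × h < B) (sym (off i' j' ¬p ¬q)) (hooks R i' j' y (trans (sym (others i' j' ¬p ¬q)) eq))
      absent' : ∀ i' j' → C' i' j' ≡ nothing → B ≤ H e' i' j'
      absent' i' j' eq with pos≟ ρ c i' j' | pos≟ i (suc c) i' j'
      ... | yes (refl , refl) | _ = case trans (sym source) eq of λ ()
      ... | no _ | yes (refl , refl) = case trans (sym target) eq of λ ()
      ... | no ¬p | no ¬q = subst (B ≤_) (sym (off i' j' ¬p ¬q)) (absent R i' j' (trans (sym (others i' j' ¬p ¬q)) eq))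
      sorted' : ∀ i' j' y → C' i' j' ≡ just y → Sorted (lg y) × Sorted (ar y)
      sorted' i' j' y eq with pos≟ ρ c i' j' | pos≟ i (suc c) i' j'
      ... | yes (refl , refl) | _ = subst (λ w → Sorted (lg w) × Sorted (ar w)) (just-injective (trans (sym source) eq)) sortedˣ
      ... | no _ | yes (refl , refl) = subst (λ w → Sorted (lg w) × Sorted (ar w)) (just-injective (trans (sym target) eq)) sortedᶻ
      ... | no ¬p | no ¬q = sorted R i' j' y (trans (sym (others i' j' ¬p ¬q)) eq)

  -- `lc` counts the legs of the target before the step. It is a function instead of a cell because
  -- the target may be empty.
  data Split (lc : ℕ → ℕ) (x x' z : Cell) (a i ρ : ℕ) : Set where
    elsewhere : i ≢ ρ → (∀ v → occ v (lg x') ≡ occ v (lg x)) → (∀ v → occ v (lg z) ≡ lc v) → Split lc x x' z a i ρ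
    same-row  : i ≡ ρ → (∀ v → v ◁ a → occ v (lg x') ≡ occ v (lg x)) → (∀ v → a ◀ v → occ v (lg x') ≡ 0) →
                (∀ v → v ◁ a → occ v (lg z) ≡ lc v) → (∀ v → a ◀ v → occ v (lg z) ≡ lc v + occ v (lg x)) → Split lc x x' z a i ρ

  HStep-rep : ∀ {C C' ρ c x x' i z e a e'} → Valid e → HStep e c a i e' → Rep C e → C ρ c ≡ just x → 0 < occ a (ar x) → Changed C C' ρ c x' i z →
              hook x' ≡ hook x → hook z ≡ a → (∀ v → occ v (ar x') + one a v ≡ occ v (ar x)) →
              (∀ v → v < B → occ v (ar z) ≡ one (H e i (suc c)) v) → (∀ v → B ≤ v → occ v (ar z) ≡ 0) →
              Split (num lg C i (suc c)) x x' z a i ρ → Rep C' e'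
  HStep-rep {C} {C'} {ρ} {c} {x} {x'} {i} {z} {e} {a} {e'} V S R Cx a∈ U hx hz arx arz arz-big split =
    changed-rep R U V' (trans hx (trans (proj₁ (hooks R ρ c x Cx)) (sym (off ρ c λ ()))))
      (subst (_< B) (sym (off ρ c λ ())) (proj₂ (hooks R ρ c x Cx))) (trans hz (sym at-target)) (subst (_< B) (sym at-target) (proj₂ (Particle.arm∈ part)))
      (λ i' j' _ ¬q → off i' j' ¬q)
      (record { legIn = proj₁ (legs' split) ; legOut = proj₂ (legs' split) ; armIn = AR.armIn' ; armOut = AR.armOut' })
    where
    open HStep S renaming (at to at-target)
    open Changed U
    V' = HStep-valid V S
    at-ρ : 0 < num ar C ρ c a
    at-ρ = subst (0 <_) (sym (num-just ar C a Cx)) a∈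
    off-column : ∀ i' j → j ≢ suc c → H e' i' j ≡ H e i' j
    off-column i' j ne = off i' j λ { (_ , refl) → ne refl }
    k-high : H e i (suc c) ◀ H e' (suc i) (suc c)
    k-high = subst (_ ◀_) (sym (off (suc i) (suc c) λ { (() , _) })) (Valid.col V i (suc c))
    module AR = Arms {num lg C} {num ar C} {num ar C'} {e} {e'} {c} {a} {H e i (suc c)} {ρ} {i} V V' part (local R) mvA off-column
      (subst (_◁ _) (sym at-target) over) k-high at-ρ
      (λ v → trans (cong (_+ one a v) (num-just ar C' v source)) (trans (arx v) (sym (num-just ar C v Cx))))
      (λ v v<B → trans (num-just ar C' v target) (arz v v<B)) (λ v big → trans (num-just ar C' v target) (arz-big v big))
      (λ i' j' v ¬p ¬q → num-cong ar C C' v (others i' j' ¬p ¬q))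
    module O = OfH {num lg C} {num ar C} {num lg C'} {ρ = ρ} V S (local R) at-ρ
    legs' : Split (num lg C i (suc c)) x x' z a i ρ →
            (∀ i' j' v → H e' i' j' ◀ v → v ◁ H e' i' (suc j') → v < B → num lg C' i' j' v ≡ L e' i' v) ×
            (∀ i' j' v → 0 < num lg C' i' j' v → (H e' i' j' ◀ v) × (v ◁ H e' i' (suc j')) × v < B)
    legs' (elsewhere ne lgx lgz) = O.apart-legIn ne same , O.apart-legOut ne same
      where
      same : ∀ i' j' v → num lg C' i' j' v ≡ num lg C i' j' v
      same i' j' v with pos≟ ρ c i' j' | pos≟ i (suc c) i' j'
      ... | yes (refl , refl) | _ = trans (num-just lg C' v source) (trans (lgx v) (sym (num-just lg C v Cx)))
      ... | no _ | yes (refl , refl) = trans (num-just lg C' v target) (lgz v)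
      ... | no ¬p | no ¬q = num-cong lg C C' v (others i' j' ¬p ¬q)
    legs' (same-row i≡ρ keep drop low high) = OS.legIn' , OS.legOut'
      where
      source' = subst (λ r → C' r c ≡ just x') (sym i≡ρ) source
      Cx' = subst (λ r → C r c ≡ just x) (sym i≡ρ) Cx
      module OS = O.Same i≡ρ
        (λ v q → trans (num-just lg C' v source') (trans (keep v q) (sym (num-just lg C v Cx'))))
        (λ v q → trans (num-just lg C' v source') (drop v q))
        (λ v q → trans (num-just lg C' v target) (low v q))
        (λ v q → trans (num-just lg C' v target) (trans (high v q) (cong (num lg C i (suc c) v +_) (sym (num-just lg C v Cx')))))
        (λ i' j' v ¬p ¬q → num-cong lg C C' v (others i' j' (subst (λ r → ¬ (r ≡ i' × c ≡ j')) i≡ρ ¬p) ¬q))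

  GStep-rep : ∀ {C C' ρ c x x' i y z e a k e'} → Valid e → GStep e c a i k e' → Rep C e → C ρ c ≡ just x → 0 < occ a (ar x) → C i (suc c) ≡ just y →
              Changed C C' ρ c x' i z →
              hook x' ≡ hook x → hook z ≡ hook y → (∀ v → occ v (ar x') + one a v ≡ occ v (ar x)) →
              (∀ v → occ v (ar z) ≡ one k v) → (∀ v → occ v (lg x') ≡ occ v (lg x)) → (∀ v → occ v (lg z) + one k v ≡ occ v (lg y) + one a v) → Rep C' e'
  GStep-rep {C} {C'} {ρ} {c} {x} {x'} {i} {y} {z} {e} {a} {k} {e'} V S R Cx a∈ Cy U hx hz arx arz lgx lgz =
    changed-rep R U V' (trans hx (trans (proj₁ (hooks R ρ c x Cx)) (sym (sameH ρ c)))) (subst (_< B) (sym (sameH ρ c)) (proj₂ (hooks R ρ c x Cx)))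
      (trans hz (trans (proj₁ (hooks R i (suc c) y Cy)) (sym (sameH i (suc c))))) (subst (_< B) (sym (sameH i (suc c))) (proj₂ (hooks R i (suc c) y Cy)))
      (λ i' j' _ _ → sameH i' j')
      (record { legIn = O.legIn' ; legOut = O.legOut' ; armIn = AR.armIn' ; armOut = AR.armOut' })
    where
    open GStep S renaming (leg∈ to k∈)
    open Changed U
    V' = GStep-valid V S
    at-ρ : 0 < num ar C ρ c a
    at-ρ = subst (0 <_) (sym (num-just ar C a Cx)) a∈
    new-big : ∀ v → B ≤ v → num ar C' i (suc c) v ≡ 0
    new-big v big = trans (num-just ar C' v target) (trans (arz v) (one-miss λ { refl → <⇒≱ (proj₂ k∈) big }))
    module AR = Arms {num lg C} {num ar C} {num ar C'} {e} {e'} {c} {a} {k} {ρ} {i} V V' part (local R) mvA (λ i' j _ → sameH i' j)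
      (subst (_◁ k) (sym (sameH i (suc c))) (<⇒◁ (◀◁⇒< under over))) (subst (k ◀_) (sym (sameH (suc i) (suc c))) (OfGStep.k-above V S)) at-ρ
      (λ v → trans (cong (_+ one a v) (num-just ar C' v source)) (trans (arx v) (sym (num-just ar C v Cx))))
      (λ v _ → trans (num-just ar C' v target) (arz v))
      new-big
      (λ i' j' v ¬p ¬q → num-cong ar C C' v (others i' j' ¬p ¬q))
    same : ∀ i' j' v → ¬ (i ≡ i' × suc c ≡ j') → num lg C' i' j' v ≡ num lg C i' j' v
    same i' j' v ¬q with pos≟ ρ c i' j'
    ... | yes (refl , refl) = trans (num-just lg C' v source) (trans (lgx v) (sym (num-just lg C v Cx)))
    ... | no ¬p = num-cong lg C C' v (others i' j' ¬p ¬q)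
    module O = OfG {num lg C} {num ar C} {num lg C'} V S (local R)
      (λ v → trans (cong (_+ one k v) (num-just lg C' v target)) (trans (lgz v) (cong (_+ one a v) (sym (num-just lg C v Cy)))))
      same

-- Bumping in lists of rows

record Edited₁ (T T' : Tableau) (p q : ℕ) (x' : Cell) : Set where
  field
    edited  : at T' p q ≡ just x'
    others  : ∀ i j → ¬ (p ≡ i × q ≡ j) → at T' i j ≡ at T i j
    lengths : map length T' ≡ map length T
    filled  : NonEmpty T → NonEmpty T'

modify₁ : ∀ {T p q x} f → at T p q ≡ just x → Edited₁ T (modifyCell p q f T) p q (f x)
modify₁ {T} {p} {q} f eq = record { edited = at-modify-same f T {p} {q} eq ; others = λ i j ¬p → at-modify-other f T {p} {q} {i} {j} ¬p
  ; lengths = lengths-modify f p q T ; filled = modify-nonEmpty f p q }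

modify₁-again : ∀ {T T' p q x'} f → Edited₁ T T' p q x' → Edited₁ T (modifyCell p q f T') p q (f x')
modify₁-again {T} {T'} {p} {q} f E = record { edited = at-modify-same f T' {p} {q} edited
  ; others = λ i j ¬p → trans (at-modify-other f T' {p} {q} {i} {j} ¬p) (others i j ¬p)
  ; lengths = trans (lengths-modify f p q T') lengths ; filled = modify-nonEmpty f p q ∘ filled }
  where open Edited₁ E

record Edited (T T' : Tableau) (p q : ℕ) (x' : Cell) (p' q' : ℕ) (z : Cell) : Set where
  field
    first  : at T' p q ≡ just x'
    second : at T' p' q' ≡ just z
    others : ∀ i j → ¬ (p ≡ i × q ≡ j) → ¬ (p' ≡ i × q' ≡ j) → at T' i j ≡ at T i j
    filled : NonEmpty T → NonEmpty T'

modify₂ : ∀ {T T₁ p q x' p' q' y} g → Edited₁ T T₁ p q x' → ¬ (p ≡ p' × q ≡ q') → at T p' q' ≡ just y → Edited T (modifyCell p' q' g T₁) p q x' p' q' (g y)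
modify₂ {T} {T₁} {p} {q} {p' = p'} {q'} g E ¬p eq = record
  { first = trans (at-modify-other g T₁ {p'} {q'} {p} {q} λ (e , e') → ¬p (sym e , sym e')) edited
  ; second = at-modify-same g T₁ {p'} {q'} (trans (others p' q' ¬p) eq)
  ; others = λ i j ¬q ¬q' → trans (at-modify-other g T₁ {p'} {q'} {i} {j} ¬q') (others i j ¬q)
  ; filled = modify-nonEmpty g p' q' ∘ filled }
  where open Edited₁ E

modify₂-again : ∀ {T T' p q x' p' q' z} f g → ¬ (p ≡ p' × q ≡ q') → Edited T T' p q x' p' q' z →
                Edited T (modifyCell p' q' g (modifyCell p q f T')) p q (f x') p' q' (g z)
modify₂-again {T} {T'} {p} {q} {p' = p'} {q'} f g ¬p E = record
  { first = trans (at-modify-other g T₁ {p'} {q'} {p} {q} λ (e , e') → ¬p (sym e , sym e')) (at-modify-same f T' {p} {q} first)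
  ; second = at-modify-same g T₁ {p'} {q'} (trans (at-modify-other f T' {p} {q} {p'} {q'} ¬p) second)
  ; others = λ i j ¬q ¬q' → trans (at-modify-other g T₁ {p'} {q'} {i} {j} ¬q') (trans (at-modify-other f T' {p} {q} {i} {j} ¬q) (others i j ¬q ¬q'))
  ; filled = modify-nonEmpty g p' q' ∘ modify-nonEmpty f p q ∘ filled }
  where
  open Edited E
  T₁ = modifyCell p q f T'

row-lengths : ∀ {X Y : Set} (T : List (List X)) (T' : List (List Y)) → map length T' ≡ map length T → ∀ i → length (nth [] T' i) ≡ length (nth [] T i)
row-lengths T T' eq i = trans (sym (nth-map T' i)) (trans (cong (λ ns → nth 0 ns i) eq) (nth-map T i))
  where
  nth-map : ∀ {X : Set} (T : List (List X)) i → nth 0 (map length T) i ≡ length (nth [] T i)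
  nth-map [] i = refl
  nth-map (row ∷ T) zero = refl
  nth-map (row ∷ T) (suc i) = nth-map T i

append₂ : ∀ {T T₁ p q x' i j} z → Edited₁ T T₁ p q x' → i ≤ length T → length (nth [] T i) ≡ j → ¬ (p ≡ i × q ≡ j) → Edited T (appendAt T₁ i z) p q x' i j z
append₂ {T} {T₁} {p} {q} {i = i} {j} z E le len ¬p = record
  { first = trans (at-append-other T₁ {i} z le₁ λ (e , e') → ¬p (sym e , trans (sym e') len₁)) edited
  ; second = subst (λ j → at (appendAt T₁ i z) i j ≡ just z) len₁ (at-append-same T₁ z le₁)
  ; others = λ i' j' ¬q ¬q' → trans (at-append-other T₁ {i} z le₁ λ (e , e') → ¬q' (e , trans (sym len₁) e')) (others i' j' ¬q)
  ; filled = append-nonEmpty i z ∘ filled }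
  where
  open Edited₁ E
  le₁ : i ≤ length T₁
  le₁ = subst (i ≤_) (trans (sym (length-map length T)) (trans (cong length (sym lengths)) (length-map length T₁))) le
  len₁ : length (nth [] T₁ i) ≡ j
  len₁ = trans (row-lengths T T₁ lengths i) len

Present : Tableau → ℕ → ℕ → Set
Present T i j = Σ Cell λ x → at T i j ≡ just x

present-row : ∀ (T : Tableau) {i j x} → at T i j ≡ just x → i < length T
present-row (row ∷ T) {zero} eq = s≤s z≤n
present-row (row ∷ T) {suc i} eq = s≤s (present-row T eq)

row-end : ∀ (T : Tableau) {i j} → at T i j ≡ nothing → (∀ j' → j' < j → Present T i j') → length (nth [] T i) ≡ j
row-end T {i} {j} none before with <-cmp (length (nth [] T i)) j
... | tri≈ _ eq _ = eq
... | tri> _ _ gt = case trans (sym none) (proj₂ (<-nth? (nth [] T i) gt)) of λ ()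
... | tri< lt _ _ = case trans (sym (nth?-end (nth [] T i))) (proj₂ (before _ lt)) of λ ()

column-end : ∀ (T : Tableau) {i j} → at T i j ≡ nothing → (∀ i' → i' < i → Present T i' j) → colHeight T j ≡ i
column-end [] {zero} none before = refl
column-end [] {suc i} none before = case before 0 (s≤s z≤n) of λ ()
column-end (row ∷ T) {zero} {j} none before with j <ᵇ length row in eq
... | false = refl
... | true = case trans (sym none) (proj₂ (<-nth? row (<ᵇ≡⇒< eq))) of λ ()
column-end (row ∷ T) {suc i} {j} none before rewrite <⇒<ᵇ≡ (nth?-< row (proj₂ (before 0 (s≤s z≤n)))) =
  cong suc (column-end T none λ i' lt → before (suc i') (s≤s lt))

rows-below : ∀ (T : Tableau) {i j} → (∀ i' → i' < i → Present T i' j) → i ≤ length T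
rows-below T {zero} before = z≤n
rows-below T {suc i} {j} before with before i ≤-refl
... | x , eq = present-row T {i} {j} {x} eq

module Finish (B : ℕ) (_◁_ _◀_ : ℕ → ℕ → Set) (orders : Orders _◁_ _◀_) (lg ar : Cell → List ℕ) where
  open Bounded B
  open Half B _◁_ _◀_ orders
  open Growth B _◁_ _◀_ orders
  open Orders orders
  open Representation B _◁_ _◀_ orders lg ar

  record Rewritten (C C' : Cells) (ρ c : ℕ) (x x' : Cell) (i : ℕ) (z : Cell) (a : ℕ) : Set where
    field
      source : C' ρ c ≡ just x'
      target : C' i (suc c) ≡ just z
      others : ∀ i' j' → ¬ (ρ ≡ i' × c ≡ j') → ¬ (i ≡ i' × suc c ≡ j') → C' i' j' ≡ C i' j'
      hookˣ  : hook x' ≡ hook x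
      arˣ    : ar x' ≡ removeOne a (ar x)

  changed : ∀ {C C' ρ c x x' i z a e} → Rep C e → C ρ c ≡ just x → Rewritten C C' ρ c x x' i z a →
            Sorted (lg x') → Sorted (lg z) → Sorted (ar z) → Changed C C' ρ c x' i z
  changed {x = x} {a = a} R Cx W sx sz sz' = record
    { source = source ; target = target ; others = others
    ; sortedˣ = sx , subst Sorted (sym arˣ) (sorted-remove a (proj₂ (sorted R _ _ x Cx))) ; sortedᶻ = sz , sz' }
    where open Rewritten W

  removed : ∀ {x x' a} → 0 < occ a (ar x) → ar x' ≡ removeOne a (ar x) → ∀ v → occ v (ar x') + one a v ≡ occ v (ar x)
  removed {x} {x'} {a} a∈ eq v = trans (cong (λ as → occ v as + one a v) eq) (occ-remove a (ar x) v a∈)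

  -- A bumped fictitious hook leaves no arm behind.
  data NewArms (z : Cell) (k : ℕ) : Set where
    kept   : k < B → ar z ≡ k ∷ [] → NewArms z k
    exited : B ≤ k → ar z ≡ [] → NewArms z k

  newArms-small : ∀ {z k} → NewArms z k → ∀ v → v < B → occ v (ar z) ≡ one k v
  newArms-small {k = k} (kept _ eq) v v<B = trans (cong (occ v) eq) (+-identityʳ (one k v))
  newArms-small (exited big eq) v v<B = trans (cong (occ v) eq) (sym (one-miss λ { refl → <⇒≱ v<B big }))

  newArms-big : ∀ {z k} → NewArms z k → ∀ v → B ≤ v → occ v (ar z) ≡ 0
  newArms-big {k = k} (kept k<B eq) v big = trans (cong (occ v) eq) (trans (+-identityʳ (one k v)) (one-miss λ { refl → <⇒≱ k<B big }))
  newArms-big (exited _ eq) v big = cong (occ v) eq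

  newArms-sorted : ∀ {z k} → NewArms z k → Sorted (ar z)
  newArms-sorted (kept _ eq) = subst Sorted (sym eq) ([] ∷ [])
  newArms-sorted (exited _ eq) = subst Sorted (sym eq) []

  -- An empty target is treated as having no legs, so that bumping a hook and creating a cell share
  -- their lemmas.
  base : Maybe Cell → List ℕ
  base m = Maybe.maybe′ lg [] m

  num-base : ∀ C i j v → num lg C i j v ≡ occ v (base (C i j))
  num-base C i j v with C i j
  ... | just _ = refl
  ... | nothing = refl

  base-sorted : ∀ {C e} → Rep C e → ∀ i j → Sorted (base (C i j))
  base-sorted {C} R i j with C i j in eq
  ... | just x = proj₁ (sorted R i j x eq)
  ... | nothing = []

  hook-elsewhere : ∀ {C C' ρ c x x' i z e a e'} → Valid e → HStep e c a i e' → Rep C e → C ρ c ≡ just x → 0 < occ a (ar x) →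
                   i ≢ ρ → Rewritten C C' ρ c x x' i z a → lg x' ≡ lg x → hook z ≡ a → lg z ≡ base (C i (suc c)) → NewArms z (H e i (suc c)) → Rep C' e'
  hook-elsewhere {C} {c = c} {x} {i = i} V S R Cx a∈ ne W lgx hz lgz arz =
    HStep-rep V S R Cx a∈ (changed R Cx W (subst Sorted (sym lgx) (proj₁ (sorted R _ _ x Cx))) (subst Sorted (sym lgz) (base-sorted R i (suc c))) (newArms-sorted arz))
      hookˣ hz (removed a∈ arˣ) (newArms-small arz) (newArms-big arz)
      (elsewhere ne (λ v → cong (occ v) lgx) (λ v → trans (cong (occ v) lgz) (sym (num-base C i (suc c) v))))
    where open Rewritten W

  -- The tests are parameters because arm and leg bumping separate the kept from the moved entries
  -- by different comparisons: an entry equal to the moving one stays in the first case and moves in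
  -- the second.
  hook-same-row : ∀ {C C' c x x' i z e a e'} (keeps moves : ℕ → Bool) → Valid e → HStep e c a i e' → Rep C e → C i c ≡ just x → 0 < occ a (ar x) →
                  (∀ v → v ◁ a → keeps v ≡ true × moves v ≡ false) → (∀ v → a ◀ v → keeps v ≡ false × moves v ≡ true) →
                  Rewritten C C' i c x x' i z a → lg x' ≡ filterB keeps (lg x) → hook z ≡ a →
                  Sorted (lg z) → (∀ v → occ v (lg z) ≡ occ v (filterB moves (lg x)) + occ v (base (C i (suc c)))) → NewArms z (H e i (suc c)) → Rep C' e'
  hook-same-row {C} {c = c} {x} {i = i} keeps moves V S R Cx a∈ low high W lgx hz sz lgz arz =
    HStep-rep V S R Cx a∈ (changed R Cx W (subst Sorted (sym lgx) (sorted-filter keeps (proj₁ (sorted R _ _ x Cx)))) sz (newArms-sorted arz))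
      hookˣ hz (removed a∈ arˣ) (newArms-small arz) (newArms-big arz)
      (same-row refl
        (λ v q → trans (cong (occ v) lgx) (occ-filter-true keeps (lg x) (proj₁ (low v q))))
        (λ v q → trans (cong (occ v) lgx) (occ-filter-false keeps (lg x) (proj₁ (high v q))))
        (λ v q → trans (lgz v) (trans (cong (_+ occ v (base (C i (suc c)))) (occ-filter-false moves (lg x) (proj₂ (low v q)))) (sym (num-base C i (suc c) v))))
        (λ v q → trans (lgz v) (trans (+-comm (occ v (filterB moves (lg x))) _) (cong₂ _+_ (sym (num-base C i (suc c) v)) (occ-filter-true moves (lg x) (proj₂ (high v q)))))))
    where open Rewritten W

  leg-elsewhere : ∀ {C C' ρ c x x' i y z e a k e'} → Valid e → GStep e c a i k e' → Rep C e → C ρ c ≡ just x → 0 < occ a (ar x) → C i (suc c) ≡ just y →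
                  0 < occ k (lg y) → Rewritten C C' ρ c x x' i z a → lg x' ≡ lg x → hook z ≡ hook y → lg z ≡ ins a (removeOne k (lg y)) → ar z ≡ k ∷ [] → Rep C' e'
  leg-elsewhere {C} {c = c} {x} {i = i} {y} {z} {a = a} {k} V S R Cx a∈ Cy k∈ W lgx hz lgz arz =
    GStep-rep V S R Cx a∈ Cy (changed R Cx W (subst Sorted (sym lgx) (proj₁ (sorted R _ _ x Cx)))
        (subst Sorted (sym lgz) (sorted-ins a (sorted-remove k (proj₁ (sorted R _ _ y Cy))))) (subst Sorted (sym arz) ([] ∷ [])))
      hookˣ hz (removed a∈ arˣ) (λ v → trans (cong (occ v) arz) (+-identityʳ (one k v))) (λ v → cong (occ v) lgx) replaced
    where
    open Rewritten W
    replaced : ∀ v → occ v (lg z) + one k v ≡ occ v (lg y) + one a v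
    replaced v = trans (cong (λ ls → occ v ls + one k v) lgz) (trans (cong (_+ one k v) (occ-ins a (removeOne k (lg y)) v)) (trans (+-assoc (one a v) _ _)
      (trans (cong (one a v +_) (occ-remove k (lg y) v k∈)) (+-comm (one a v) _))))

  -- For a created cell: the column is filled up to the target, so `colHeight` finds the right row,
  -- and by `row-before` appending to that row reaches the right column.
  column-before : ∀ {C c a i e e'} → Valid e → HStep e c a i e' → Rep C e → ∀ i' → i' < i → Σ Cell λ x → C i' (suc c) ≡ just x
  column-before {i = suc i} V S R i' (s≤s le) = present R i' _ (≤-<-trans (≤-trans (H-col V _ le) (◀⇒≤ (HStep.under S i refl))) (proj₂ (Particle.arm∈ (HStep.part S))))

  row-before : ∀ {C c a i e e'} → Valid e → HStep e c a i e' → Rep C e → ∀ j' → j' < suc c → Σ Cell λ x → C i j' ≡ just x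
  row-before {i = i} V S R j' (s≤s le) = present R i j' (≤-<-trans (≤-trans (H-row V i le) (◁⇒≤ (OfHStep.left V S))) (proj₂ (Particle.arm∈ (HStep.part S))))

  target-absent : ∀ {C e i j} → Rep C e → B ≤ H e i j → C i j ≡ nothing
  target-absent {C} {i = i} {j} R big with C i j in eq
  ... | nothing = refl
  ... | just x = ⊥-elim (<⇒≱ (proj₂ (hooks R i j x eq)) big)

  -- Keeps the bumping of a leg out of the branch that transfers further entries.
  leg-row : ∀ {C c a i k e e' ρ x} → Valid e → GStep e c a i k e' → Rep C e → C ρ c ≡ just x → 0 < occ a (ar x) → i ≢ ρ
  leg-row {C} {a = a} V S R Cx a∈ refl with armOut R _ _ _ (subst (0 <_) (sym (num-just ar C a Cx)) a∈) | OfGStep.place V S | OfGStep.i<ρ V S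
  ... | p , q , _ | ρ , p' , q' , _ | lt = <⇒≢ lt (sym (arm-row-unique V p' q' p q))

  -- The replacement functions test the hook first; this inequality sends them on to the remaining
  -- entries.
  leg-below : ∀ {C c a i k e e' y} → Valid e → GStep e c a i k e' → Rep C e → C i (suc c) ≡ just y → hook y ≢ k
  leg-below {y = y} V S R Cy refl = <-irrefl refl (≤-<-trans (≤-reflexive (proj₁ (hooks R _ _ y Cy))) (◀◁⇒< (GStep.under S) (GStep.over S)))

  leg-present : ∀ {C c a i k e e' y} → Valid e → GStep e c a i k e' → Rep C e → C i (suc c) ≡ just y → 0 < occ k (lg y)
  leg-present {C} {c} {a} {i} {k} V S R Cy = subst (0 <_) (trans (sym (legIn R i (suc c) k (◀≤ (GStep.under S) (◁⇒≤ (GStep.over S))) (GStep.right S) (proj₂ (GStep.leg∈ S))))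
    (num-just lg C k Cy)) (proj₁ (GStep.leg∈ S))

armBump-into : ∀ T {r c a x r' j k} → findArm T ≡ just (r , c , a , x) → findMin (λ _ j → j ≡ᵇ suc c) (λ y → a ≤ᵇ y) T ≡ just (r' , j , k) →
               armBump T ≡ (if r' ≡ᵇ r
                 then modifyCell r (suc c) (addLegs (filterB (λ y → a <ᵇ y) (legs x)))
                   (modifyCell r c (keepLegsLE a) (modifyCell r' (suc c) (λ y → addArm k (replaceA a k y)) (modifyCell r c (removeArm a) T)))
                 else modifyCell r' (suc c) (λ y → addArm k (replaceA a k y)) (modifyCell r c (removeArm a) T))
armBump-into T eq eq' rewrite eq | eq' = refl

armBump-out : ∀ T {r c a x} → findArm T ≡ just (r , c , a , x) → findMin (λ _ j → j ≡ᵇ suc c) (λ y → a ≤ᵇ y) T ≡ nothing →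
              armBump T ≡ (if colHeight T (suc c) ≡ᵇ r
                then appendAt (modifyCell r c (keepLegsLE a) (modifyCell r c (removeArm a) T)) (colHeight T (suc c)) (cell a (filterB (λ y → a <ᵇ y) (legs x)) [])
                else appendAt (modifyCell r c (removeArm a) T) (colHeight T (suc c)) (cell a [] []))
armBump-out T eq eq' rewrite eq | eq' = refl

legBump-into : ∀ T {r c l x i c' k} → findLeg T ≡ just (r , c , l , x) → findMin (λ i _ → i ≡ᵇ suc r) (λ y → l <ᵇ y) T ≡ just (i , c' , k) →
               legBump T ≡ (if c' ≡ᵇ c
                 then modifyCell (suc r) c (addArms (filterB (λ y → l ≤ᵇ y) (arms x)))
                   (modifyCell r c (keepArmsLT l) (modifyCell (suc r) c' (λ y → addLeg k (replaceL l k y)) (modifyCell r c (removeLeg l) T)))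
                 else modifyCell (suc r) c' (λ y → addLeg k (replaceL l k y)) (modifyCell r c (removeLeg l) T))
legBump-into T eq eq' rewrite eq | eq' = refl

legBump-out : ∀ T {r c l x} → findLeg T ≡ just (r , c , l , x) → findMin (λ i _ → i ≡ᵇ suc r) (λ y → l <ᵇ y) T ≡ nothing →
              legBump T ≡ (if length (nth [] T (suc r)) ≡ᵇ c
                then appendAt (modifyCell r c (keepArmsLT l) (modifyCell r c (removeLeg l) T)) (suc r) (cell l [] (filterB (λ y → l ≤ᵇ y) (arms x)))
                else appendAt (modifyCell r c (removeLeg l) T) (suc r) (cell l [] []))
legBump-out T eq eq' rewrite eq | eq' = refl

if-true : ∀ {X : Set} {m n} {x y : X} → m ≡ n → (if m ≡ᵇ n then x else y) ≡ x
if-true {m = m} refl rewrite n≡ᵇn m = refl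

if-false : ∀ {X : Set} {m n} {x y : X} → m ≢ n → (if m ≡ᵇ n then x else y) ≡ y
if-false ne rewrite ≢⇒≡ᵇ ne = refl

replaceA-hook : ∀ a k y → hook y ≡ k → arms y ≡ [] → addArm k (replaceA a k y) ≡ cell a (legs y) (k ∷ [])
replaceA-hook a k (cell h ls []) refl refl rewrite n≡ᵇn k = refl

replaceA-leg : ∀ a k y → hook y ≢ k → arms y ≡ [] → 0 < occ k (legs y) → addArm k (replaceA a k y) ≡ cell (hook y) (ins a (removeOne k (legs y))) (k ∷ [])
replaceA-leg a k (cell h ls []) ne refl k∈ rewrite ≢⇒≡ᵇ ne | elemB-occ ls k∈ = refl

replaceL-hook : ∀ l k y → hook y ≡ k → legs y ≡ [] → addLeg k (replaceL l k y) ≡ cell l (k ∷ []) (arms y)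
replaceL-hook l k (cell h [] as) refl refl rewrite n≡ᵇn k = refl

replaceL-arm : ∀ l k y → hook y ≢ k → legs y ≡ [] → 0 < occ k (arms y) → addLeg k (replaceL l k y) ≡ cell (hook y) (k ∷ []) (ins l (removeOne k (arms y)))
replaceL-arm l k (cell h [] as) ne refl k∈ rewrite ≢⇒≡ᵇ ne | elemB-occ as k∈ = refl

module Bumping (B : ℕ) where
  open Bounded B
  module AG = Growth B _≤_ _<_ ≤-<
  module LG = Growth B _<_ _≤_ (transposed ≤-<)
  module AD = Defn _≤_ _<_
  module LD = Defn _<_ _≤_
  module AR = Representation B _≤_ _<_ ≤-< legs arms
  module LR = Representation B _<_ _≤_ (transposed ≤-<) arms legs
  module AF = Finish B _≤_ _<_ ≤-< legs arms
  module LF = Finish B _<_ _≤_ (transposed ≤-<) arms legs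

  -- Only the position function is transposed. The list of rows stays, as `legBump` is defined on it
  -- directly.
  Flipped : Tableau → ℕ → ℕ → Maybe Cell
  Flipped T i j = at T j i

  flip-rep : ∀ T {e} → AR.Rep (at T) e → LR.Rep (Flipped T) (e ᵗ)
  flip-rep T R = record
    { hooks = λ i j → AR.hooks R j i ; absent = λ i j → AR.absent R j i ; sorted = λ i j x eq → swap (AR.sorted R j i x eq)
    ; local = record { legIn = λ i j → AR.armIn R j i ; legOut = λ i j → AR.armOut R j i ; armIn = λ i j → AR.legIn R j i ; armOut = λ i j → AR.legOut R j i } }

  unflip-rep : ∀ T {e} → LR.Rep (Flipped T) (e ᵗ) → AR.Rep (at T) e
  unflip-rep T R = record
    { hooks = λ i j → LR.hooks R j i ; absent = λ i j → LR.absent R j i ; sorted = λ i j x eq → swap (LR.sorted R j i x eq)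
    ; local = record { legIn = λ i j → LR.armIn R j i ; legOut = λ i j → LR.armOut R j i ; armIn = λ i j → LR.legIn R j i ; armOut = λ i j → LR.legOut R j i } }

  -- The bumped value `k` tells whether the shape changed: only one of `kept` and `grown` has a
  -- satisfiable premise.
  record Bumped (T T' : Tableau) (e' : Enc) (k i : ℕ) : Set where
    field
      rep    : AR.Rep (at T') e'
      filled : NonEmpty T → NonEmpty T'
      kept   : k < B → map length T' ≡ map length T
      grown  : B ≤ k → map length T' ≡ growAt i (map length T) × i ≤ length T

  no-big : ∀ {X : Set} {k} → k < B → B ≤ k → X
  no-big p q = ⊥-elim (<⇒≱ p q)

  module ArmStep {T e c a} (V : AD.Valid e) (R : AR.Rep (at T) e) (P : AD.Particle e c a) where
    open AR.OfParticle V R P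

    findArm-found : Σ ℕ λ ρ → Σ Cell λ x → findArm T ≡ just (ρ , c , a , x) × at T ρ c ≡ just x × 0 < occ a (arms x)
    findArm-found with findArm T | findArm-picks T
    ... | nothing | none = ⊥-elim (some-arm none)
    ... | just (i , j , a' , x) | eq , ne , eq' , top with particle-found eq ne eq' top
    ...   | refl , refl , a∈ = i , x , refl , eq , a∈

    q : ℕ → ℕ → Bool
    q _ j = j ≡ᵇ suc c

    p : ℕ → Bool
    p y = a ≤ᵇ y

    findMin-found : ∀ {k e'} (X : AG.Slide⊎Exit e c a k e') → (k < B × findMin q p T ≡ just (row X , suc c , k)) ⊎ (B ≤ k × findMin q p T ≡ nothing)
    findMin-found {k} X with findMin q p T | findMin-smallest q p T
    ... | nothing | none = inj₂ (≮⇒≥ (λ k<B → found-exists X k<B λ i y v eq v∈ a≤v →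
            case trans (sym (none i (suc c) y eq (n≡ᵇn c) v (entry-occ y v∈))) (≤⇒≤ᵇ≡ a≤v) of λ ()) , refl)
    ... | just (i , j , k') | (y , eq , k'∈) , qj , pk , least' with ≡ᵇ≡⇒≡ {j} {suc c} qj
    ...   | refl with found-bumped X eq (entry-cases y k'∈) a≤k' least''
      where
      a≤k' : a ≤ k'
      a≤k' = ≤ᵇ⇒≤ a k' (subst Data.Bool.T (sym pk) tt)
      least'' : ∀ i' y' v → at T i' (suc c) ≡ just y' → EntryOf legs arms y' v → a ≤ v → k' ≤ v × (i' < i → k' < v)
      least'' i' y' v eq' v∈ a≤v with least' i' (suc c) y' eq' (n≡ᵇn c) v (entry-occ y' v∈) (≤⇒≤ᵇ≡ a≤v)
      ... | le , lt = le , λ i'<i → lt (inj₁ i'<i)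
    ...     | refl , refl = inj₁ (found-fin X eq (entry-cases y k'∈) (≤ᵇ⇒≤ a k (subst Data.Bool.T (sym pk) tt)) , refl)

    below-above : ∀ v → v ≤ a → (v ≤ᵇ a) ≡ true × (a <ᵇ v) ≡ false
    below-above v le = ≤⇒≤ᵇ≡ le , ≮⇒<ᵇ≡ (≤⇒≯ le)

    above-below : ∀ v → a < v → (v ≤ᵇ a) ≡ false × (a <ᵇ v) ≡ true
    above-below v lt = ≰⇒≤ᵇ≡ (<⇒≱ lt) , <⇒<ᵇ≡ lt

    rewritten : ∀ {T' ρ x x' i z} → Edited T T' ρ c x' i (suc c) z → hook x' ≡ hook x → arms x' ≡ removeOne a (arms x) →
                AF.Rewritten (at T) (at T') ρ c x x' i z a
    rewritten E hx ax = record { source = first ; target = second ; others = others ; hookˣ = hx ; arˣ = ax }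
      where open Edited E

    bumped : ∀ {k e'} (X : AG.Slide⊎Exit e c a k e') → Bumped T (armBump T) e' k (row X)
    bumped X with findArm-found | findMin-found X
    bumped {k} (inj₁ (i , S , refl)) | ρ , x , fa , Cx , a∈ | inj₁ (k<B , fm) with AR.present R i (suc c) k<B | i ≟ ρ
    ... | y , Cy | no ne = record
        { rep = subst (λ T' → AR.Rep (at T') _) (sym result) (AF.hook-elsewhere V S R Cx a∈ ne (rewritten E refl refl) refl (cong hook z≡)
                  (trans (cong legs z≡) (sym (cong (Maybe.maybe′ legs []) Cy))) (AF.kept k<B (cong arms z≡)))
        ; filled = λ f → subst NonEmpty (sym result) (Edited.filled E f)
        ; kept = λ _ → trans (cong (map length) result) (trans (lengths-modify _ i (suc c) _) (lengths-modify _ ρ c T))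
        ; grown = no-big k<B }
      where
      result = trans (armBump-into T fa fm) (if-false ne)
      E = modify₂ (λ y → addArm k (replaceA a k y)) (modify₁ {T} {ρ} {c} (removeArm a) Cx) (λ { (_ , ()) }) Cy
      z≡ = replaceA-hook a k y (proj₁ (AR.hooks R i (suc c) y Cy)) (no-arms Cy)
    ... | y , Cy | yes refl = record
        { rep = subst (λ T' → AR.Rep (at T') _) (sym result) (AF.hook-same-row (_≤ᵇ a) (a <ᵇ_) V S R Cx a∈ below-above above-below (rewritten E refl refl) refl
                  (cong (hook ∘ addLegs moved) z≡)
                  (subst Sorted (sym (cong (legs ∘ addLegs moved) z≡)) (sorted-insAll moved (proj₁ (AR.sorted R i (suc c) y Cy))))
                  (λ v → trans (cong (occ v ∘ legs ∘ addLegs moved) z≡) (trans (occ-insAll moved (legs y) v) (cong (λ m → occ v moved + occ v (Maybe.maybe′ legs [] m)) (sym Cy))))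
                  (AF.kept k<B (cong (arms ∘ addLegs moved) z≡)))
        ; filled = λ f → subst NonEmpty (sym result) (Edited.filled E f)
        ; kept = λ _ → trans (cong (map length) result) (trans (lengths-modify _ i (suc c) _) (trans (lengths-modify _ i c _) (trans (lengths-modify _ i (suc c) _) (lengths-modify _ i c T))))
        ; grown = no-big k<B }
      where
      moved = filterB (a <ᵇ_) (legs x)
      result = trans (armBump-into T fa fm) (if-true {m = i} refl)
      E = modify₂-again (keepLegsLE a) (addLegs moved) (λ { (_ , ()) })
            (modify₂ (λ y → addArm k (replaceA a k y)) (modify₁ {T} {i} {c} (removeArm a) Cx) (λ { (_ , ()) }) Cy)
      z≡ = replaceA-hook a k y (proj₁ (AR.hooks R i (suc c) y Cy)) (no-arms Cy)
    bumped {k} (inj₁ (i , S , refl)) | ρ , x , fa , Cx , a∈ | inj₂ (big , fm) with AF.target-absent R big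
    ... | none with column-end T {i} none (AF.column-before V S R) | rows-below T (AF.column-before V S R) | row-end T {i} none (AF.row-before V S R) | i ≟ ρ
    ...   | height | le | end | no ne = record
        { rep = subst (λ T' → AR.Rep (at T') _) (sym result) (AF.hook-elsewhere V S R Cx a∈ ne (rewritten E refl refl) refl refl
                  (sym (cong (Maybe.maybe′ legs []) none)) (AF.exited big refl))
        ; filled = λ f → subst NonEmpty (sym result) (Edited.filled E f)
        ; kept = λ k<B → no-big k<B big
        ; grown = λ _ → trans (cong (map length) result) (trans (lengths-append _ i _) (cong (growAt i) (lengths-modify _ ρ c T))) , le }
      where
      E₁ = modify₁ {T} {ρ} {c} (removeArm a) Cx
      E = append₂ (cell a [] []) E₁ le end (λ { (_ , ()) })
      result = trans (armBump-out T fa fm) (trans (if-false (ne ∘ trans (sym height))) (cong (λ h → appendAt (modifyCell ρ c (removeArm a) T) h (cell a [] [])) height))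
    ...   | height | le | end | yes refl = record
        { rep = subst (λ T' → AR.Rep (at T') _) (sym result) (AF.hook-same-row (_≤ᵇ a) (a <ᵇ_) V S R Cx a∈ below-above above-below (rewritten E refl refl) refl refl
                  (sorted-filter (a <ᵇ_) (proj₁ (AR.sorted R i c x Cx)))
                  (λ v → sym (trans (cong (λ m → occ v moved + occ v (Maybe.maybe′ legs [] m)) none) (+-identityʳ _)))
                  (AF.exited big refl))
        ; filled = λ f → subst NonEmpty (sym result) (Edited.filled E f)
        ; kept = λ k<B → no-big k<B big
        ; grown = λ _ → trans (cong (map length) result) (trans (lengths-append _ i _) (cong (growAt i) (trans (lengths-modify _ i c _) (lengths-modify _ i c T)))) , le }
      where
      moved = filterB (a <ᵇ_) (legs x)
      E₁ = modify₁-again (keepLegsLE a) (modify₁ {T} {i} {c} (removeArm a) Cx)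
      E = append₂ (cell a moved []) E₁ le end (λ { (_ , ()) })
      result = trans (armBump-out T fa fm) (trans (if-true height) (cong (λ h → appendAt (modifyCell i c (keepLegsLE a) (modifyCell i c (removeArm a) T)) h (cell a moved [])) height))
    -- A bumped leg is visible, so the search cannot have failed.
    bumped {k} (inj₂ (i , S)) | ρ , x , fa , Cx , a∈ | inj₂ (big , fm) = no-big (proj₂ (AD.GStep.leg∈ S)) big
    bumped {k} X@(inj₂ (i , S)) | ρ , x , fa , Cx , a∈ | inj₁ (k<B , fm) with bumped-entry X k<B
    ... | y , Cy , _ = record
        { rep = subst (λ T' → AR.Rep (at T') _) (sym result) (AF.leg-elsewhere V S R Cx a∈ Cy k∈ (rewritten E refl refl) refl (cong hook z≡) (cong legs z≡) (cong arms z≡))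
        ; filled = λ f → subst NonEmpty (sym result) (Edited.filled E f)
        ; kept = λ _ → trans (cong (map length) result) (trans (lengths-modify _ i (suc c) _) (lengths-modify _ ρ c T))
        ; grown = no-big k<B }
      where
      k∈ = AF.leg-present V S R Cy
      result = trans (armBump-into T fa fm) (if-false (AF.leg-row V S R Cx a∈))
      E = modify₂ (λ y → addArm k (replaceA a k y)) (modify₁ {T} {ρ} {c} (removeArm a) Cx) (λ { (_ , ()) }) Cy
      z≡ = replaceA-leg a k y (AF.leg-below V S R Cy) (no-arms Cy) k∈

  module LegStep {T e r l} (V : LD.Valid (e ᵗ)) (R : AR.Rep (at T) e) (P : LD.Particle (e ᵗ) r l) where
    Rᵗ : LR.Rep (Flipped T) (e ᵗ)
    Rᵗ = flip-rep T R

    open LR.OfParticle V Rᵗ P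

    findLeg-found : Σ ℕ λ κ → Σ Cell λ x → findLeg T ≡ just (r , κ , l , x) × at T r κ ≡ just x × 0 < occ l (legs x)
    findLeg-found with findLeg T | findLeg-picks T
    ... | nothing | none = ⊥-elim (some-arm λ j i x → none i j x)
    ... | just (i , j , a' , x) | eq , ne , eq' , top with particle-found eq ne eq' (λ j' i' → top i' j')
    ...   | refl , refl , l∈ = j , x , refl , eq , l∈

    q : ℕ → ℕ → Bool
    q i _ = i ≡ᵇ suc r

    p : ℕ → Bool
    p y = l <ᵇ y

    to-entry : ∀ y {v} → EntryOf legs arms y v → EntryOf arms legs y v
    to-entry y = Sum.map₂ Sum.swap

    from-entry : ∀ y {v} → EntryOf arms legs y v → EntryOf legs arms y v
    from-entry y = Sum.map₂ Sum.swap

    findMin-found : ∀ {k f} (X : LG.Slide⊎Exit (e ᵗ) r l k f) → (k < B × findMin q p T ≡ just (suc r , row X , k)) ⊎ (B ≤ k × findMin q p T ≡ nothing)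
    findMin-found {k} X with findMin q p T | findMin-smallest q p T
    ... | nothing | none = inj₂ (≮⇒≥ (λ k<B → found-exists X k<B λ j y v eq v∈ l<v →
            case trans (sym (none (suc r) j y eq (n≡ᵇn r) v (entry-occ y (from-entry y v∈)))) (<⇒<ᵇ≡ l<v) of λ ()) , refl)
    ... | just (i , j , k') | (y , eq , k'∈) , qi , pk , least' with ≡ᵇ≡⇒≡ {i} {suc r} qi
    ...   | refl with found-bumped X eq (to-entry y (entry-cases y k'∈)) (<ᵇ≡⇒< pk) least''
      where
      least'' : ∀ j' y' v → at T (suc r) j' ≡ just y' → EntryOf arms legs y' v → l < v → k' ≤ v × (j' < j → k' < v)
      least'' j' y' v eq' v∈ l<v with least' (suc r) j' y' eq' (n≡ᵇn r) v (entry-occ y' (from-entry y' v∈)) (<⇒<ᵇ≡ l<v)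
      ... | le , lt = le , λ j'<j → lt (inj₂ (refl , j'<j))
    ...     | refl , refl = inj₁ (found-fin X eq (to-entry y (entry-cases y k'∈)) (<ᵇ≡⇒< pk) , refl)

    below-above : ∀ v → v < l → (v <ᵇ l) ≡ true × (l ≤ᵇ v) ≡ false
    below-above v lt = <⇒<ᵇ≡ lt , ≰⇒≤ᵇ≡ (<⇒≱ lt)

    above-below : ∀ v → l ≤ v → (v <ᵇ l) ≡ false × (l ≤ᵇ v) ≡ true
    above-below v le = ≮⇒<ᵇ≡ (≤⇒≯ le) , ≤⇒≤ᵇ≡ le

    rewritten : ∀ {T' κ x x' j z} → Edited T T' r κ x' (suc r) j z → hook x' ≡ hook x → legs x' ≡ removeOne l (legs x) →
                LF.Rewritten (Flipped T) (Flipped T') κ r x x' j z l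
    rewritten E hx lx = record
      { source = first ; target = second ; others = λ j' i' ¬p ¬q → others i' j' (¬p ∘ swap) (¬q ∘ swap) ; hookˣ = hx ; arˣ = lx }
      where open Edited E

    bumped : ∀ {k f} (X : LG.Slide⊎Exit (e ᵗ) r l k f) → Bumped T (legBump T) (f ᵗ) k (suc r)
    bumped X with findLeg-found | findMin-found X
    bumped {k} {f} (inj₁ (j , S , refl)) | κ , x , fl , Cx , l∈ | inj₁ (k<B , fm) with LR.present Rᵗ j (suc r) k<B | j ≟ κ
    ... | y , Cy | no ne = record
        { rep = unflip-rep (legBump T) (subst (λ T' → LR.Rep (Flipped T') _) (sym result) (LF.hook-elsewhere V S Rᵗ Cx l∈ ne (rewritten E refl refl) refl (cong hook z≡)
                  (trans (cong arms z≡) (sym (cong (Maybe.maybe′ arms []) Cy))) (LF.kept k<B (cong legs z≡))))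
        ; filled = λ f → subst NonEmpty (sym result) (Edited.filled E f)
        ; kept = λ _ → trans (cong (map length) result) (trans (lengths-modify _ (suc r) j _) (lengths-modify _ r κ T))
        ; grown = no-big k<B }
      where
      result = trans (legBump-into T fl fm) (if-false ne)
      E = modify₂ (λ y → addLeg k (replaceL l k y)) (modify₁ {T} {r} {κ} (removeLeg l) Cx) (λ { (() , _) }) Cy
      z≡ = replaceL-hook l k y (proj₁ (LR.hooks Rᵗ j (suc r) y Cy)) (no-arms Cy)
    ... | y , Cy | yes refl = record
        { rep = unflip-rep (legBump T) (subst (λ T' → LR.Rep (Flipped T') _) (sym result) (LF.hook-same-row (_<ᵇ l) (l ≤ᵇ_) V S Rᵗ Cx l∈ below-above above-below (rewritten E refl refl) refl
                  (cong (hook ∘ addArms moved) z≡)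
                  (subst Sorted (sym (cong (arms ∘ addArms moved) z≡)) (sorted-insAll moved (proj₁ (LR.sorted Rᵗ j (suc r) y Cy))))
                  (λ v → trans (cong (occ v ∘ arms ∘ addArms moved) z≡) (trans (occ-insAll moved (arms y) v) (cong (λ m → occ v moved + occ v (Maybe.maybe′ arms [] m)) (sym Cy))))
                  (LF.kept k<B (cong (legs ∘ addArms moved) z≡))))
        ; filled = λ f → subst NonEmpty (sym result) (Edited.filled E f)
        ; kept = λ _ → trans (cong (map length) result) (trans (lengths-modify _ (suc r) j _) (trans (lengths-modify _ r j _) (trans (lengths-modify _ (suc r) j _) (lengths-modify _ r j T))))
        ; grown = no-big k<B }
      where
      moved = filterB (l ≤ᵇ_) (arms x)
      result = trans (legBump-into T fl fm) (if-true {m = j} refl)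
      E = modify₂-again (keepArmsLT l) (addArms moved) (λ { (() , _) })
            (modify₂ (λ y → addLeg k (replaceL l k y)) (modify₁ {T} {r} {j} (removeLeg l) Cx) (λ { (() , _) }) Cy)
      z≡ = replaceL-hook l k y (proj₁ (LR.hooks Rᵗ j (suc r) y Cy)) (no-arms Cy)
    bumped {k} (inj₁ (j , S , refl)) | κ , x , fl , Cx , l∈ | inj₂ (big , fm) with LF.target-absent Rᵗ big
    ... | none with row-end T {suc r} none (LF.column-before V S Rᵗ) | present-row T {r} Cx | j ≟ κ
    ...   | end | le | no ne = record
        { rep = unflip-rep (legBump T) (subst (λ T' → LR.Rep (Flipped T') _) (sym result) (LF.hook-elsewhere V S Rᵗ Cx l∈ ne (rewritten E refl refl) refl refl
                  (sym (cong (Maybe.maybe′ arms []) none)) (LF.exited big refl)))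
        ; filled = λ f → subst NonEmpty (sym result) (Edited.filled E f)
        ; kept = λ k<B → no-big k<B big
        ; grown = λ _ → trans (cong (map length) result) (trans (lengths-append _ (suc r) _) (cong (growAt (suc r)) (lengths-modify _ r κ T))) , le }
      where
      E₁ = modify₁ {T} {r} {κ} (removeLeg l) Cx
      E = append₂ (cell l [] []) E₁ le end (λ { (() , _) })
      result = trans (legBump-out T fl fm) (if-false (ne ∘ trans (sym end)))
    ...   | end | le | yes refl = record
        { rep = unflip-rep (legBump T) (subst (λ T' → LR.Rep (Flipped T') _) (sym result) (LF.hook-same-row (_<ᵇ l) (l ≤ᵇ_) V S Rᵗ Cx l∈ below-above above-below (rewritten E refl refl) refl refl
                  (sorted-filter (l ≤ᵇ_) (proj₁ (LR.sorted Rᵗ j r x Cx)))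
                  (λ v → sym (trans (cong (λ m → occ v moved + occ v (Maybe.maybe′ arms [] m)) none) (+-identityʳ _)))
                  (LF.exited big refl)))
        ; filled = λ f → subst NonEmpty (sym result) (Edited.filled E f)
        ; kept = λ k<B → no-big k<B big
        ; grown = λ _ → trans (cong (map length) result) (trans (lengths-append _ (suc r) _) (cong (growAt (suc r)) (trans (lengths-modify _ r j _) (lengths-modify _ r j T)))) , le }
      where
      moved = filterB (l ≤ᵇ_) (arms x)
      E₁ = modify₁-again (keepArmsLT l) (modify₁ {T} {r} {j} (removeLeg l) Cx)
      E = append₂ (cell l [] moved) E₁ le end (λ { (() , _) })
      result = trans (legBump-out T fl fm) (if-true end)
    bumped {k} (inj₂ (j , S)) | κ , x , fl , Cx , l∈ | inj₂ (big , fm) = no-big (proj₂ (LD.GStep.leg∈ S)) big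
    bumped {k} X@(inj₂ (j , S)) | κ , x , fl , Cx , l∈ | inj₁ (k<B , fm) with bumped-entry X k<B
    ... | y , Cy , _ = record
        { rep = unflip-rep (legBump T) (subst (λ T' → LR.Rep (Flipped T') _) (sym result)
                  (LF.leg-elsewhere V S Rᵗ Cx l∈ Cy k∈ (rewritten E refl refl) refl (cong hook z≡) (cong arms z≡) (cong legs z≡)))
        ; filled = λ f → subst NonEmpty (sym result) (Edited.filled E f)
        ; kept = λ _ → trans (cong (map length) result) (trans (lengths-modify _ (suc r) j _) (lengths-modify _ r κ T))
        ; grown = no-big k<B }
      where
      k∈ = LF.leg-present V S Rᵗ Cy
      result = trans (legBump-into T fl fm) (if-false (LF.leg-row V S Rᵗ Cx l∈))
      E = modify₂ (λ y → addLeg k (replaceL l k y)) (modify₁ {T} {r} {κ} (removeLeg l) Cx) (λ { (() , _) }) Cy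
      z≡ = replaceL-arm l k y (LF.leg-below V S Rᵗ Cy) (no-arms Cy) k∈

-- Uncrowding

iter-shift : ∀ {X : Set} (f : X → X) n x → iter f n (f x) ≡ iter f (suc n) x
iter-shift f zero x = refl
iter-shift f (suc n) x = cong f (iter-shift f n x)

filling-ext : ∀ {F F' : Filling} → map length F ≡ map length F' → (∀ i j → getQ F i j ≡ getQ F' i j) → F ≡ F'
filling-ext {[]} {[]} _ _ = refl
filling-ext {row ∷ F} {row' ∷ F'} len eq = cong₂ _∷_ (row-ext row row' (cong (λ ns → nth 0 ns 0) len) (eq 0)) (filling-ext (cong (Data.List.drop 1) len) (eq ∘ suc))
  where
  row-ext : ∀ (xs ys : List (Maybe Sym)) → length xs ≡ length ys → (∀ j → nth nothing xs j ≡ nth nothing ys j) → xs ≡ ys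
  row-ext [] [] _ _ = refl
  row-ext (x ∷ xs) (y ∷ ys) len eq = cong₂ _∷_ (eq 0) (row-ext xs ys (suc-injective len) (eq ∘ suc))

blank-lengths : ∀ T → map length (blank T) ≡ map length T
blank-lengths [] = refl
blank-lengths (row ∷ T) = cong₂ _∷_ (length-map _ row) (blank-lengths T)

blank-shows : ∀ T → Shows (blank T) []
blank-shows [] i j = refl
blank-shows (row ∷ T) zero j = go row j
  where
  go : ∀ (row : List Cell) j → nth {Maybe Sym} nothing (map (λ _ → nothing) row) j ≡ nothing
  go [] j = refl
  go (x ∷ row) zero = refl
  go (x ∷ row) (suc j) = go row j
blank-shows (row ∷ T) (suc i) j = blank-shows T i j

append-shows : ∀ Q {ch i j} s → i ≤ length Q → length (nth [] Q i) ≡ j → Shows Q ch → Shows (appendAt Q i (just s)) (ch ++ ((i , j) , s) ∷ [])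
append-shows Q {ch} {i} s le refl sh i' j' with (i , length (nth [] Q i)) ≟ᵖ (i' , j')
... | yes refl = trans (getQ-at (appendAt Q i (just s)) {i} (at-append-same Q (just s) le))
                       (sym (trans (look-++ʳ ch _ free) (look-here (i , length (nth [] Q i)) s [])))
  where
  free : look ch (i , length (nth [] Q i)) ≡ nothing
  free = trans (sym (sh i _)) (trans (getQ-nth? Q i _) (cong (Maybe.maybe′ id nothing) (nth?-end (nth [] Q i))))
... | no ne = trans (getQ-nth? (appendAt Q i (just s)) i' j') (trans (cong (Maybe.maybe′ id nothing) (at-append-other Q {i} (just s) le λ { (refl , refl) → ne refl }))
                (trans (sym (getQ-nth? Q i' j')) (trans (sh i' j') (sym (kept (look ch (i' , j')) refl)))))
  where
  kept : ∀ m → look ch (i' , j') ≡ m → look (ch ++ ((i , length (nth [] Q i)) , s) ∷ []) (i' , j') ≡ look ch (i' , j')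
  kept (just t) eq = trans (look-++ˡ ch _ eq) (sym eq)
  kept nothing eq = trans (look-++ʳ ch _ eq) (trans (look-there s [] ne) (sym eq))

label-arm : ∀ T {r c a x} → findArm T ≡ just (r , c , a , x) → label 𝒜 T ≡ just (α (suc c))
label-arm T eq rewrite eq = refl

label-leg : ∀ T {r c a x} → findLeg T ≡ just (r , c , a , x) → label ℒ T ≡ just (β (suc r))
label-leg T eq rewrite eq = refl

replicate-snoc : ∀ n (f : Letter) w → replicate n f ++ f ∷ w ≡ replicate (suc n) f ++ w
replicate-snoc zero f w = refl
replicate-snoc (suc n) f w = cong (f ∷_) (replicate-snoc n f w)

replicate-+ : ∀ m n (f : Letter) w → replicate m f ++ replicate n f ++ w ≡ replicate (m + n) f ++ w
replicate-+ zero n f w = refl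
replicate-+ (suc m) n f w = cong (f ∷_) (replicate-+ m n f w)

idle-steps : ∀ k {f w T₀ T Q} → locate f T ≡ nothing → Uncrowd w T₀ T Q → Uncrowd (replicate k f ++ w) T₀ T Q
idle-steps zero eq u = u
idle-steps (suc k) {f} {T = T} {Q} eq u = subst (Uncrowd _ _ T) unrecorded (next (idle-steps k eq u) (idle eq))
  where
  unrecorded : recordStep f T T Q ≡ Q
  unrecorded rewrite ≮⇒<ᵇ≡ (<-irrefl {size T} refl) = refl

module Running (B : ℕ) where
  open Bounded B
  open Bumping B
  open Shuffling B _≤_ _<_ ≤-< using (LegGrows; []; _∷_)
  open Grid B _≤_ _<_ ≤-< using (LegGrow)
  module AH = Half B _≤_ _<_ ≤-<

  -- `before` provides the minimality of the number of bumpings that `Apply` demands.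
  record Runs (f : Letter) (T : Tableau) (e' : Enc) (i : ℕ) : Set where
    field
      steps   : ℕ
      rep     : AR.Rep (at (iter (bump f) steps T)) e'
      filled  : NonEmpty (iter (bump f) steps T)
      lengths : map length (iter (bump f) steps T) ≡ growAt i (map length T)
      inside  : i ≤ length T
      before  : ∀ m → m < steps → map length (iter (bump f) m T) ≡ map length T

  runs-once : ∀ f {T e' k i} → NonEmpty T → B ≤ k → Bumped T (bump f T) e' k i → Runs f T e' i
  runs-once f ne big b = record { steps = 1 ; rep = rep ; filled = filled ne ; lengths = proj₁ (grown big) ; inside = proj₂ (grown big)
    ; before = λ { zero _ → refl ; (suc m) (s≤s ()) } }
    where open Bumped b

  runs-more : ∀ f {T e₁ e' k i₁ i} → k < B → Bumped T (bump f T) e₁ k i₁ → Runs f (bump f T) e' i → Runs f T e' i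
  runs-more f {T} k<B b r = record
    { steps = suc steps ; rep = subst (λ T' → AR.Rep (at T') _) shift rep ; filled = subst NonEmpty shift filled
    ; lengths = trans (cong (map length) (sym shift)) (trans lengths (cong (growAt _) (Bumped.kept b k<B)))
    ; inside = subst (_ ≤_) (trans (sym (length-map length (bump f T))) (trans (cong length (Bumped.kept b k<B)) (length-map length T))) inside
    ; before = λ { zero _ → refl ; (suc m) (s≤s m<) → trans (cong (map length) (sym (iter-shift (bump f) m T))) (trans (before m m<) (Bumped.kept b k<B)) } }
    where
    open Runs r
    shift = iter-shift (bump f) steps T

  arm-runs : ∀ {e c i j e' T} → AD.Valid e → AR.Rep (at T) e → NonEmpty T → AD.Grow e c i j e' → Runs 𝒜 T e' i
  arm-runs {T = T} V R ne (AD.exits (AD.exit S big)) = runs-once 𝒜 ne big (ArmStep.bumped {T} V R (AD.HStep.part S) (inj₁ (_ , S , refl)))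
  arm-runs {T = T} V R ne (AD.slides S G) with AG.split-slide S
  ... | a , k , X , k<B with ArmStep.bumped {T} V R (proj₁ (AG.pushes X)) X
  ...   | b = runs-more 𝒜 k<B b (arm-runs (AG.Slide-valid V S) (Bumped.rep b) (Bumped.filled b ne) G)

  leg-runs : ∀ {e r i j f T} → AD.Valid e → AR.Rep (at T) e → NonEmpty T → LD.Grow (e ᵗ) r j i f → Runs ℒ T (f ᵗ) i
  leg-runs {e} {T = T} V R ne (LD.exits (LD.exit S big)) = runs-once ℒ ne big (LegStep.bumped {T} {e} (Valid-ᵗ V) R (LD.HStep.part S) (inj₁ (_ , S , refl)))
  leg-runs {e} {T = T} V R ne (LD.slides {e₁ = g} S G) with LG.split-slide S
  ... | a , k , X , k<B with LegStep.bumped {T} {e} (Valid-ᵗ V) R (proj₁ (LG.pushes X)) X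
  ...   | b = runs-more ℒ k<B b (leg-runs {g ᵗ} (Valid-ᵗ (LG.Slide-valid (Valid-ᵗ V) S)) (Bumped.rep b) (Bumped.filled b ne) G)

  record State (T : Tableau) (e : Enc) (Q : Filling) (ch : Entries) : Set where
    field
      valid  : AD.Valid e
      rep    : AR.Rep (at T) e
      filled : NonEmpty T
      same   : map length Q ≡ map length T
      shows  : Shows Q ch

  one-step : ∀ {f T e Q ch i j e' s w T₀} → State T e Q ch → AD.Valid e' → Adds e i j e' → label f T ≡ just s → Runs f T e' i → Uncrowd w T₀ T Q →
             Σ Tableau λ T' → Σ Filling λ Q' → State T' e' Q' (ch ++ ((i , j) , s) ∷ []) × Uncrowd (f ∷ w) T₀ T' Q'
  one-step {f} {T} {e} {Q} {ch} {i} {j} {e'} {s} st V' ad lab r u = T' , Q' ,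
    record { valid = V' ; rep = Runs.rep r ; filled = Runs.filled r ; same = same' ; shows = append-shows Q {ch} s inQ endQ shows } ,
    subst (Uncrowd _ _ T') recorded (next u (grow steps grows minimal))
    where
    open State st
    open Runs r using (steps; lengths; inside; before)
    T' = iter (bump f) steps T
    Q' = appendAt Q i (just s)
    size-T' : size T' ≡ suc (size T)
    size-T' = trans (cong sum lengths) (sum-grow i (map length T))
    grows : size T < size T'
    grows = ≤-reflexive (sym size-T')
    minimal : ∀ m → m < steps → ¬ (size T < size (iter (bump f) m T))
    minimal m m< lt = <-irrefl refl (subst (size T <_) (cong sum (before m m<)) lt)
    inQ : i ≤ length Q
    inQ = subst (i ≤_) (trans (sym (length-map length T)) (trans (cong length (sym same)) (length-map length Q))) inside
    -- Hooks increase along rows in the new encoding, so the cells left of the new one are filled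
    -- there, and hence were filled before.
    end : length (nth [] T i) ≡ j
    end = row-end T {i} (AF.target-absent rep (Adds.before ad)) λ j' j'<j → AR.present rep i j' (case Adds.fresh ad i j' (≤-<-trans (AH.H-row V' i (<⇒≤ j'<j)) (Adds.after ad)) of λ
      { (inj₁ fin) → fin ; (inj₂ (_ , refl)) → ⊥-elim (<-irrefl refl j'<j) })
    endQ : length (nth [] Q i) ≡ j
    endQ = trans (row-lengths T Q same i) end
    same' : map length Q' ≡ map length T'
    same' = trans (lengths-append Q i (just s)) (trans (cong (growAt i) same) (sym lengths))
    recorded : recordStep f T T' Q ≡ Q'
    recorded rewrite <⇒<ᵇ≡ grows | lengths | firstDiff-grow i (map length T) (subst (i ≤_) (sym (length-map length T)) inside) | lab = refl

  arm-steps : ∀ {e ps e' T Q ch w T₀} → AD.Grows e ps e' → State T e Q ch → Uncrowd w T₀ T Q →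
              Σ Tableau λ T' → Σ Filling λ Q' → State T' e' Q' (ch ++ arm-entries ps) × Uncrowd (replicate (length ps) 𝒜 ++ w) T₀ T' Q'
  arm-steps {Q = Q} {ch} AD.[] st u = _ , Q , subst (State _ _ Q) (sym (++-identityʳ ch)) st , u
  arm-steps {T = T} {ch = ch} {w} (AD._∷_ {ps = ps} G Gs) st u with AG.grow-arms G
  ... | a , P , _ with ArmStep.findArm-found {T} (State.valid st) (State.rep st) P
  ...   | _ , _ , fa , _ with one-step st (AG.Grow-valid (State.valid st) G) (AG.Grow-adds G) (label-arm T fa) (arm-runs (State.valid st) (State.rep st) (State.filled st) G) u
  ...     | T₁ , Q₁ , st₁ , u₁ with arm-steps Gs st₁ u₁
  ...       | T' , Q' , st' , u' = T' , Q' , subst (State T' _ Q') (++-assoc ch _ _) st' ,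
                                  subst (λ w → Uncrowd w _ T' Q') (replicate-snoc (length ps) 𝒜 w) u'

  transpose-adds : ∀ {e i j f} → Adds (e ᵗ) j i (f ᵗ) → Adds e i j f
  transpose-adds ad = record { before = before ; after = after ; kept = λ i j → kept j i ; fresh = λ i j p → Sum.map₂ swap (fresh j i p) }
    where open Adds ad

  leg-steps : ∀ {e qs e' T Q ch w T₀} → LegGrows e qs e' → State T e Q ch → Uncrowd w T₀ T Q →
              Σ Tableau λ T' → Σ Filling λ Q' → State T' e' Q' (ch ++ leg-entries qs) × Uncrowd (replicate (length qs) ℒ ++ w) T₀ T' Q'
  leg-steps {Q = Q} {ch} [] st u = _ , Q , subst (State _ _ Q) (sym (++-identityʳ ch)) st , u
  leg-steps {e} {T = T} {ch = ch} {w} (_∷_ {e₁ = e₁} {qs} G Gs) st u with LG.grow-arms G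
  ... | l , P , _ with LegStep.findLeg-found {T} {e} (Valid-ᵗ (State.valid st)) (State.rep st) P
  ...   | _ , _ , fl , _ with one-step {e' = e₁} st (Valid-ᵗ (LG.Grow-valid (Valid-ᵗ (State.valid st)) G)) (transpose-adds {e} {f = e₁} (LG.Grow-adds G)) (label-leg T fl)
                                 (leg-runs {e} (State.valid st) (State.rep st) (State.filled st) G) u
  ...     | T₁ , Q₁ , st₁ , u₁ with leg-steps Gs st₁ u₁
  ...       | T' , Q' , st' , u' = T' , Q' , subst (State T' _ Q') (++-assoc ch _ _) st' ,
                                  subst (λ w → Uncrowd w _ T' Q') (replicate-snoc (length qs) ℒ w) u'

  no-arm-found : ∀ {T e} → AR.Rep (at T) e → Listed (A e) 0 → findArm T ≡ nothing
  no-arm-found {T} R ls with findArm T | findArm-picks T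
  ... | nothing | _ = refl
  ... | just _ | eq , ne , _ = case AR.cell-arm R eq (occ-max ne) of λ (p , v<B) → ⊥-elim (listed-zero ls v<B p)

  no-leg-found : ∀ {T e} → AR.Rep (at T) e → Listed (L e) 0 → findLeg T ≡ nothing
  no-leg-found {T} {e} R ls with findLeg T | findLeg-picks T
  ... | nothing | _ = refl
  ... | just _ | eq , ne , _ = case LR.cell-arm (flip-rep T {e} R) eq (occ-max ne) of λ (p , v<B) → ⊥-elim (listed-zero ls v<B p)

  -- Once nothing is left to move, further letters are idle, so any exponent from the number of
  -- growths on gives the same result.
  padded : ∀ {f w T₀ T Q} M n → n ≤ M → locate f T ≡ nothing → Uncrowd (replicate n f ++ w) T₀ T Q → Uncrowd (replicate M f ++ w) T₀ T Q
  padded {f} {w} M n n≤M eq u = subst (λ w → Uncrowd w _ _ _) (trans (replicate-+ (M ∸ n) n f w) (cong (λ k → replicate k f ++ w) (m∸n+n≡m n≤M))) (idle-steps (M ∸ n) eq u)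

-- Encoding a hook-valued tableau

cellAt-at : ∀ T i j → cellAt T i j ≡ at T i j
cellAt-at T i j = go (nth [] T i) j
  where
  go : ∀ row j → nth nothing (map just row) j ≡ nth? {Cell} row j
  go [] j = refl
  go (x ∷ row) zero = refl
  go (x ∷ row) (suc j) = go row j

occ-Any : ∀ {v} xs → 0 < occ v xs → Any (v ≡_) xs
occ-Any {v} (x ∷ xs) p with x ≟ v
... | yes refl = here refl
... | no ne = there (occ-Any xs p)

nth?-pred : ∀ {X : Set} (xs : List X) {j x} → nth? xs (suc j) ≡ just x → Σ X λ y → nth? xs j ≡ just y
nth?-pred (y ∷ xs) {zero} eq = y , refl
nth?-pred (y ∷ xs) {suc j} eq = nth?-pred xs eq

allEntries : List (ℕ × ℕ × Cell) → List ℕ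
allEntries [] = []
allEntries ((_ , _ , x) ∷ zs) = entries x ++ allEntries zs

entries-all : ∀ zs {i j x v} → (i , j , x) ∈ zs → 0 < occ v (entries x) → 0 < occ v (allEntries zs)
entries-all ((_ , _ , x) ∷ zs) {v = v} (here refl) p = subst (0 <_) (sym (occ-++ (entries x) _ v)) (m≤n⇒m≤n+o _ p)
entries-all ((_ , _ , y) ∷ zs) {v = v} (there q) p = subst (0 <_) (sym (occ-++ (entries y) _ v)) (m≤n⇒m≤o+n (occ v (entries y)) (entries-all zs q p))

interval-unique : ∀ {f : ℕ → ℕ} → (∀ n → f n ≤ f (suc n)) → ∀ {v m n} → f m < v → v ≤ f (suc m) → f n < v → v ≤ f (suc n) → m ≡ n
interval-unique mono {v} {m} {n} p q p' q' with <-cmp m n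
... | tri< lt _ _ = ⊥-elim (<⇒≱ p' (≤-trans q (monotone mono lt)))
... | tri≈ _ eq _ = eq
... | tri> _ _ gt = ⊥-elim (<⇒≱ p (≤-trans q' (monotone mono gt)))

interval-unique′ : ∀ {f : ℕ → ℕ} → (∀ n → f n ≤ f (suc n)) → ∀ {v m n} → f m ≤ v → v < f (suc m) → f n ≤ v → v < f (suc n) → m ≡ n
interval-unique′ mono {v} {m} {n} p q p' q' with <-cmp m n
... | tri< lt _ _ = ⊥-elim (<⇒≱ q (≤-trans (monotone mono lt) p'))
... | tri≈ _ eq _ = eq
... | tri> _ _ gt = ⊥-elim (<⇒≱ q' (≤-trans (monotone mono gt) p))

occ? : (Cell → List ℕ) → ℕ → Maybe Cell → ℕ
occ? sel v m = Maybe.maybe′ (λ x → occ v (sel x)) 0 m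

rowTotal : List Cell → ℕ → ℕ
rowTotal [] v = 0
rowTotal (x ∷ row) v = occ v (legs x) + rowTotal row v

columnTotal : Tableau → ℕ → ℕ → ℕ
columnTotal [] j v = 0
columnTotal (row ∷ T) j v = occ? arms v (nth? row j) + columnTotal T j v

rowTotal-pos : ∀ row {v} → 0 < rowTotal row v → Σ ℕ λ j → 0 < occ? legs v (nth? row j)
rowTotal-pos (x ∷ row) {v} p with 0 <? occ v (legs x)
... | yes q = 0 , q
... | no ¬q = case rowTotal-pos row (subst (λ z → 0 < z + rowTotal row v) (¬0<⇒≡0 ¬q) p) of λ (j , q) → suc j , q

columnTotal-pos : ∀ T {j v} → 0 < columnTotal T j v → Σ ℕ λ i → 0 < occ? arms v (at T i j)
columnTotal-pos (row ∷ T) {j} {v} p with 0 <? occ? arms v (nth? row j)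
... | yes q = 0 , q
... | no ¬q = case columnTotal-pos T (subst (λ z → 0 < z + columnTotal T j v) (¬0<⇒≡0 ¬q) p) of λ (i , q) → suc i , q

rowTotal-zero : ∀ row {v} → (∀ j → occ? legs v (nth? row j) ≡ 0) → rowTotal row v ≡ 0
rowTotal-zero [] z = refl
rowTotal-zero (x ∷ row) z = cong₂ _+_ (z 0) (rowTotal-zero row (z ∘ suc))

columnTotal-zero : ∀ T {j v} → (∀ i → occ? arms v (at T i j) ≡ 0) → columnTotal T j v ≡ 0
columnTotal-zero [] z = refl
columnTotal-zero (row ∷ T) z = cong₂ _+_ (z 0) (columnTotal-zero T (z ∘ suc))

rowTotal-only : ∀ row {v} j → (∀ j' → j' ≢ j → occ? legs v (nth? row j') ≡ 0) → rowTotal row v ≡ occ? legs v (nth? row j)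
rowTotal-only [] j z = refl
rowTotal-only (x ∷ row) {v} zero z = trans (cong (occ v (legs x) +_) (rowTotal-zero row λ j → z (suc j) λ ())) (+-identityʳ _)
rowTotal-only (x ∷ row) (suc j) z = trans (cong (_+ _) (z 0 λ ())) (rowTotal-only row j λ j' ne → z (suc j') (ne ∘ suc-injective))

columnTotal-only : ∀ T {j v} i → (∀ i' → i' ≢ i → occ? arms v (at T i' j) ≡ 0) → columnTotal T j v ≡ occ? arms v (at T i j)
columnTotal-only [] i z = refl
columnTotal-only (row ∷ T) {j} {v} zero z = trans (cong (occ? arms v (nth? row j) +_) (columnTotal-zero T λ i → z (suc i) λ ())) (+-identityʳ _)
columnTotal-only (row ∷ T) (suc i) z = trans (cong (_+ _) (z 0 λ ())) (columnTotal-only T i λ i' ne → z (suc i') (ne ∘ suc-injective))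

count-++ : ∀ xs ys j v → count (xs ++ ys) j v ≡ count xs j v + count ys j v
count-++ [] ys j v = refl
count-++ ((i , k) ∷ xs) ys j v = trans (cong (δ i k j v +_) (count-++ xs ys j v)) (sym (+-assoc (δ i k j v) _ _))

count-line : ∀ i vs v → count (map (i ,_) vs) i v ≡ occ v vs
count-line i [] v = refl
count-line i (k ∷ vs) v = cong₂ _+_ (δ-one i k v) (count-line i vs v)

count-off-line : ∀ {i j} vs v → i ≢ j → count (map (i ,_) vs) j v ≡ 0
count-off-line [] v ne = refl
count-off-line (k ∷ vs) v ne = cong₂ _+_ (δ-miss (ne ∘ proj₁)) (count-off-line vs v ne)

armsOfRow : ℕ → List Cell → List (ℕ × ℕ)
armsOfRow j [] = []
armsOfRow j (x ∷ row) = map (j ,_) (arms x) ++ armsOfRow (suc j) row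

armList : Tableau → List (ℕ × ℕ)
armList [] = []
armList (row ∷ T) = armsOfRow 0 row ++ armList T

legsOfRow : ℕ → List Cell → List (ℕ × ℕ)
legsOfRow i [] = []
legsOfRow i (x ∷ row) = map (i ,_) (legs x) ++ legsOfRow i row

legList : ℕ → Tableau → List (ℕ × ℕ)
legList i [] = []
legList i (row ∷ T) = legsOfRow i row ++ legList (suc i) T

count-armsOfRow-low : ∀ row {m j} v → j < m → count (armsOfRow m row) j v ≡ 0
count-armsOfRow-low [] v lt = refl
count-armsOfRow-low (x ∷ row) {m} {j} v lt = trans (count-++ (map (m ,_) (arms x)) _ j v)
  (cong₂ _+_ (count-off-line (arms x) v (>⇒≢ lt)) (count-armsOfRow-low row v (m≤n⇒m≤1+n lt)))

count-armsOfRow : ∀ row m d v → count (armsOfRow m row) (d + m) v ≡ occ? arms v (nth? row d)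
count-armsOfRow [] m d v = refl
count-armsOfRow (x ∷ row) m zero v = trans (count-++ (map (m ,_) (arms x)) _ m v)
  (trans (cong₂ _+_ (count-line m (arms x) v) (count-armsOfRow-low row v ≤-refl)) (+-identityʳ _))
count-armsOfRow (x ∷ row) m (suc d) v = trans (count-++ (map (m ,_) (arms x)) _ (suc d + m) v)
  (cong₂ _+_ (count-off-line (arms x) v (<⇒≢ (s≤s (m≤n+m m d))))
    (subst (λ j → count (armsOfRow (suc m) row) j v ≡ occ? arms v (nth? row d)) (+-suc d m) (count-armsOfRow row (suc m) d v)))

count-armList : ∀ T j v → count (armList T) j v ≡ columnTotal T j v
count-armList [] j v = refl
count-armList (row ∷ T) j v = trans (count-++ (armsOfRow 0 row) _ j v)
  (cong₂ _+_ (subst (λ k → count (armsOfRow 0 row) k v ≡ occ? arms v (nth? row j)) (+-identityʳ j) (count-armsOfRow row 0 j v)) (count-armList T j v))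

count-legsOfRow : ∀ row i v → count (legsOfRow i row) i v ≡ rowTotal row v
count-legsOfRow [] i v = refl
count-legsOfRow (x ∷ row) i v = trans (count-++ (map (i ,_) (legs x)) _ i v) (cong₂ _+_ (count-line i (legs x) v) (count-legsOfRow row i v))

count-legsOfRow-off : ∀ row {i j} v → i ≢ j → count (legsOfRow i row) j v ≡ 0
count-legsOfRow-off [] v ne = refl
count-legsOfRow-off (x ∷ row) {i} {j} v ne = trans (count-++ (map (i ,_) (legs x)) _ j v) (cong₂ _+_ (count-off-line (legs x) v ne) (count-legsOfRow-off row v ne))

count-legList-low : ∀ T {m i} v → i < m → count (legList m T) i v ≡ 0
count-legList-low [] v lt = refl
count-legList-low (row ∷ T) {m} {i} v lt = trans (count-++ (legsOfRow m row) _ i v) (cong₂ _+_ (count-legsOfRow-off row v (>⇒≢ lt)) (count-legList-low T v (m≤n⇒m≤1+n lt)))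

count-legList : ∀ T m d v → count (legList m T) (d + m) v ≡ rowTotal (nth [] T d) v
count-legList [] m d v = refl
count-legList (row ∷ T) m zero v = trans (count-++ (legsOfRow m row) _ m v)
  (trans (cong₂ _+_ (count-legsOfRow row m v) (count-legList-low T v ≤-refl)) (+-identityʳ _))
count-legList (row ∷ T) m (suc d) v = trans (count-++ (legsOfRow m row) _ (suc d + m) v)
  (cong₂ _+_ (count-legsOfRow-off row v (<⇒≢ (s≤s (m≤n+m m d))))
    (subst (λ i → count (legList (suc m) T) i v ≡ rowTotal (nth [] T d) v) (+-suc d m) (count-legList T (suc m) d v)))

length-armList : ∀ T → length (armList T) ≡ numArms T
length-armList [] = refl
length-armList (row ∷ T) = trans (length-++ (armsOfRow 0 row)) (cong₂ _+_ (go 0 row) (length-armList T))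
  where
  go : ∀ m row → length (armsOfRow m row) ≡ sum (map (λ x → length (arms x)) row)
  go m [] = refl
  go m (x ∷ row) = trans (length-++ (map (m ,_) (arms x))) (cong₂ _+_ (length-map _ (arms x)) (go (suc m) row))

length-legList : ∀ m T → length (legList m T) ≡ numLegs T
length-legList m [] = refl
length-legList m (row ∷ T) = trans (length-++ (legsOfRow m row)) (cong₂ _+_ (go row) (length-legList (suc m) T))
  where
  go : ∀ row → length (legsOfRow m row) ≡ sum (map (λ x → length (legs x)) row)
  go [] = refl
  go (x ∷ row) = trans (length-++ (map (m ,_) (legs x))) (cong₂ _+_ (length-map _ (legs x)) (go row))

count-small : ∀ {B} xs → (∀ j v → 0 < count xs j v → v < B) → All (λ p → proj₂ p < B) xs
count-small [] small = []
count-small ((i , k) ∷ xs) small = small i k (count-head i k xs) ∷ count-small xs λ j v p → small j v (count-tail i k xs p)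

module Encoding (T : Tableau) (HV : HookValued T) where
  open HookValued HV

  B : ℕ
  B = suc (maxList (allEntries (cellsOf T)))

  open Bounded B
  open Bumping B
  open Running B

  -- The fictitious hooks `B + i` are constant along rows and strictly increasing up the columns, as
  -- weak rows and strict columns require; a constant would violate `col`.
  e₀ : Enc
  e₀ = enc (λ i j → Maybe.maybe′ hook (B + i) (at T i j)) (columnTotal T) (λ i → rowTotal (nth [] T i))

  entry-small : ∀ {i j x v} → at T i j ≡ just x → EntryOf legs arms x v → v < B
  entry-small {i} {j} {x} eq v∈ = s≤s (maxList-≤ (allEntries (cellsOf T)) (entries-all (cellsOf T) (∈-cellsOf⁺ {i = i} {j} T eq) (entry-occ x v∈)))

  H-just : ∀ i j {x} → at T i j ≡ just x → H e₀ i j ≡ hook x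
  H-just i j eq = cong (Maybe.maybe′ hook (B + i)) eq

  H-nothing : ∀ i j → at T i j ≡ nothing → H e₀ i j ≡ B + i
  H-nothing i j eq = cong (Maybe.maybe′ hook (B + i)) eq

  ∈-entries : ∀ x {v} → EntryOf legs arms x v → Any (v ≡_) (entries x)
  ∈-entries x v∈ = occ-Any (entries x) (entry-occ x v∈)

  to-cellAt : ∀ i j {x} → at T i j ≡ just x → cellAt T i j ≡ just x
  to-cellAt i j = trans (cellAt-at T i j)

  right-bound : ∀ i j {x v} → at T i j ≡ just x → EntryOf legs arms x v → v ≤ H e₀ i (suc j)
  right-bound i j {x} {v} eq v∈ with at T i (suc j) in eq'
  ... | just y = rowWeak i j x y (to-cellAt i j eq) (to-cellAt i (suc j) eq') v (hook y) (∈-entries x v∈) (here refl)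
  ... | nothing = ≤-trans (<⇒≤ (entry-small {i} {j} eq v∈)) (m≤m+n B i)

  upper-bound : ∀ i j {x v} → at T i j ≡ just x → EntryOf legs arms x v → v < H e₀ (suc i) j
  upper-bound i j {x} {v} eq v∈ with at T (suc i) j in eq'
  ... | just y = colStrict i j x y (to-cellAt i j eq) (to-cellAt (suc i) j eq') v (hook y) (∈-entries x v∈) (here refl)
  ... | nothing = <-≤-trans (entry-small {i} {j} eq v∈) (m≤m+n B (suc i))

  row₀ : ∀ i j → H e₀ i j ≤ H e₀ i (suc j)
  row₀ i j with at T i j in eq
  ... | just x = right-bound i j eq (inj₁ refl)
  ... | nothing with at T i (suc j) in eq'
  ...   | nothing = ≤-refl
  ...   | just y = case trans (sym eq) (proj₂ (nth?-pred (nth [] T i) eq')) of λ ()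

  col₀ : ∀ i j → H e₀ i j < H e₀ (suc i) j
  col₀ i j with at T i j in eq
  ... | just x = upper-bound i j eq (inj₁ refl)
  ... | nothing with at T (suc i) j in eq'
  ...   | nothing = ≤-reflexive (sym (+-suc B i))
  ...   | just y = case trans (sym eq) (proj₂ (<-nth? (nth [] T i) (<-≤-trans (nth?-< (nth [] T (suc i)) eq') (rowsDecr i)))) of λ ()

  num-cell : ∀ sel i j v → 0 < occ? sel v (at T i j) → Σ Cell λ x → at T i j ≡ just x × 0 < occ v (sel x)
  num-cell sel i j v p with at T i j
  ... | just x = x , refl , p

  sorted-hook : ∀ {R : ℕ → ℕ → Set} → (∀ {x y z} → R x y → R y z → R x z) → ∀ {h xs} → Linked R (h ∷ xs) → All (R h) xs × AllPairs R xs
  sorted-hook tr l with Linked⇒AllPairs tr l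
  ... | h ∷ s = h , s

  legs-above-hook : ∀ {i j x} → at T i j ≡ just x → All (hook x <_) (legs x) × AllPairs _<_ (legs x)
  legs-above-hook {i} {j} {x} eq = sorted-hook <-trans (legsIncr i j x (to-cellAt i j eq))

  arms-above-hook : ∀ {i j x} → at T i j ≡ just x → All (hook x ≤_) (arms x) × AllPairs _≤_ (arms x)
  arms-above-hook {i} {j} {x} eq = sorted-hook ≤-trans (armsWeak i j x (to-cellAt i j eq))

  legOut₀ : ∀ i j v → 0 < occ? legs v (at T i j) → H e₀ i j < v × v ≤ H e₀ i (suc j) × v < B
  legOut₀ i j v p with num-cell legs i j v p
  ... | x , eq , v∈ = subst (_< v) (sym (H-just i j eq)) (occ-All (legs x) (proj₁ (legs-above-hook {i} {j} eq)) v∈) ,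
                      right-bound i j eq (inj₂ (inj₁ v∈)) , entry-small {i} {j} eq (inj₂ (inj₁ v∈))

  armOut₀ : ∀ i j v → 0 < occ? arms v (at T i j) → H e₀ i j ≤ v × v < H e₀ (suc i) j × v < B
  armOut₀ i j v p with num-cell arms i j v p
  ... | x , eq , v∈ = subst (_≤ v) (sym (H-just i j eq)) (occ-All (arms x) (proj₁ (arms-above-hook {i} {j} eq)) v∈) ,
                      upper-bound i j eq (inj₂ (inj₂ v∈)) , entry-small {i} {j} eq (inj₂ (inj₂ v∈))

  -- The ranges of different cells of the row are disjoint, so no other cell contributes to the
  -- total.
  legIn₀ : ∀ i j v → H e₀ i j < v → v ≤ H e₀ i (suc j) → v < B → occ? legs v (at T i j) ≡ L e₀ i v
  legIn₀ i j v p q _ = sym (rowTotal-only (nth [] T i) j λ j' ne → ¬0<⇒≡0 λ r →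
    let (p' , q' , _) = legOut₀ i j' v r in ne (interval-unique {H e₀ i} (row₀ i) p' q' p q))

  armIn₀ : ∀ i j v → H e₀ i j ≤ v → v < H e₀ (suc i) j → v < B → occ? arms v (at T i j) ≡ A e₀ j v
  armIn₀ i j v p q _ = sym (columnTotal-only T i λ i' ne → ¬0<⇒≡0 λ r →
    let (p' , q' , _) = armOut₀ i' j v r in ne (interval-unique′ {λ i → H e₀ i j} (λ i → <⇒≤ (col₀ i j)) p' q' p q))

  occ-strict : ∀ {v} xs → AllPairs _<_ xs → ¬ 2 ≤ occ v xs
  occ-strict {v} (x ∷ xs) (x< ∷ s) p with x ≟ v
  ... | yes refl = <-irrefl refl (occ-All xs x< (≤-pred p))
  ... | no _ = occ-strict xs s p

  -- All copies of `v` in the row lie in one cell, whose legs increase strictly.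
  leg²₀ : ∀ i v → ¬ 2 ≤ L e₀ i v
  leg²₀ i v p with rowTotal-pos (nth [] T i) (<⇒≤ p)
  ... | j , r with legOut₀ i j v r | num-cell legs i j v r
  ...   | q , s , t | x , eq , _ = occ-strict (legs x) (proj₂ (legs-above-hook {i} {j} eq)) (subst (2 ≤_) (trans (sym (legIn₀ i j v q s t)) (cong (occ? legs v) eq)) p)

  valid₀ : AD.Valid e₀
  valid₀ = record
    { row = row₀ ; col = col₀
    ; arm = λ j v (p , _) → case columnTotal-pos T p of λ (i , r) → let (q , s , _) = armOut₀ i j v r ; (x , eq , v∈) = num-cell arms i j v r in
        i , q , s , right-bound i j eq (inj₂ (inj₂ v∈))
    ; leg = λ i v (p , _) → case rowTotal-pos (nth [] T i) p of λ (j , r) → let (q , s , _) = legOut₀ i j v r ; (x , eq , v∈) = num-cell legs i j v r in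
        j , q , s , upper-bound i j eq (inj₂ (inj₁ v∈))
    ; arm² = λ _ _ _ _ → ≤-refl ; leg² = λ i v _ p → ⊥-elim (leg²₀ i v p) }

  rep₀ : AR.Rep (at T) e₀
  rep₀ = record
    { hooks = λ i j x eq → sym (H-just i j eq) , subst (_< B) (sym (H-just i j eq)) (entry-small {i} {j} eq (inj₁ refl))
    ; absent = λ i j eq → subst (B ≤_) (sym (H-nothing i j eq)) (m≤m+n B i)
    ; sorted = λ i j x eq → AllPairs.map <⇒≤ (proj₂ (legs-above-hook {i} {j} eq)) , proj₂ (arms-above-hook {i} {j} eq)
    ; local = record { legIn = legIn₀ ; legOut = legOut₀ ; armIn = armIn₀ ; armOut = armOut₀ } }

  filled₀ : NonEmpty T
  filled₀ = go T rowsNonEmpty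
    where
    go : ∀ (T : Tableau) → (∀ i → i < length T → 1 ≤ length (nth [] T i)) → NonEmpty T
    go [] _ = []
    go (row ∷ T) ne = (λ { refl → case ne 0 (s≤s z≤n) of λ () }) ∷ go T λ i lt → ne (suc i) (s≤s lt)

  state₀ : State T e₀ (blank T) []
  state₀ = record { valid = valid₀ ; rep = rep₀ ; filled = filled₀ ; same = blank-lengths T ; shows = blank-shows T }

  arms₀ : Listed (A e₀) (numArms T)
  arms₀ = listed (armList T) (length-armList T)
    (count-small (armList T) λ j v p → case columnTotal-pos T (subst (0 <_) (count-armList T j v) p) of λ (i , r) → proj₂ (proj₂ (armOut₀ i j v r)))
    λ j v _ → sym (count-armList T j v)

  legCounts : ∀ i v → count (legList 0 T) i v ≡ L e₀ i v
  legCounts i v = subst (λ k → count (legList 0 T) k v ≡ rowTotal (nth [] T i) v) (+-identityʳ i) (count-legList T 0 i v)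

  legs₀ : Listed (L e₀) (numLegs T)
  legs₀ = listed (legList 0 T) (length-legList 0 T)
    (count-small (legList 0 T) λ i v p → case rowTotal-pos (nth [] T i) (subst (0 <_) (legCounts i v) p) of λ (j , r) → proj₂ (proj₂ (legOut₀ i j v r)))
    λ i v _ → sym (legCounts i v)

  narrow₀ : Narrow e₀
  narrow₀ = length (nth [] T 0) , λ i j le → big i j le
    where
    short : ∀ i → length (nth [] T i) ≤ length (nth [] T 0)
    short zero = ≤-refl
    short (suc i) = ≤-trans (rowsDecr i) (short i)
    big : ∀ i j → length (nth [] T 0) ≤ j → B ≤ H e₀ i j
    big i j le with at T i j in eq
    ... | nothing = m≤m+n B i
    ... | just x = ⊥-elim (<⇒≱ (nth?-< (nth [] T i) eq) (≤-trans (short i) le))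

  low₀ : Narrow (e₀ ᵗ)
  low₀ = length T , λ j i le → big i j le
    where
    big : ∀ i j → length T ≤ i → B ≤ H e₀ i j
    big i j le with at T i j in eq
    ... | nothing = m≤m+n B i
    ... | just x = ⊥-elim (<⇒≱ (present-row T {i} eq) le)

-- Comparison of the two orders of uncrowding

module Main (T : Tableau) (HV : HookValued T) where
  open Encoding T HV
  open Bounded B
  open Bumping B
  open Running B
  open Shuffling B _≤_ _<_ ≤-<
  module DN = Defn _<_ _≤_

  leg-grows : ∀ {e ps f} → DN.Grows (e ᵗ) ps f → Σ (List (ℕ × Pos)) λ qs → LegGrows e qs (f ᵗ) × length qs ≡ length ps
  leg-grows DN.[] = [] , [] , refl
  leg-grows (DN._∷_ {e₁ = g} G Gs) with leg-grows {g ᵗ} Gs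
  ... | qs , Rs , len = _ ∷ qs , G ∷ Rs , cong suc len

  strip-length : ∀ {c e e₁ x qs qs₀ x' e₂ e₃} → Strip c e e₁ x qs qs₀ x' e₂ e₃ → length qs ≡ length qs₀
  strip-length [] = refl
  strip-length (cons _ _ _ _ st) = cong suc (strip-length st)

  weave-length : ∀ {e ps e₁ qs qs₀ ps' e₂ e₃} → Weave e ps e₁ qs qs₀ ps' e₂ e₃ → length qs ≡ length qs₀ × length ps' ≡ length ps
  weave-length ([] _) = refl , refl
  weave-length (cons _ st _ w) with weave-length w
  ... | p , q = trans p (strip-length st) , cong suc q

  legs-keep-arms : ∀ {e qs e' n} → LegGrows e qs e' → Listed (A e) n → Listed (A e') n
  legs-keep-arms [] ls = ls
  legs-keep-arms (R ∷ Rs) ls = legs-keep-arms Rs (LG.grow-legs R ls)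

  unique : ∀ {P P' e} → AR.Rep (at P) e → AR.Rep (at P') e → NonEmpty P → NonEmpty P' → P ≡ P'
  unique {P} {P'} R R' ne ne' = at-ext ne ne' (AR.rep-unique {at P} {at P'} (λ { (cell _ _ _) (cell _ _ _) refl refl refl → refl }) R R')

  theorem : ∀ M N → numArms T ≤ M → numLegs T ≤ N →
    Σ Tableau λ P → Σ Filling λ Q₁ → Σ Filling λ Q₂ →
      Uncrowd (replicate N ℒ ++ replicate M 𝒜) T P Q₁ × Uncrowd (replicate M 𝒜 ++ replicate N ℒ) T P Q₂ × Shuff Q₁ Q₂
  theorem M N arms≤ legs≤ with AG.grows-exist (numArms T) valid₀ narrow₀ arms₀
    | LG.grows-exist (numLegs T) (Valid-ᵗ valid₀) low₀ legs₀
  ... | ps , eA , Gs , len-ps , no-arms | _ , f , Rsᵗ , len-qsᵗ , no-legs with leg-grows {e₀} Rsᵗ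
  ...   | qs₀ , Rs , len-qs₀ with weave-exists valid₀ Gs Rs
  ...     | qs , ps' , e₃ , weave , Rs' , Gs' with weave-length weave
  ...       | len-qs , len-ps' with arm-steps Gs state₀ done | leg-steps Rs state₀ done
  ...         | TA , QA , stA , uA | TL , QL , stL , uL with leg-steps Rs' stA uA' | arm-steps Gs' stL uL'
    where
    uA' : Uncrowd (replicate M 𝒜) T TA QA
    uA' = subst (λ w → Uncrowd w T TA QA) (++-identityʳ _) (padded M (length ps) (subst (_≤ M) (sym len-ps) arms≤) (no-arm-found {TA} (State.rep stA) no-arms) uA)
    uL' : Uncrowd (replicate N ℒ) T TL QL
    uL' = subst (λ w → Uncrowd w T TL QL) (++-identityʳ _)
            (padded N (length qs₀) (subst (_≤ N) (sym (trans len-qs₀ len-qsᵗ)) legs≤) (no-leg-found {TL} (State.rep stL) no-legs) uL)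
  -- Both results represent the same corner `e₃` of the growth diagram and are therefore the same
  -- list of rows.
  ...           | P , Q₁ , st₁ , u₁ | P' , Q₂ , st₂ , u₂ with unique {P} {P'} (State.rep st₁) (State.rep st₂) (State.filled st₁) (State.filled st₂)
  -- The creation list of `Q₁` has all α before all β; weaving turns it into that of `Q₂`. No α
  -- precedes the first one, hence the empty `pre`.
  ...             | refl with weaving {[]} {F = Q₁} valid₀ weave (λ ()) (nothing-earlier ps) (State.shows st₁)
    where
    nothing-earlier : ∀ ps → All (Earlier []) ps
    nothing-earlier [] = []
    nothing-earlier (p ∷ ps) = (λ ()) ∷ nothing-earlier ps
  -- Swaps preserve the row lengths, so agreement at every position identifies the shuffled filling
  -- with `Q₂`.
  ...               | F , (n , reach) , shF , lenF with filling-ext {F} {Q₂} (trans lenF (trans (State.same st₁) (sym (State.same st₂))))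
                                                           (λ i j → trans (shF i j) (sym (State.shows st₂ i j)))
  ...                 | refl = P , Q₁ , F ,
    -- That no leg is left in `P` is seen from the opposite order: there the legs are exhausted
    -- first, and arm growths preserve their number. The next line uses the dual argument for arms.
    padded N (length qs) (subst (_≤ N) (sym (trans len-qs (trans len-qs₀ len-qsᵗ))) legs≤)
      (no-leg-found {P} (State.rep st₁) (AG.grows-legs Gs' no-legs)) u₁ ,
    padded M (length ps') (subst (_≤ M) (sym (trans len-ps' len-ps)) arms≤) (no-arm-found {P} (State.rep st₁) (legs-keep-arms Rs' no-arms)) u₂ ,
    n , reach , settled {qs = qs₀} {ps = ps'} {F = F} valid₀ Rs (State.valid stL) Gs' shF

theorem4p7 : (T : Tableau) → HookValued T → (M N : ℕ) → numArms T ≤ M → numLegs T ≤ N →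
    Σ Tableau (λ P → Σ Filling (λ Q₁ → Σ Filling (λ Q₂ →
    Uncrowd (replicate N ℒ ++ replicate M 𝒜) T P Q₁ ×
    Uncrowd (replicate M 𝒜 ++ replicate N ℒ) T P Q₂ ×
    Shuff Q₁ Q₂)))
theorem4p7 T HV = Main.theorem T HV
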